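{- Assume $c\notin\{a,b\}$. For $i\in\mathbb{Z}\setminus\{1,\dots,N\}$ let $F_i$ be the $F$-polynomial of the Gale–Robinson cluster variable $x_i$. Then for all $j>0$ $$F_{1-j}=\sum_{R\in\mathcal{F}(S^{(j)})}\ \prod_{\lambda\in R}y_{a\lambda_1+b\lambda_2-c\lambda_3-d\lambda_4+(N+1-j)}$$ and $$F_{N+j}=\sum_{I\in J(S^{(j)})}\ \prod_{\lambda\in I}y_{ -a\lambda_1-b\lambda_2+c\lambda_3+d\lambda_4+j}.$$ In particular, under the specialization $x_1=x_2=\cdots=x_N=1$, one has $x_{N+j}=|J(S^{(j)})|$ for $j>0$.
   Context: Fix positive integers $a,b,c,d$ with $a+b=c+d=N$ and $\gcd(a,c,N)=1$. The Gale–Robinson quiver $Q$ has vertex set $\{1,\dots,N\}$; for vertices $i,j$ the number of arrows $i\to j$ equals the number of the following conditions that hold: $j=i+a$; $j=i+b$; $j=i-c$; $j=i-d$; $j=i+a-c$ with $i+a>N$, $i-c<1$; $j=i+a-d$ with $i+a>N$, $i-d<1$; $j=i+b-c$ with $i+b>N$, $i-c<1$; $j=i+b-d$ with $i+b>N$, $i-d<1$. Consider the cluster algebra with initial seed $(Q,(x_1,\dots,x_N))$ (2-cycles of $Q$ being irrelevant for the seed). The Gale–Robinson cluster variables $x_i$, $i>N$ or $i\le0$, are defined by the recurrence $x_ix_{i+N}=x_{i+a}x_{i+N-a}+x_{i+c}x_{i+N-c}$; $x_{N+j}$ ($j>0$) is obtained by the mutation sequence $1,2,\dots,j$ (indices mod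 $N$) and $x_{1-j}$ by $N,N-1,\dots,N-j+1$. $F_i$ denotes the $F$-polynomial (in the sense of Fomin–Zelevinsky, in variables $y_1,\dots,y_N$) of $x_i$ with respect to this initial seed, and each $x_i$ is a Laurent polynomial in $x_1,\dots,x_N$. $S^{(j)}=\{\lambda\in\mathbb{Z}^4:\ j-N\le a\lambda_1+b\lambda_2-c\lambda_3-d\lambda_4\le j-1,\ \lambda_1,\lambda_2\ge0,\ \lambda_3,\lambda_4\le0\}$, a finite poset under the componentwise order. $\mathcal{F}(P)$ is the set of order filters of a poset $P$ (subsets closed upward within $P$) and $J(P)$ the set of order ideals (subsets closed downward within $P$). -}

module Defs where

open import Level using (0ℓ)
open import Data.Bool using (Bool; true; false; if_then_else_; _∨_)
open import Data.Maybe using (Maybe; just; nothing)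
open import Data.Nat as ℕ using (ℕ; zero; suc; _≡ᵇ_)
import Data.Nat.Properties as ℕₚ
open import Data.Integer as ℤ using (ℤ; +_; -[1+_]; ∣_∣)
import Data.Integer.Properties as ℤₚ
open import Data.Product using (_×_; _,_)
open import Data.Product.Properties using (≡-dec)
open import Data.List using (List; []; _∷_; map; filter; concatMap; upTo; foldr; length)
open import Data.List.Relation.Unary.All using (All; all?)
open import Data.List.Membership.DecPropositional using () renaming (_∈?_ to mem?)
open import Data.List.Membership.Propositional using (_∈_)
open import Relation.Nullary using (Dec; does; _×-dec_; _→-dec_)
open import Relation.Binary.PropositionalEquality using (_≡_)
open import Algebra.Structures using (IsAbelianGroup; IsCommutativeSemigroup)
open import Algebra.Definitions using (_DistributesOverˡ_)

-- Semifields (Fomin–Zelevinsky): an abelian multiplicative group with a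
-- commutative, associative addition over which multiplication distributes.
-- F-polynomials are elements of the universal semifield Qsf(y); an identity
-- between subtraction-free rational expressions holds in Qsf(y) iff it holds
-- in every semifield under every assignment of the generators.

record Semifield : Set₁ where
  infixl 6 _⊕_
  infixl 7 _⊗_
  field
    Carrier : Set
    _⊕_     : Carrier → Carrier → Carrier
    _⊗_     : Carrier → Carrier → Carrier
    𝟙       : Carrier
    _⁻¹     : Carrier → Carrier
    ⊗-isAbelianGroup         : IsAbelianGroup _≡_ _⊗_ 𝟙 _⁻¹
    ⊕-isCommutativeSemigroup : IsCommutativeSemigroup _≡_ _⊕_
    distribˡ                 : _DistributesOverˡ_ _≡_ _⊗_ _⊕_

ind : ∀ {p} {P : Set p} → Dec P → ℕ
ind P? = if does P? then 1 else 0

[_]₊ : ℤ → ℕ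
[ + n ]₊      = n
[ -[1+ n ] ]₊ = 0

sublists : ∀ {A : Set} → List A → List (List A)
sublists []       = [] ∷ []
sublists (x ∷ xs) = let r = sublists xs in Data.List._++_ r (map (x ∷_) r)

-- The Gale–Robinson quiver on vertices 1..N (N = a + b), vertices as ℕ.

arrows : (a b c d : ℕ) → ℕ → ℕ → ℕ
arrows a b c d i j =
  ind (j ℕ.≟ i ℕ.+ a) ℕ.+ ind (j ℕ.≟ i ℕ.+ b) ℕ.+ ind (i ℕ.≟ j ℕ.+ c) ℕ.+ ind (i ℕ.≟ j ℕ.+ d)
  ℕ.+ wrap a c ℕ.+ wrap a d ℕ.+ wrap b c ℕ.+ wrap b d
  where
  wrap : ℕ → ℕ → ℕ
  wrap u v = ind ((j ℕ.+ v ℕ.≟ i ℕ.+ u) ×-dec (a ℕ.+ b ℕ.<? i ℕ.+ u) ×-dec (i ℕ.≤? v))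

exchB : (a b c d : ℕ) → ℕ → ℕ → ℤ
exchB a b c d i j = + arrows a b c d j i ℤ.- + arrows a b c d i j

-- Matrix mutation (rows/columns indexed by ℕ, only 1..N is relevant)

mutB : ℕ → (ℕ → ℕ → ℤ) → ℕ → ℕ → ℤ
mutB k B i j =
  if (i ≡ᵇ k) ∨ (j ≡ᵇ k) then ℤ.- B i j
  else B i j ℤ.+ + ([ B i k ]₊ ℕ.* [ B k j ]₊) ℤ.- + ([ ℤ.- B i k ]₊ ℕ.* [ ℤ.- B k j ]₊)

-- mutation of the bottom (coefficient) part C of the extended matrix
mutC : ℕ → (ℕ → ℕ → ℤ) → (ℕ → ℕ → ℤ) → ℕ → ℕ → ℤ
mutC k B C i j =
  if j ≡ᵇ k then ℤ.- C i j
  else C i j ℤ.+ + ([ C i k ]₊ ℕ.* [ B k j ]₊) ℤ.- + ([ ℤ.- C i k ]₊ ℕ.* [ ℤ.- B k j ]₊)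

fwdV : ℕ → ℕ → ℕ
fwdV N zero    = 1
fwdV N (suc m) = let k = fwdV N m in if k ≡ᵇ N then 1 else suc k

bwdV : ℕ → ℕ → ℕ
bwdV N zero    = N
bwdV N (suc m) = let k = bwdV N m in if k ≡ᵇ 1 then N else ℕ.pred k

-- F-polynomials (evaluated in a semifield) via principal-coefficient
-- mutation (Fomin–Zelevinsky, Cluster algebras IV, Prop. 5.1).

record FSeed (C : Set) : Set where
  field
    Bm : ℕ → ℕ → ℤ
    Cm : ℕ → ℕ → ℤ     -- coefficient part (c-vectors), Cm row-index = y-index
    Fv : ℕ → C

record XSeed (C : Set) : Set where
  field
    Bm : ℕ → ℕ → ℤ
    Xv : ℕ → C

module _ (P : Semifield) where
  open Semifield P

  pow : Carrier → ℕ → Carrier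
  pow x zero    = 𝟙
  pow x (suc n) = x ⊗ pow x n

  prodTo : ℕ → (ℕ → Carrier) → Carrier
  prodTo zero    f = 𝟙
  prodTo (suc n) f = prodTo n f ⊗ f (suc n)

  prodL : List Carrier → Carrier
  prodL = foldr _⊗_ 𝟙

  -- adjoin a zero to the semifield to sum over possibly empty lists
  _⊕?_ : Maybe Carrier → Maybe Carrier → Maybe Carrier
  just x  ⊕? just z  = just (x ⊕ z)
  just x  ⊕? nothing = just x
  nothing ⊕? m       = m

  sumL : List Carrier → Maybe Carrier
  sumL = foldr (λ x acc → just x ⊕? acc) nothing

  natP : ℕ → Maybe Carrier
  natP zero    = nothing
  natP (suc n) = just 𝟙 ⊕? natP n

  module _ (a b c d : ℕ) (y : ℕ → Carrier) where
    private N = a ℕ.+ b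

    initF : FSeed Carrier
    initF = record
      { Bm = exchB a b c d
      ; Cm = λ i j → if i ≡ᵇ j then + 1 else + 0
      ; Fv = λ _ → 𝟙 }

    mutF : ℕ → FSeed Carrier → FSeed Carrier
    mutF k s = record
      { Bm = mutB k B
      ; Cm = mutC k B C
      ; Fv = λ l → if l ≡ᵇ k then new else F l }
      where
      open FSeed s renaming (Bm to B; Cm to C; Fv to F)
      new : Carrier
      new = (prodTo N (λ i → pow (y i) [ C i k ]₊) ⊗ prodTo N (λ i → pow (F i) [ B i k ]₊)
             ⊕ prodTo N (λ i → pow (y i) [ ℤ.- C i k ]₊) ⊗ prodTo N (λ i → pow (F i) [ ℤ.- B i k ]₊))
            ⊗ (F k ⁻¹)

    seedFwd : ℕ → FSeed Carrier
    seedFwd zero    = initF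
    seedFwd (suc m) = mutF (fwdV N m) (seedFwd m)

    seedBwd : ℕ → FSeed Carrier
    seedBwd zero    = initF
    seedBwd (suc m) = mutF (bwdV N m) (seedBwd m)

    -- F_{N+j} for j > 0 (value at j = 0 is an unused placeholder)
    Fplus : ℕ → Carrier
    Fplus zero    = 𝟙
    Fplus (suc m) = FSeed.Fv (seedFwd (suc m)) (fwdV N m)

    -- F_{1-j} for j > 0 (value at j = 0 is an unused placeholder)
    Fminus : ℕ → Carrier
    Fminus zero    = 𝟙
    Fminus (suc m) = FSeed.Fv (seedBwd (suc m)) (bwdV N m)

  module _ (a b c d : ℕ) (xs : ℕ → Carrier) where
    private N = a ℕ.+ b

    mutX : ℕ → XSeed Carrier → XSeed Carrier
    mutX k s = record
      { Bm = mutB k B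
      ; Xv = λ l → if l ≡ᵇ k then new else X l }
      where
      open XSeed s renaming (Bm to B; Xv to X)
      new : Carrier
      new = (prodTo N (λ i → pow (X i) [ B i k ]₊) ⊕ prodTo N (λ i → pow (X i) [ ℤ.- B i k ]₊))
            ⊗ (X k ⁻¹)

    xseedFwd : ℕ → XSeed Carrier
    xseedFwd zero    = record { Bm = exchB a b c d ; Xv = xs }
    xseedFwd (suc m) = mutX (fwdV N m) (xseedFwd m)

    -- x_{N+j} for j > 0 (value at j = 0 is an unused placeholder)
    xPlus : ℕ → Carrier
    xPlus zero    = 𝟙
    xPlus (suc m) = XSeed.Xv (xseedFwd (suc m)) (fwdV N m)

ℤ⁴ : Set
ℤ⁴ = ℤ × ℤ × ℤ × ℤ

lin : (a b c d : ℕ) → ℤ⁴ → ℤ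
lin a b c d (l₁ , l₂ , l₃ , l₄) = + a ℤ.* l₁ ℤ.+ + b ℤ.* l₂ ℤ.- + c ℤ.* l₃ ℤ.- + d ℤ.* l₄

InS : (a b c d j : ℕ) → ℤ⁴ → Set
InS a b c d j l@(l₁ , l₂ , l₃ , l₄) =
  (+ j ℤ.- + (a ℕ.+ b) ℤ.≤ lin a b c d l) × (lin a b c d l ℤ.≤ + j ℤ.- + 1)
  × (+ 0 ℤ.≤ l₁) × (+ 0 ℤ.≤ l₂) × (l₃ ℤ.≤ + 0) × (l₄ ℤ.≤ + 0)

inS? : (a b c d j : ℕ) → (l : ℤ⁴) → Dec (InS a b c d j l)
inS? a b c d j l@(l₁ , l₂ , l₃ , l₄) =
  (+ j ℤ.- + (a ℕ.+ b) ℤ.≤? lin a b c d l) ×-dec (lin a b c d l ℤ.≤? + j ℤ.- + 1)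
  ×-dec (+ 0 ℤ.≤? l₁) ×-dec (+ 0 ℤ.≤? l₂) ×-dec (l₃ ℤ.≤? + 0) ×-dec (l₄ ℤ.≤? + 0)

_≼_ : ℤ⁴ → ℤ⁴ → Set
(l₁ , l₂ , l₃ , l₄) ≼ (m₁ , m₂ , m₃ , m₄) = (l₁ ℤ.≤ m₁) × (l₂ ℤ.≤ m₂) × (l₃ ℤ.≤ m₃) × (l₄ ℤ.≤ m₄)

_≼?_ : (l m : ℤ⁴) → Dec (l ≼ m)
(l₁ , l₂ , l₃ , l₄) ≼? (m₁ , m₂ , m₃ , m₄) =
  (l₁ ℤ.≤? m₁) ×-dec (l₂ ℤ.≤? m₂) ×-dec (l₃ ℤ.≤? m₃) ×-dec (l₄ ℤ.≤? m₄)

_≟⁴_ : (l m : ℤ⁴) → Dec (l ≡ m)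
_≟⁴_ = ≡-dec ℤ._≟_ (≡-dec ℤ._≟_ (≡-dec ℤ._≟_ ℤ._≟_))

-- candidate box: every λ ∈ S^(j) has 0 ≤ λ₁,λ₂ ≤ j and -j ≤ λ₃,λ₄ ≤ 0
-- (since a,b,c,d ≥ 1 and all four summands of lin are ≥ 0)
box : ℕ → List ℤ⁴
box j =
  concatMap (λ p → concatMap (λ q → concatMap (λ r → map (λ s → (+ p , + q , ℤ.- + r , ℤ.- + s))
    (upTo (suc j))) (upTo (suc j))) (upTo (suc j))) (upTo (suc j))

-- S^(j) as a duplicate-free list
Sj : (a b c d j : ℕ) → List ℤ⁴
Sj a b c d j = filter (inS? a b c d j) (box j)

IsFilter : List ℤ⁴ → List ℤ⁴ → Set
IsFilter P R = All (λ x → All (λ z → x ≼ z → z ∈ R) P) R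

IsIdeal : List ℤ⁴ → List ℤ⁴ → Set
IsIdeal P I = All (λ x → All (λ z → z ≼ x → z ∈ I) P) I

isFilter? : (P R : List ℤ⁴) → Dec (IsFilter P R)
isFilter? P R = all? (λ x → all? (λ z → (x ≼? z) →-dec mem? _≟⁴_ z R) P) R

isIdeal? : (P I : List ℤ⁴) → Dec (IsIdeal P I)
isIdeal? P I = all? (λ x → all? (λ z → (z ≼? x) →-dec mem? _≟⁴_ z I) P) I

-- 𝓕(S^(j)) and J(S^(j)), each subset listed exactly once
filtersS : (a b c d j : ℕ) → List (List ℤ⁴)
filtersS a b c d j = filter (isFilter? (Sj a b c d j)) (sublists (Sj a b c d j))

idealsS : (a b c d j : ℕ) → List (List ℤ⁴)
idealsS a b c d j = filter (isIdeal? (Sj a b c d j)) (sublists (Sj a b c d j))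

filterSum : (P : Semifield) (a b c d : ℕ) (y : ℕ → Semifield.Carrier P) (j : ℕ) → Maybe (Semifield.Carrier P)
filterSum P a b c d y j =
  sumL P (map (λ R → prodL P (map (λ l → y ∣ lin a b c d l ℤ.+ (+ (a ℕ.+ b ℕ.+ 1) ℤ.- + j) ∣) R))
              (filtersS a b c d j))

idealSum : (P : Semifield) (a b c d : ℕ) (y : ℕ → Semifield.Carrier P) (j : ℕ) → Maybe (Semifield.Carrier P)
idealSum P a b c d y j =
  sumL P (map (λ I → prodL P (map (λ l → y ∣ ℤ.- lin a b c d l ℤ.+ + j ∣) I))
              (idealsS a b c d j))

{-# OPTIONS --safe #-}
-- The quiver is invariant under the rotation that moves the mutated vertex to the end. Hence the cluster
-- variable x_{N+j} is x_{N+j-1} computed from the initial seed mutated at its first vertex. On F-polynomials this reads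
--   F_{N+j}(y) = (1 + y₁)^K F_{N+j-1}(y′),   K = #{(r , s) ∈ ℕ² : c r + d s = j - 1},
-- with y′ the mutated coefficients; it follows from the exchange relation by induction, as the c-vectors of
-- the mutated vertices have the nonnegative entries #{(r , s) ∈ ℕ² : c r + d s + i = t}.
-- The sums over order ideals satisfy the same recursion: passing from S⁽ʲ⁾ to S⁽ʲ⁻¹⁾ replaces the points of maximal weight
-- by points of minimal weight. Given the rest of an ideal, the points of such a layer can be summed out one by
-- one, and the resulting factors 1 + y₁ and y₁ / (1 + y₁) turn the weights y into y′.
-- The reflection i ↦ N + 1 - i exchanges {a , b} with {c , d}, which gives F_{1-j} from F_{N+j}.
module Submission where

open import Defs
open import Data.Nat using (ℕ; _<_; _+_)
open import Data.Nat.GCD using (gcd)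
open import Data.Maybe using (just)
open import Data.List using (length)
open import Data.Product using (_×_)
open import Relation.Binary.PropositionalEquality using (_≡_; _≢_)

open import Level using (0ℓ)
open import Algebra.Bundles using (CommutativeMonoid)
open import Algebra.Structures using (IsAbelianGroup; IsCommutativeSemigroup)
open import Data.Bool using (Bool; true; false; if_then_else_; _∨_; _∧_; not)
open import Data.Bool.ListAction using (all; any)
open import Data.Bool.Properties using (∨-zeroʳ; ∨-comm; ∨-assoc) renaming (_≟_ to _≟ᵇ_)
open import Data.Empty using (⊥-elim)
open import Data.Integer as ℤ using (ℤ; +_; ∣_∣; +≤+)
import Data.Integer.Properties as ℤₚ
import Data.Integer.Solver as ℤSolver
open import Data.List using (List; []; _∷_; _++_; map; filter; foldr; upTo; concatMap; cartesianProduct)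
open import Data.List.Membership.Propositional using (_∈_; _∉_)
open import Data.List.Membership.Propositional.Properties
open import Data.List.Membership.Propositional.Properties.WithK using (unique∧set⇒bag)
open import Data.List.Properties using (map-∘; map-++; concatMap-cong)
open import Data.List.Relation.Binary.BagAndSetEquality using (∼bag⇒↭)
open import Data.List.Relation.Binary.Permutation.Propositional as ↭ using (_↭_; ↭-sym; ↭⇒↭ₛ)
import Data.List.Relation.Binary.Permutation.Propositional.Properties as ↭ₚ
import Data.List.Relation.Binary.Permutation.Setoid.Properties as ↭ₛₚ
open import Data.List.Relation.Unary.All as All using (All; all?)
open import Data.List.Relation.Unary.AllPairs using ([]; _∷_)
open import Data.List.Relation.Unary.Any using (here; there)
open import Data.List.Relation.Unary.Unique.Propositional using (Unique)
import Data.List.Relation.Unary.Unique.Propositional.Properties as Uniqueₚ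
open import Data.Maybe using (Maybe; nothing)
open import Data.Nat as ℕ
  using (zero; suc; pred; _*_; _∸_; _≤_; z≤n; s≤s; s≤s⁻¹; z<s; _≟_; _<?_; _≤?_; _≡ᵇ_)
open import Data.Nat.ListAction using (sum)
open import Data.Nat.ListAction.Properties using (sum-↭)
open import Data.Nat.Properties
open import Data.Nat.Solver using (module +-*-Solver)
open import Data.Product using (_,_; proj₁; proj₂; ∃; ∃₂)
open import Data.Product.Properties using (≡-dec)
open import Data.Sum using (_⊎_; inj₁; inj₂; [_,_]′)
open import Function using (_∘_; mk⇔)
open import Relation.Binary using (DecidableEquality)
open import Relation.Binary.Definitions using (tri<; tri≈; tri>)
open import Relation.Binary.PropositionalEquality
open import Relation.Nullary using (Dec; yes; no; ¬_; does; _×-dec_; _→-dec_)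
open import Relation.Nullary.Decidable using (map′; does-⇔; dec-true; dec-false)
open import Relation.Unary using (Decidable)

-- The Gale–Robinson quiver is invariant under mutation followed by rotation

-- The exchange relation is quadratic in the cluster variables, so checking it directly on the sums
-- over ideals would mean matching pairs of ideals. A change of initial seed relates one
-- F-polynomial to one F-polynomial, and the recursion becomes linear. The price is that `y` changes
-- at every step, so everything is proved for all `y`, in an arbitrary semifield: division and
-- cancellation are available, subtraction and zero are not. The numbers K are the coefficients of 1
-- / ((1 - x^c)(1 - x^d)), and their recurrence is the expansion 1 - x^c - x^d + x^N of the
-- denominator, where c + d = N. On the side of the posets, K counts the points of the top layer
-- with p = q = 0: these have no lower neighbour, so nothing prevents them from joining an ideal.
-- The remaining contributions of the top and of the bottom layer match because a top point and its
-- translate by -(1,1,0,0) share two neighbours, which are lower for the one and upper for the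
-- other, and (u ∧ v) + (u ∨ v) = u + v; likewise in the last two coordinates.

ind-yes : ∀ {p} {P : Set p} (P? : Dec P) → P → ind P? ≡ 1
ind-yes P? p rewrite dec-true P? p = refl

ind-no : ∀ {p} {P : Set p} (P? : Dec P) → ¬ P → ind P? ≡ 0
ind-no P? ¬p rewrite dec-false P? ¬p = refl

ind-cong : ∀ {p q} {P : Set p} {Q : Set q} (P? : Dec P) (Q? : Dec Q) →
           (P → Q) → (Q → P) → ind P? ≡ ind Q?
ind-cong (yes p) Q? f g = sym (ind-yes Q? (f p))
ind-cong (no ¬p) Q? f g = sym (ind-no Q? (λ q → ¬p (g q)))

ind-× : ∀ {p q} {P : Set p} {Q : Set q} (P? : Dec P) (Q? : Dec Q) →
        ind (P? ×-dec Q?) ≡ ind P? * ind Q?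
ind-× (yes p) (yes q) = refl
ind-× (yes p) (no ¬q) = refl
ind-× (no ¬p) Q?      = refl

+-cong₈ : ∀ {p q r s t u v w p′ q′ r′ s′ t′ u′ v′ w′} → p ≡ p′ → q ≡ q′ → r ≡ r′ → s ≡ s′ → t ≡ t′ → u ≡ u′ → v ≡ v′ → w ≡ w′ →
          p + q + r + s + t + u + v + w ≡ p′ + q′ + r′ + s′ + t′ + u′ + v′ + w′
+-cong₈ refl refl refl refl refl refl refl refl = refl

module Wrap (N : ℕ) where
  wrapInd : (u v i j : ℕ) → ℕ
  wrapInd u v i j = ind ((j + v ≟ i + u) ×-dec (N <? i + u) ×-dec (i ≤? v))

  -- On the diagonal j + v = i + u the wrap-around arrows are present for N - u < i ≤ v, an interval
  -- that is nonempty exactly when N < u + v. `enter` marks the place just before its first point,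
  -- `leave` marks its last point.
  enter leave : (u v x z : ℕ) → ℕ
  enter u v x z = ind ((x + u ≟ N) ×-dec (z + v ≟ N) ×-dec (N <? u + v))
  leave u v x z = ind ((x ≟ v) ×-dec (z ≟ u) ×-dec (N <? u + v))

  wrap-shift : ∀ u v x z → wrapInd u v x z + enter u v x z ≡ wrapInd u v (suc x) (suc z) + leave u v x z
  wrap-shift u v x z with z + v ≟ x + u
  ... | no ¬e = trans (cong₂ _+_ (ind-no new? (λ p → ¬e (proj₁ p)))
                                 (ind-no enter? λ { (p , q , _) → ¬e (trans q (sym p)) }))
                (sym (cong₂ _+_ (ind-no old? (λ p → ¬e (suc-injective (proj₁ p))))
                                (ind-no leave? λ { (refl , refl , _) → ¬e (+-comm z x) })))
    where
    new?   = (z + v ≟ x + u) ×-dec (N <? x + u) ×-dec (x ≤? v)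
    old?   = (suc z + v ≟ suc x + u) ×-dec (N <? suc x + u) ×-dec (suc x ≤? v)
    enter? = (x + u ≟ N) ×-dec (z + v ≟ N) ×-dec (N <? u + v)
    leave? = (x ≟ v) ×-dec (z ≟ u) ×-dec (N <? u + v)
  ... | yes e with N <? u + v
  ... | no N≮ = trans (cong₂ _+_ (ind-no new? λ { (_ , p , q) → N≮ (≤-trans p (bound q)) })
                                 (ind-no enter? λ { (_ , _ , p) → N≮ p }))
                (sym (cong₂ _+_ (ind-no old? λ { (_ , p , q) → N≮ (≤-trans p (bound q)) })
                                (ind-no leave? λ { (_ , _ , p) → N≮ p })))
    where
    new?   = (z + v ≟ x + u) ×-dec (N <? x + u) ×-dec (x ≤? v)
    old?   = (suc z + v ≟ suc x + u) ×-dec (N <? suc x + u) ×-dec (suc x ≤? v)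
    enter? = (x + u ≟ N) ×-dec (z + v ≟ N) ×-dec (N <? u + v)
    leave? = (x ≟ v) ×-dec (z ≟ u) ×-dec (N <? u + v)
    bound : ∀ {k} → k ≤ v → k + u ≤ u + v
    bound k≤v = ≤-trans (+-monoˡ-≤ u k≤v) (≤-reflexive (+-comm v u))
  ... | yes N<uv = trans (cong₂ _+_ new≡ enter≡) (trans balance (sym (cong₂ _+_ old≡ leave≡)))
    where
    new?   = (z + v ≟ x + u) ×-dec (N <? x + u) ×-dec (x ≤? v)
    old?   = (suc z + v ≟ suc x + u) ×-dec (N <? suc x + u) ×-dec (suc x ≤? v)
    enter? = (x + u ≟ N) ×-dec (z + v ≟ N) ×-dec (N <? u + v)
    leave? = (x ≟ v) ×-dec (z ≟ u) ×-dec (N <? u + v)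
    new≡ : ind new? ≡ ind ((N <? x + u) ×-dec (x ≤? v))
    new≡ = ind-cong new? ((N <? x + u) ×-dec (x ≤? v)) proj₂ (e ,_)
    old≡ : ind old? ≡ ind ((N ≤? x + u) ×-dec (x <? v))
    old≡ = ind-cong old? ((N ≤? x + u) ×-dec (x <? v)) (λ { (_ , s≤s p , q) → p , q }) (λ { (p , q) → cong suc e , s≤s p , q })
    enter≡ : ind enter? ≡ ind (x + u ≟ N)
    enter≡ = ind-cong enter? (x + u ≟ N) proj₁ (λ p → p , trans e p , N<uv)
    leave≡ : ind leave? ≡ ind (x ≟ v)
    leave≡ = ind-cong leave? (x ≟ v) proj₁ (λ { refl → refl , +-cancelʳ-≡ x z u (trans e (+-comm x u)) , N<uv })
    N≤⇒ : ∀ {k} → v ≤ k → N < k + u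
    N≤⇒ v≤k = ≤-trans N<uv (≤-trans (≤-reflexive (+-comm u v)) (+-monoˡ-≤ u v≤k))
    balance : ind ((N <? x + u) ×-dec (x ≤? v)) + ind (x + u ≟ N) ≡ ind ((N ≤? x + u) ×-dec (x <? v)) + ind (x ≟ v)
    balance with <-cmp N (x + u)
    balance | tri> N≮ N≢ N> =
      trans (cong₂ _+_ (ind-no ((N <? x + u) ×-dec (x ≤? v)) (λ p → N≮ (proj₁ p))) (ind-no (x + u ≟ N) (λ p → N≢ (sym p))))
        (sym (cong₂ _+_ (ind-no ((N ≤? x + u) ×-dec (x <? v)) (λ p → <⇒≱ N> (proj₁ p)))
                        (ind-no (x ≟ v) (λ p → N≮ (N≤⇒ (≤-reflexive (sym p)))))))
    balance | tri≈ N≮ N≡ _ =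
      trans (cong₂ _+_ (ind-no ((N <? x + u) ×-dec (x ≤? v)) (λ p → N≮ (proj₁ p))) (ind-yes (x + u ≟ N) (sym N≡)))
        (sym (cong₂ _+_ (ind-yes ((N ≤? x + u) ×-dec (x <? v)) (≤-reflexive N≡ , ≰⇒> (λ v≤x → N≮ (N≤⇒ v≤x))))
                        (ind-no (x ≟ v) (λ p → N≮ (N≤⇒ (≤-reflexive (sym p)))))))
    balance | tri< N< N≢ _ with <-cmp x v
    ... | tri< x<v x≢v _ =
      trans (cong₂ _+_ (ind-yes ((N <? x + u) ×-dec (x ≤? v)) (N< , <⇒≤ x<v)) (ind-no (x + u ≟ N) (λ p → N≢ (sym p))))
        (sym (cong₂ _+_ (ind-yes ((N ≤? x + u) ×-dec (x <? v)) (<⇒≤ N< , x<v)) (ind-no (x ≟ v) x≢v)))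
    ... | tri≈ x≮v x≡v _ =
      trans (cong₂ _+_ (ind-yes ((N <? x + u) ×-dec (x ≤? v)) (N< , ≤-reflexive x≡v)) (ind-no (x + u ≟ N) (λ p → N≢ (sym p))))
        (sym (cong₂ _+_ (ind-no ((N ≤? x + u) ×-dec (x <? v)) (λ p → x≮v (proj₂ p))) (ind-yes (x ≟ v) x≡v)))
    ... | tri> x≮v x≢v v<x =
      trans (cong₂ _+_ (ind-no ((N <? x + u) ×-dec (x ≤? v)) (λ p → <⇒≱ v<x (proj₂ p))) (ind-no (x + u ≟ N) (λ p → N≢ (sym p))))
        (sym (cong₂ _+_ (ind-no ((N ≤? x + u) ×-dec (x <? v)) (λ p → x≮v (proj₂ p))) (ind-no (x ≟ v) x≢v)))

  -- From (u + v) + (u′ + v′) = 2N and u + v ≠ N it follows that exactly one of the two sums exceeds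
  -- N, so exactly one of the two indicators is live, and both then test the same point. The
  -- condition c ∉ {a , b} supplies u + v ≠ N for u in {a , b} and v in {c , d}.
  leave+enter : ∀ u v u′ v′ x z → u + u′ ≡ N → v + v′ ≡ N → u + v ≢ N →
                leave u v z x + enter u′ v′ x z ≡ ind (x ≟ u) * ind (z ≟ v)
  leave+enter u v u′ v′ x z uu′ vv′ u+v≢N = trans (cong₂ _+_ l≡ e≡) split
    where
    leave? = (z ≟ v) ×-dec (x ≟ u) ×-dec (N <? u + v)
    enter? = (x + u′ ≟ N) ×-dec (z + v′ ≟ N) ×-dec (N <? u′ + v′)
    prod? = (x ≟ u) ×-dec (z ≟ v)
    sum≡ : (u + v) + (u′ + v′) ≡ N + N
    sum≡ = trans (solve 4 (λ a b c d → (a :+ b) :+ (c :+ d) := (a :+ c) :+ (b :+ d)) refl u v u′ v′) (cong₂ _+_ uu′ vv′)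
      where open +-*-Solver
    flip< : N < u′ + v′ → ¬ N < u + v
    flip< p q = <⇒≢ (+-mono-< q p) (sym sum≡)
    flip≮ : ¬ N < u + v → N < u′ + v′
    flip≮ p with N <? u′ + v′
    ... | yes q = q
    ... | no q = ⊥-elim (<⇒≢ (+-mono-<-≤ (≤∧≢⇒< (≮⇒≥ p) u+v≢N) (≮⇒≥ q)) sum≡)
    l≡ : ind leave? ≡ ind (prod? ×-dec (N <? u + v))
    l≡ = ind-cong leave? (prod? ×-dec (N <? u + v)) (λ { (p , q , r) → (q , p) , r }) (λ { ((q , p) , r) → p , q , r })
    e≡ : ind enter? ≡ ind (prod? ×-dec (N <? u′ + v′))
    e≡ = ind-cong enter? (prod? ×-dec (N <? u′ + v′))
           (λ { (p , q , r) → (+-cancelʳ-≡ u′ x u (trans p (sym uu′)) , +-cancelʳ-≡ v′ z v (trans q (sym vv′))) , r })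
           (λ { ((refl , refl) , r) → uu′ , vv′ , r })
    split : ind (prod? ×-dec (N <? u + v)) + ind (prod? ×-dec (N <? u′ + v′)) ≡ ind (x ≟ u) * ind (z ≟ v)
    split with N <? u + v
    ... | yes p = trans (cong₂ _+_ (ind-cong (prod? ×-dec (N <? u + v)) prod? proj₁ (_, p))
                                   (ind-no (prod? ×-dec (N <? u′ + v′)) (λ q → flip< (proj₂ q) p)))
                        (trans (+-identityʳ _) (ind-× (x ≟ u) (z ≟ v)))
    ... | no p = trans (cong₂ _+_ (ind-no (prod? ×-dec (N <? u + v)) (λ q → p (proj₂ q)))
                                  (ind-cong (prod? ×-dec (N <? u′ + v′)) prod? proj₁ (_, flip≮ p)))
                       (ind-× (x ≟ u) (z ≟ v))

  wrap-N : ∀ {u v} z → v < N → wrapInd u v N z ≡ 0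
  wrap-N {u} {v} z v<N = ind-no ((z + v ≟ N + u) ×-dec (N <? N + u) ×-dec (N ≤? v)) (λ p → <⇒≱ v<N (proj₂ (proj₂ p)))

  wrap-to-N : ∀ {u v} x → u < N → wrapInd u v x N ≡ 0
  wrap-to-N {u} {v} x u<N = ind-no ((N + v ≟ x + u) ×-dec (N <? x + u) ×-dec (x ≤? v))
    λ { (e , _ , x≤v) → <⇒≢ (≤-<-trans (+-monoˡ-≤ u x≤v) (≤-<-trans (≤-reflexive (+-comm v u)) (+-monoˡ-< v u<N))) (sym e) }

  wrap-1 : ∀ {u v} z → u < N → wrapInd u v 1 z ≡ 0
  wrap-1 {u} {v} z u<N = ind-no ((z + v ≟ 1 + u) ×-dec (N <? 1 + u) ×-dec (1 ≤? v)) (λ p → <⇒≱ (proj₁ (proj₂ p)) u<N)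

  wrap-to-1 : ∀ {u v} x → v < N → wrapInd u v x 1 ≡ 0
  wrap-to-1 {u} {v} x v<N = ind-no ((1 + v ≟ x + u) ×-dec (N <? x + u) ×-dec (x ≤? v))
    (λ { (e , p , _) → <⇒≱ (subst (N <_) (sym e) p) v<N })

[]₊-⊖ : ∀ m n → m * n ≡ 0 → [ + m ℤ.- + n ]₊ ≡ m
[]₊-⊖ zero zero _ = refl
[]₊-⊖ zero (suc n) _ = refl
[]₊-⊖ (suc m) zero _ = +-identityʳ (suc m)
[]₊-⊖ (suc m) (suc n) ()

⊖-balance : ∀ {A₁ B₁ A₂ B₂ P Q} → A₁ + B₂ + Q ≡ A₂ + B₁ + P →
            + A₁ ℤ.- + B₁ ≡ (+ A₂ ℤ.- + B₂) ℤ.+ + P ℤ.- + Q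
⊖-balance {A₁} {B₁} {A₂} {B₂} {P} {Q} eq = begin
  + A₁ ℤ.- + B₁ ≡⟨ solve 4 (λ x y z w → x :- y := ((x :+ z) :+ w) :- y :- z :- w) refl (+ A₁) (+ B₁) (+ B₂) (+ Q) ⟩
  + (A₁ + B₂ + Q) ℤ.- + B₁ ℤ.- + B₂ ℤ.- + Q ≡⟨ cong (λ t → + t ℤ.- + B₁ ℤ.- + B₂ ℤ.- + Q) eq ⟩
  + (A₂ + B₁ + P) ℤ.- + B₁ ℤ.- + B₂ ℤ.- + Q ≡⟨ solve 5 (λ x y z p q → ((x :+ y) :+ p) :- y :- z :- q := (x :- z) :+ p :- q) refl (+ A₂) (+ B₁) (+ B₂) (+ P) (+ Q) ⟩
  (+ A₂ ℤ.- + B₂) ℤ.+ + P ℤ.- + Q ∎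
  where open ≡-Reasoning
        open ℤSolver.+-*-Solver

⊖-flip : ∀ m n → + m ℤ.- + n ≡ ℤ.- (+ n ℤ.- + m)
⊖-flip m n = solve 2 (λ x y → x :- y := :- (y :- x)) refl (+ m) (+ n)
  where open ℤSolver.+-*-Solver

exchB-antisym : ∀ a b c d i j → exchB a b c d i j ≡ ℤ.- exchB a b c d j i
exchB-antisym a b c d i j = ⊖-flip (arrows a b c d j i) (arrows a b c d i j)

module Quiver (a b c d : ℕ) (a>0 : 0 < a) (b>0 : 0 < b) (c>0 : 0 < c) (d>0 : 0 < d)
              (c+d : c + d ≡ a + b) (c≢a : c ≢ a) (c≢b : c ≢ b) where

  N : ℕ
  N = a + b
  open Wrap N

  -- Positions are counted from 0, so the vertex 1 sits in position 0. `D` counts the arrows from it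
  -- and `G` the arrows into it.
  D G : ℕ → ℕ
  D x = ind (x ≟ a) + ind (x ≟ b)
  G x = ind (x ≟ c) + ind (x ≟ d)

  e : ℕ → ℕ → ℤ
  e i j = exchB a b c d (suc i) (suc j)

  a<N : a < N
  a<N = m<m+n a b>0
  b<N : b < N
  b<N = m<n+m b a>0
  c<N : c < N
  c<N = subst (c <_) c+d (m<m+n c d>0)
  d<N : d < N
  d<N = subst (d <_) c+d (m<n+m d c>0)

  d≢a : d ≢ a
  d≢a refl = c≢b (+-cancelʳ-≡ d c b (trans c+d (+-comm d b)))
  d≢b : d ≢ b
  d≢b refl = c≢a (+-cancelʳ-≡ d c a c+d)

  private
    Ent Lv : ℕ → ℕ → ℕ
    Ent x z = enter a c x z + enter a d x z + enter b c x z + enter b d x z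
    Lv x z = leave a c x z + leave a d x z + leave b c x z + leave b d x z

    arrows-shift : ∀ x z → arrows a b c d x z + Ent x z ≡ arrows a b c d (suc x) (suc z) + Lv x z
    arrows-shift x z =
      trans (regroup h (w a c) (w a d) (w b c) (w b d) (enter a c x z) (enter a d x z) (enter b c x z) (enter b d x z))
      (trans (cong (λ t → h + t) (cong₂ _+_ (cong₂ _+_ (cong₂ _+_ (wrap-shift a c x z) (wrap-shift a d x z)) (wrap-shift b c x z)) (wrap-shift b d x z)))
      (sym (regroup h (w′ a c) (w′ a d) (w′ b c) (w′ b d) (leave a c x z) (leave a d x z) (leave b c x z) (leave b d x z))))
      where
      h = ind (z ≟ x + a) + ind (z ≟ x + b) + ind (x ≟ z + c) + ind (x ≟ z + d)
      w w′ : ℕ → ℕ → ℕ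
      w u v = wrapInd u v x z
      w′ u v = wrapInd u v (suc x) (suc z)
      open +-*-Solver
      regroup : ∀ h w₁ w₂ w₃ w₄ e₁ e₂ e₃ e₄ → h + w₁ + w₂ + w₃ + w₄ + (e₁ + e₂ + e₃ + e₄) ≡ h + (w₁ + e₁ + (w₂ + e₂) + (w₃ + e₃) + (w₄ + e₄))
      regroup = solve 9 (λ h w₁ w₂ w₃ w₄ e₁ e₂ e₃ e₄ → h :+ w₁ :+ w₂ :+ w₃ :+ w₄ :+ (e₁ :+ e₂ :+ e₃ :+ e₄) := h :+ (w₁ :+ e₁ :+ (w₂ :+ e₂) :+ (w₃ :+ e₃) :+ (w₄ :+ e₄))) refl

    -- Each `leave` for (u , v) is paired with the `enter` for (N - u , N - v); the four pairs give
    -- the four products of the expansion.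
    Lv+Ent : ∀ x z → Lv z x + Ent x z ≡ D x * G z
    Lv+Ent x z =
      trans (regroup (leave a c z x) (leave a d z x) (leave b c z x) (leave b d z x) (enter a c x z) (enter a d x z) (enter b c x z) (enter b d x z))
      (trans (cong₂ _+_ (cong₂ _+_ (cong₂ _+_
        (leave+enter a c b d x z refl c+d (λ p → c≢b (+-cancelˡ-≡ a c b p)))
        (leave+enter a d b c x z refl (trans (+-comm d c) c+d) (λ p → d≢b (+-cancelˡ-≡ a d b p))))
        (leave+enter b c a d x z (+-comm b a) c+d (λ p → c≢a (+-cancelˡ-≡ b c a (trans p (+-comm a b))))))
        (leave+enter b d a c x z (+-comm b a) (trans (+-comm d c) c+d) (λ p → d≢a (+-cancelˡ-≡ b d a (trans p (+-comm a b))))))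
      (expand (ind (x ≟ a)) (ind (x ≟ b)) (ind (z ≟ c)) (ind (z ≟ d))))
      where
      open +-*-Solver
      regroup : ∀ l₁ l₂ l₃ l₄ e₁ e₂ e₃ e₄ → l₁ + l₂ + l₃ + l₄ + (e₁ + e₂ + e₃ + e₄) ≡ l₁ + e₄ + (l₂ + e₃) + (l₃ + e₂) + (l₄ + e₁)
      regroup = solve 8 (λ l₁ l₂ l₃ l₄ e₁ e₂ e₃ e₄ → l₁ :+ l₂ :+ l₃ :+ l₄ :+ (e₁ :+ e₂ :+ e₃ :+ e₄) := l₁ :+ e₄ :+ (l₂ :+ e₃) :+ (l₃ :+ e₂) :+ (l₄ :+ e₁)) refl
      expand : ∀ p q r s → p * r + p * s + q * r + q * s ≡ (p + q) * (r + s)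
      expand = solve 4 (λ p q r s → p :* r :+ p :* s :+ q :* r :+ q :* s := (p :+ q) :* (r :+ s)) refl

  -- The correction is that of a matrix mutation at the vertex 1, because `e x 0` has positive part
  -- `D x` and negative part `G x`. Mutation followed by lowering the labels by one therefore gives
  -- back the same matrix.
  exchB-shift : ∀ x z → exchB a b c d x z ≡ e x z ℤ.+ + (D x * G z) ℤ.- + (G x * D z)
  -- `arrows-shift` contains no subtraction, so `Ent z x` is added to both sides before it can be
  -- applied.
  exchB-shift x z = ⊖-balance {A₁} {B₁} {A₂} {B₂} {D x * G z} {G x * D z} (+-cancelʳ-≡ (Ent z x) _ _ (begin
    A₁ + B₂ + G x * D z + Ent z x ≡⟨ cong (λ t → A₁ + B₂ + t + Ent z x) (trans (*-comm (G x) (D z)) (sym (Lv+Ent z x))) ⟩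
    A₁ + B₂ + (Lv x z + Ent z x) + Ent z x ≡⟨ solve 4 (λ p q l e → p :+ q :+ (l :+ e) :+ e := (p :+ e) :+ (q :+ l) :+ e) refl A₁ B₂ (Lv x z) (Ent z x) ⟩
    (A₁ + Ent z x) + (B₂ + Lv x z) + Ent z x ≡⟨ cong₂ (λ s t → s + t + Ent z x) (arrows-shift z x) (sym (arrows-shift x z)) ⟩
    (A₂ + Lv z x) + (B₁ + Ent x z) + Ent z x ≡⟨ solve 5 (λ p l q e f → (p :+ l) :+ (q :+ e) :+ f := p :+ q :+ (l :+ e) :+ f) refl A₂ (Lv z x) B₁ (Ent x z) (Ent z x) ⟩
    A₂ + B₁ + (Lv z x + Ent x z) + Ent z x ≡⟨ cong (λ t → A₂ + B₁ + t + Ent z x) (Lv+Ent x z) ⟩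
    A₂ + B₁ + D x * G z + Ent z x ∎))
    where
    open ≡-Reasoning
    open +-*-Solver
    A₁ = arrows a b c d z x
    B₁ = arrows a b c d x z
    A₂ = arrows a b c d (suc z) (suc x)
    B₂ = arrows a b c d (suc x) (suc z)

  private
    0-4 : ∀ p q → p + q + 0 + 0 + 0 + 0 + 0 + 0 ≡ p + q
    0-4 p q = solve 2 (λ p q → p :+ q :+ con 0 :+ con 0 :+ con 0 :+ con 0 :+ con 0 :+ con 0 := p :+ q) refl p q
      where open +-*-Solver

    4-0 : ∀ p q → p + q + 0 + 0 + 0 + 0 ≡ p + q
    4-0 p q = solve 2 (λ p q → p :+ q :+ con 0 :+ con 0 :+ con 0 :+ con 0 := p :+ q) refl p q
      where open +-*-Solver

    x≢x+ : ∀ {m n k} → m ≤ n → 0 < k → m ≢ n + k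
    x≢x+ m≤n 0<k = <⇒≢ (≤-<-trans m≤n (m<m+n _ 0<k))

    ind-compl : ∀ {u u′} x → u + u′ ≡ N → ind (N ≟ x + u) ≡ ind (x ≟ u′)
    ind-compl {u} {u′} x uu′ = ind-cong (N ≟ x + u) (x ≟ u′)
      (λ p → +-cancelʳ-≡ u x u′ (trans (sym p) (trans (sym uu′) (+-comm u u′))))
      (λ { refl → trans (sym uu′) (+-comm u u′) })

    -- Going down from N by c arrives at d, and by d at c, since c + d = N. Hence the neighbours of
    -- N are those of the vertex 1 lowered by one, with all arrows reversed.
    from-N : ∀ x → x ≤ N → arrows a b c d N x ≡ G x
    from-N x x≤N = trans (+-cong₈
      (ind-no (x ≟ N + a) (x≢x+ x≤N a>0)) (ind-no (x ≟ N + b) (x≢x+ x≤N b>0))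
      (ind-compl x c+d) (ind-compl x (trans (+-comm d c) c+d))
      (wrap-N {a} x c<N) (wrap-N {a} x d<N) (wrap-N {b} x c<N) (wrap-N {b} x d<N))
      (trans (4-0 (ind (x ≟ d)) (ind (x ≟ c))) (+-comm (ind (x ≟ d)) _))

    to-N : ∀ x → x ≤ N → arrows a b c d x N ≡ D x
    to-N x x≤N = trans (+-cong₈
      (ind-compl x refl) (ind-compl x (+-comm b a))
      (ind-no (x ≟ N + c) (x≢x+ x≤N c>0)) (ind-no (x ≟ N + d) (x≢x+ x≤N d>0))
      (wrap-to-N {a} {c} x a<N) (wrap-to-N {a} {d} x a<N) (wrap-to-N {b} {c} x b<N) (wrap-to-N {b} {d} x b<N))
      (trans (0-4 (ind (x ≟ b)) (ind (x ≟ a))) (+-comm (ind (x ≟ b)) _))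

    from-1 : ∀ x → arrows a b c d 1 (suc x) ≡ D x
    from-1 x = trans (+-cong₈ {p = ind (x ≟ a)} {q = ind (x ≟ b)} refl refl
      (ind-no (1 ≟ suc x + c) (x≢x+ (s≤s z≤n) c>0)) (ind-no (1 ≟ suc x + d) (x≢x+ (s≤s z≤n) d>0))
      (wrap-1 {a} {c} (suc x) a<N) (wrap-1 {a} {d} (suc x) a<N) (wrap-1 {b} {c} (suc x) b<N) (wrap-1 {b} {d} (suc x) b<N))
      (0-4 (ind (x ≟ a)) (ind (x ≟ b)))

    to-1 : ∀ x → arrows a b c d (suc x) 1 ≡ G x
    to-1 x = trans (+-cong₈ {r = ind (x ≟ c)} {s = ind (x ≟ d)}
      (ind-no (1 ≟ suc x + a) (x≢x+ (s≤s z≤n) a>0)) (ind-no (1 ≟ suc x + b) (x≢x+ (s≤s z≤n) b>0))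
      refl refl
      (wrap-to-1 {a} {c} (suc x) c<N) (wrap-to-1 {a} {d} (suc x) d<N) (wrap-to-1 {b} {c} (suc x) c<N) (wrap-to-1 {b} {d} (suc x) d<N))
      (4-0 (ind (x ≟ c)) (ind (x ≟ d)))

    -- No 2-cycle passes through the vertex 1, because {a , b} and {c , d} are disjoint. So the
    -- positive and negative parts of its row and column are read off without cancellation.
    DG : ∀ x → D x * G x ≡ 0
    DG x with x ≟ c | x ≟ d
    ... | no x≢c | no x≢d = trans (cong (λ t → D x * t) (cong₂ _+_ (ind-no (x ≟ c) x≢c) (ind-no (x ≟ d) x≢d))) (*-zeroʳ (D x))
    ... | yes refl | _ rewrite ind-no (c ≟ a) c≢a | ind-no (c ≟ b) c≢b = refl
    ... | no _ | yes refl rewrite ind-no (d ≟ a) d≢a | ind-no (d ≟ b) d≢b = refl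

  e-row : ∀ j → e 0 j ≡ + G j ℤ.- + D j
  e-row j = cong₂ (λ s t → + s ℤ.- + t) (to-1 j) (from-1 j)

  e-col : ∀ i → e i 0 ≡ + D i ℤ.- + G i
  e-col i = cong₂ (λ s t → + s ℤ.- + t) (from-1 i) (to-1 i)

  e-row₊ : ∀ j → [ e 0 j ]₊ ≡ G j
  e-row₊ j = trans (cong [_]₊ (e-row j)) ([]₊-⊖ (G j) (D j) (trans (*-comm (G j) (D j)) (DG j)))

  e-row₋ : ∀ j → [ ℤ.- e 0 j ]₊ ≡ D j
  e-row₋ j = trans (cong [_]₊ (sym (exchB-antisym a b c d (suc j) 1))) (trans (cong [_]₊ (e-col j)) ([]₊-⊖ (D j) (G j) (DG j)))

  e-col₊ : ∀ i → [ e i 0 ]₊ ≡ D i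
  e-col₊ i = trans (cong [_]₊ (e-col i)) ([]₊-⊖ (D i) (G i) (DG i))

  e-col₋ : ∀ i → [ ℤ.- e i 0 ]₊ ≡ G i
  e-col₋ i = trans (cong [_]₊ (sym (exchB-antisym a b c d 1 (suc i)))) (e-row₊ i)

  exchB-N-row : ∀ x → x ≤ N → exchB a b c d N x ≡ ℤ.- e 0 x
  exchB-N-row x x≤N = trans (cong₂ (λ s t → + s ℤ.- + t) (to-N x x≤N) (from-N x x≤N))
    (trans (⊖-flip (D x) (G x)) (cong ℤ.-_ (sym (e-row x))))

  exchB-N-col : ∀ x → x ≤ N → exchB a b c d x N ≡ ℤ.- e x 0
  exchB-N-col x x≤N = trans (exchB-antisym a b c d x N) (cong ℤ.-_ (trans (exchB-N-row x x≤N) (sym (exchB-antisym a b c d (suc x) 1))))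

  exchB-diag : ∀ x → exchB a b c d x x ≡ + 0
  exchB-diag x = ℤₚ.+-inverseʳ (+ arrows a b c d x x)

-- Finite sums and lattice points

unique-↭ : ∀ {A : Set} {xs ys : List A} → Unique xs → Unique ys →
           (∀ {x} → x ∈ xs → x ∈ ys) → (∀ {x} → x ∈ ys → x ∈ xs) → xs ↭ ys
unique-↭ u v f g = ∼bag⇒↭ (unique∧set⇒bag u v (mk⇔ f g))

∑ : ∀ {A : Set} → List A → (A → ℕ) → ℕ
∑ xs f = sum (map f xs)

∑-cong : ∀ {A : Set} {f g : A → ℕ} xs → (∀ {x} → x ∈ xs → f x ≡ g x) → ∑ xs f ≡ ∑ xs g
∑-cong []       h = refl
∑-cong (x ∷ xs) h = cong₂ _+_ (h (here refl)) (∑-cong xs (h ∘ there))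

∑-+ : ∀ {A : Set} (f g : A → ℕ) xs → ∑ xs (λ x → f x + g x) ≡ ∑ xs f + ∑ xs g
∑-+ f g []       = refl
∑-+ f g (x ∷ xs) = trans (cong (λ t → f x + g x + t) (∑-+ f g xs))
  (solve 4 (λ p q r s → p :+ q :+ (r :+ s) := (p :+ r) :+ (q :+ s)) refl (f x) (g x) (∑ xs f) (∑ xs g))
  where open +-*-Solver

∑-filter : ∀ {A : Set} {P : A → Set} (P? : Decidable P) (f : A → ℕ) xs →
           ∑ xs (λ x → ind (P? x) * f x) ≡ ∑ (filter P? xs) f
∑-filter P? f []       = refl
∑-filter P? f (x ∷ xs) with P? x
... | yes _ = cong₂ _+_ (+-identityʳ (f x)) (∑-filter P? f xs)
... | no  _ = ∑-filter P? f xs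

-- Conditions are kept as indicator factors over a fixed list, so that sums under different
-- conditions can afterwards be added term by term. The map `φ` only has to match the points
-- satisfying the two conditions.
∑-reindex : ∀ {A B : Set} {P : A → Set} {Q : B → Set} (P? : Decidable P) (Q? : Decidable Q)
            {xs : List A} {ys : List B} (F : A → ℕ) (G : B → ℕ) (φ : A → B) →
            (∀ {x y} → φ x ≡ φ y → x ≡ y) → Unique xs → Unique ys →
            (∀ {x} → x ∈ xs → P x → φ x ∈ ys × Q (φ x)) →
            (∀ {y} → y ∈ ys → Q y → ∃ λ x → x ∈ xs × P x × φ x ≡ y) →
            (∀ x → F x ≡ G (φ x)) →
            ∑ xs (λ x → ind (P? x) * F x) ≡ ∑ ys (λ y → ind (Q? y) * G y)
∑-reindex P? Q? {xs} {ys} F G φ inj ux uy to from FG = begin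
  ∑ xs (λ x → ind (P? x) * F x)  ≡⟨ ∑-filter P? F xs ⟩
  ∑ (filter P? xs) F             ≡⟨ ∑-cong (filter P? xs) (λ {x} _ → FG x) ⟩
  ∑ (filter P? xs) (G ∘ φ)       ≡⟨ cong sum (map-∘ (filter P? xs)) ⟩
  ∑ (map φ (filter P? xs)) G     ≡⟨ sum-↭ (↭ₚ.map⁺ G (unique-↭ (Uniqueₚ.map⁺ inj (Uniqueₚ.filter⁺ P? ux)) (Uniqueₚ.filter⁺ Q? uy) ⇒ ⇐)) ⟩
  ∑ (filter Q? ys) G             ≡⟨ ∑-filter Q? G ys ⟨
  ∑ ys (λ y → ind (Q? y) * G y)  ∎
  where
  open ≡-Reasoning
  ⇒ : ∀ {y} → y ∈ map φ (filter P? xs) → y ∈ filter Q? ys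
  ⇒ y∈ with ∈-map∘filter⁻ φ P? {f = φ} y∈
  ... | x , x∈ , refl , px = let q∈ , q = to x∈ px in ∈-filter⁺ Q? q∈ q
  ⇐ : ∀ {y} → y ∈ filter Q? ys → y ∈ map φ (filter P? xs)
  ⇐ y∈ with y∈ys , q ← ∈-filter⁻ Q? {xs = ys} y∈ with x , x∈ , px , refl ← from y∈ys q = ∈-map⁺ φ (∈-filter⁺ P? x∈ px)

Pt : Set
Pt = ℕ × ℕ × ℕ × ℕ

abstract
  grid : ℕ → List Pt
  grid n = cartesianProduct (upTo n) (cartesianProduct (upTo n) (cartesianProduct (upTo n) (upTo n)))

  grid-def : ∀ n → grid n ≡ cartesianProduct (upTo n) (cartesianProduct (upTo n) (cartesianProduct (upTo n) (upTo n)))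
  grid-def n = refl

  grid-unique : ∀ n → Unique (grid n)
  grid-unique n = let u = Uniqueₚ.upTo⁺ n in Uniqueₚ.cartesianProduct⁺ u (Uniqueₚ.cartesianProduct⁺ u (Uniqueₚ.cartesianProduct⁺ u u))

  ∈-grid⁺ : ∀ {n p q r s} → p < n → q < n → r < n → s < n → (p , q , r , s) ∈ grid n
  ∈-grid⁺ p q r s = ∈-cartesianProduct⁺ (∈-upTo⁺ p) (∈-cartesianProduct⁺ (∈-upTo⁺ q) (∈-cartesianProduct⁺ (∈-upTo⁺ r) (∈-upTo⁺ s)))

module Points (a b c d N : ℕ) (a>0 : 0 < a) (b>0 : 0 < b) (c>0 : 0 < c) (d>0 : 0 < d)
              (a+b : a + b ≡ N) (c+d : c + d ≡ N) where

  wt : Pt → ℕ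
  wt (p , q , r , s) = a * p + b * q + c * r + d * s

  wt-p : ∀ p q r s → wt (suc p , q , r , s) ≡ wt (p , q , r , s) + a
  wt-p p q r s = solve 8 (λ a b c d p q r s → a :* (con 1 :+ p) :+ b :* q :+ c :* r :+ d :* s := a :* p :+ b :* q :+ c :* r :+ d :* s :+ a) refl a b c d p q r s
    where open +-*-Solver
  wt-q : ∀ p q r s → wt (p , suc q , r , s) ≡ wt (p , q , r , s) + b
  wt-q p q r s = solve 8 (λ a b c d p q r s → a :* p :+ b :* (con 1 :+ q) :+ c :* r :+ d :* s := a :* p :+ b :* q :+ c :* r :+ d :* s :+ b) refl a b c d p q r s
    where open +-*-Solver
  wt-r : ∀ p q r s → wt (p , q , suc r , s) ≡ wt (p , q , r , s) + c
  wt-r p q r s = solve 8 (λ a b c d p q r s → a :* p :+ b :* q :+ c :* (con 1 :+ r) :+ d :* s := a :* p :+ b :* q :+ c :* r :+ d :* s :+ c) refl a b c d p q r s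
    where open +-*-Solver
  wt-s : ∀ p q r s → wt (p , q , r , suc s) ≡ wt (p , q , r , s) + d
  wt-s p q r s = solve 8 (λ a b c d p q r s → a :* p :+ b :* q :+ c :* r :+ d :* (con 1 :+ s) := a :* p :+ b :* q :+ c :* r :+ d :* s :+ d) refl a b c d p q r s
    where open +-*-Solver

  wt-pq : ∀ p q r s → wt (suc p , suc q , r , s) ≡ wt (p , q , r , s) + N
  wt-pq p q r s = trans (wt-p p (suc q) r s) (trans (cong (λ t → t + a) (wt-q p q r s))
    (trans (+-assoc _ b a) (cong (λ t → wt (p , q , r , s) + t) (trans (+-comm b a) a+b))))
  wt-rs : ∀ p q r s → wt (p , q , suc r , suc s) ≡ wt (p , q , r , s) + N
  wt-rs p q r s = trans (wt-r p q r (suc s)) (trans (cong (λ t → t + c) (wt-s p q r s))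
    (trans (+-assoc _ d c) (cong (λ t → wt (p , q , r , s) + t) (trans (+-comm d c) c+d))))

  -- The four coefficients are positive, so no coordinate exceeds the weight.
  ∈-grid : ∀ {n} x → wt x < n → x ∈ grid n
  ∈-grid (p , q , r , s) w<n = ∈-grid⁺
    (≤-<-trans (≤-trans (m≤n* a>0 p) (≤-trans (m≤m+n (a * p) (b * q)) (≤-trans (m≤m+n _ (c * r)) (m≤m+n _ (d * s))))) w<n)
    (≤-<-trans (≤-trans (m≤n* b>0 q) (≤-trans (m≤n+m (b * q) (a * p)) (≤-trans (m≤m+n _ (c * r)) (m≤m+n _ (d * s))))) w<n)
    (≤-<-trans (≤-trans (m≤n* c>0 r) (≤-trans (m≤n+m (c * r) (a * p + b * q)) (m≤m+n _ (d * s)))) w<n)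
    (≤-<-trans (≤-trans (m≤n* d>0 s) (m≤n+m (d * s) (a * p + b * q + c * r))) w<n)
    where
    m≤n* : ∀ {n} → 0 < n → ∀ m → m ≤ n * m
    m≤n* {suc n} _ m = m≤m+n m (n * m)

  -- The pairs (r , s) are represented by points with p = q = 0, so that `K-base` can identify them
  -- with points of a layer of the poset.
  bottom? : (i t : ℕ) → Decidable λ x → wt x + i ≡ t × proj₁ x ≡ 0 × proj₁ (proj₂ x) ≡ 0
  bottom? i t x = (wt x + i ≟ t) ×-dec (proj₁ x ≟ 0) ×-dec (proj₁ (proj₂ x) ≟ 0)

  -- The number of (r , s) with c r + d s + i = t.
  K : ℕ → ℕ → ℕ
  K t i = ∑ (grid (suc t)) (λ x → ind (bottom? i t x) * 1)

  wt≤ : ∀ {x i t} → wt x + i ≡ t → wt x ≤ t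
  wt≤ {x} {i} refl = m≤m+n (wt x) i

  K-shift : ∀ t i → K (suc t) (suc i) ≡ K t i
  K-shift t i = ∑-reindex (bottom? (suc i) (suc t)) (bottom? i t) (λ _ → 1) (λ _ → 1) (λ x → x) (λ e → e) (grid-unique (suc (suc t))) (grid-unique (suc t))
    (λ { {x} _ (e , z) → let e′ = suc-injective (trans (sym (+-suc (wt x) i)) e) in ∈-grid x (s≤s (wt≤ {x} e′)) , e′ , z })
    (λ { {x} _ (e , z) → x , ∈-grid x (s≤s (≤-trans (wt≤ {x} e) (n≤1+n t))) , (trans (+-suc (wt x) i) (cong suc e) , z) , refl })
    (λ _ → refl)

  K-zero : ∀ t i → t < i → K t i ≡ 0
  K-zero t i t<i = trans (∑-cong {g = λ _ → 0} (grid (suc t)) (λ {x} _ → cong (_* 1) (ind-no (bottom? i t x)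
     λ { (e , _) → <⇒≱ t<i (≤-trans (m≤n+m i (wt x)) (≤-reflexive e)) }))) (zeros (grid (suc t)))
    where
    zeros : ∀ (xs : List Pt) → ∑ xs (λ _ → 0) ≡ 0
    zeros [] = refl
    zeros (x ∷ xs) = zeros xs

  K-00 : K 0 0 ≡ 1
  K-00 rewrite grid-def 1 | *-zeroʳ a | *-zeroʳ b | *-zeroʳ c | *-zeroʳ d = refl

  -- Inclusion–exclusion: a solution of c r + d s = t with t > 0 has r > 0 or s > 0.
  K-rec : ∀ t → 0 < t → K t 0 + K t N ≡ K t c + K t d
  K-rec t t>0 = begin
    K t 0 + K t N                             ≡⟨ cong (λ u → K t 0 + u) K-N ⟩
    K t 0 + ∑ g (λ x → ind (rs? x) * 1)        ≡⟨ ∑-+ (λ x → ind (bottom? 0 t x) * 1) (λ x → ind (rs? x) * 1) g ⟨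
    ∑ g (λ x → ind (bottom? 0 t x) * 1 + ind (rs? x) * 1)   ≡⟨ ∑-cong g (λ {x} _ → pointwise x) ⟩
    ∑ g (λ x → ind (r? x) * 1 + ind (s? x) * 1) ≡⟨ ∑-+ (λ x → ind (r? x) * 1) (λ x → ind (s? x) * 1) g ⟩
    ∑ g (λ x → ind (r? x) * 1) + ∑ g (λ x → ind (s? x) * 1) ≡⟨ cong₂ _+_ K-c K-d ⟨
    K t c + K t d                             ∎
    where
    open ≡-Reasoning
    g = grid (suc t)
    r>0 s>0 : Decidable _
    r>0 (p , q , r , s) = 0 <? r
    s>0 (p , q , r , s) = 0 <? s
    r? = λ x → bottom? 0 t x ×-dec r>0 x
    s? = λ x → bottom? 0 t x ×-dec s>0 x
    rs? = λ x → bottom? 0 t x ×-dec (r>0 x ×-dec s>0 x)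
    in-grid : ∀ {i} x → wt x + i ≡ t → x ∈ g
    in-grid x e = ∈-grid x (s≤s (wt≤ {x} e))
    K-c : K t c ≡ ∑ g (λ x → ind (r? x) * 1)
    K-c = ∑-reindex (bottom? c t) r? (λ _ → 1) (λ _ → 1) (λ { (p , q , r , s) → p , q , suc r , s }) (λ { refl → refl }) (grid-unique (suc t)) (grid-unique (suc t))
      (λ { {p , q , r , s} _ (e , z) → let e′ = trans (+-identityʳ _) (trans (wt-r p q r s) e) in in-grid (p , q , suc r , s) e′ , (e′ , z) , z<s })
      (λ { {p , q , suc r , s} _ ((e , z) , _) → let e′ = trans (sym (wt-r p q r s)) (trans (sym (+-identityʳ _)) e) in
           (p , q , r , s) , in-grid (p , q , r , s) e′ , (e′ , z) , refl })
      (λ _ → refl)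
    K-d : K t d ≡ ∑ g (λ x → ind (s? x) * 1)
    K-d = ∑-reindex (bottom? d t) s? (λ _ → 1) (λ _ → 1) (λ { (p , q , r , s) → p , q , r , suc s }) (λ { refl → refl }) (grid-unique (suc t)) (grid-unique (suc t))
      (λ { {p , q , r , s} _ (e , z) → let e′ = trans (+-identityʳ _) (trans (wt-s p q r s) e) in in-grid (p , q , r , suc s) e′ , (e′ , z) , z<s })
      (λ { {p , q , r , suc s} _ ((e , z) , _) → let e′ = trans (sym (wt-s p q r s)) (trans (sym (+-identityʳ _)) e) in
           (p , q , r , s) , in-grid (p , q , r , s) e′ , (e′ , z) , refl })
      (λ _ → refl)
    K-N : K t N ≡ ∑ g (λ x → ind (rs? x) * 1)
    K-N = ∑-reindex (bottom? N t) rs? (λ _ → 1) (λ _ → 1) (λ { (p , q , r , s) → p , q , suc r , suc s }) (λ { refl → refl }) (grid-unique (suc t)) (grid-unique (suc t))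
      (λ { {p , q , r , s} _ (e , z) → let e′ = trans (+-identityʳ _) (trans (wt-rs p q r s) e) in in-grid (p , q , suc r , suc s) e′ , (e′ , z) , z<s , z<s })
      (λ { {p , q , suc r , suc s} _ ((e , z) , _) → let e′ = trans (sym (wt-rs p q r s)) (trans (sym (+-identityʳ _)) e) in
           (p , q , r , s) , in-grid (p , q , r , s) e′ , (e′ , z) , refl })
      (λ _ → refl)
    split : ∀ x {P Q : Set} (P? : Dec P) (Q? : Dec Q) → 1 + ind P? * ind Q? ≡ ind P? + ind Q? →
            ind (bottom? 0 t x) * 1 + ind (bottom? 0 t x ×-dec (P? ×-dec Q?)) * 1 ≡ ind (bottom? 0 t x ×-dec P?) * 1 + ind (bottom? 0 t x ×-dec Q?) * 1
    split x P? Q? eq = begin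
      u * 1 + ind (bottom? 0 t x ×-dec (P? ×-dec Q?)) * 1
        ≡⟨ cong (λ t → u * 1 + t * 1) (trans (ind-× (bottom? 0 t x) (P? ×-dec Q?)) (cong (λ t → u * t) (ind-× P? Q?))) ⟩
      u * 1 + u * (ind P? * ind Q?) * 1 ≡⟨ solve 2 (λ u v → u :* con 1 :+ u :* v :* con 1 := u :* (con 1 :+ v)) refl u (ind P? * ind Q?) ⟩
      u * (1 + ind P? * ind Q?) ≡⟨ cong (λ t → u * t) eq ⟩
      u * (ind P? + ind Q?) ≡⟨ solve 3 (λ u v w → u :* (v :+ w) := u :* v :* con 1 :+ u :* w :* con 1) refl u (ind P?) (ind Q?) ⟩
      u * ind P? * 1 + u * ind Q? * 1 ≡⟨ cong₂ (λ s t → s * 1 + t * 1) (ind-× (bottom? 0 t x) P?) (ind-× (bottom? 0 t x) Q?) ⟨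
      ind (bottom? 0 t x ×-dec P?) * 1 + ind (bottom? 0 t x ×-dec Q?) * 1 ∎
      where
      u = ind (bottom? 0 t x)
      open +-*-Solver
    pointwise : ∀ x → ind (bottom? 0 t x) * 1 + ind (rs? x) * 1 ≡ ind (r? x) * 1 + ind (s? x) * 1
    pointwise x@(p , q , zero , zero) = trans (cong₂ _+_ none (kill (rs? x) proj₁)) (sym (cong₂ _+_ (kill (r? x) proj₁) (kill (s? x) proj₁)))
      where
      wt-0 : wt (p , q , 0 , 0) + 0 ≡ t → p ≡ 0 → q ≡ 0 → 0 ≡ t
      wt-0 e refl refl = trans (sym (solve 4 (λ a b c d → a :* con 0 :+ b :* con 0 :+ c :* con 0 :+ d :* con 0 :+ con 0 := con 0) refl a b c d)) e
        where open +-*-Solver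
      none : ind (bottom? 0 t x) * 1 ≡ 0
      none = cong (λ t → t * 1) (ind-no (bottom? 0 t x) (λ { (e , z , z′) → <⇒≢ t>0 (wt-0 e z z′) }))
      kill : ∀ {Q : Set} (Q? : Dec Q) → (Q → wt x + 0 ≡ t × p ≡ 0 × q ≡ 0) → ind Q? * 1 ≡ 0
      kill Q? f = cong (λ t → t * 1) (ind-no Q? (λ z → let (e , z₁ , z₂) = f z in <⇒≢ t>0 (wt-0 e z₁ z₂)))
    pointwise x@(p , q , zero , suc s) = split x (0 <? zero) (0 <? suc s) refl
    pointwise x@(p , q , suc r , zero) = split x (0 <? suc r) (0 <? zero) refl
    pointwise x@(p , q , suc r , suc s) = split x (0 <? suc r) (0 <? suc s) refl

  K-diag : ∀ l → K l l ≡ 1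
  K-diag zero    = K-00
  K-diag (suc l) = trans (K-shift l l) (K-diag l)

  K-shift* : ∀ n t l → K (n + t) (n + l) ≡ K t l
  K-shift* zero    t l = refl
  K-shift* (suc n) t l = trans (K-shift (n + t) (n + l)) (K-shift* n t l)

  -- `K t l` is the coefficient of x^t in x^l / ((1 - x^c)(1 - x^d)), with denominator 1 - x^c - x^d
  -- + x^N. At t = l the left side is larger by 1, which is the source of the identity matrix in
  -- `cvec-init`.
  K-recurrence : ∀ t l → t ≢ l → K t l + K t (l + N) ≡ K t (l + c) + K t (l + d)
  K-recurrence zero    zero    t≢l = ⊥-elim (t≢l refl)
  K-recurrence (suc t) zero    t≢l = K-rec (suc t) z<s
  K-recurrence zero    (suc l) t≢l
    rewrite K-zero 0 (suc l) z<s | K-zero 0 (suc l + N) z<s | K-zero 0 (suc l + c) z<s | K-zero 0 (suc l + d) z<s = refl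
  K-recurrence (suc t) (suc l) t≢l
    rewrite K-shift t l | K-shift t (l + N) | K-shift t (l + c) | K-shift t (l + d) = K-recurrence t l (λ e → t≢l (cong suc e))

-- Semifields

module SemifieldProperties (P : Semifield) where
  open Semifield P public
  open IsAbelianGroup ⊗-isAbelianGroup public
    using (isCommutativeMonoid; identityˡ; identityʳ; inverseˡ; inverseʳ) renaming (assoc to ⊗-assoc; comm to ⊗-comm)
  open IsCommutativeSemigroup ⊕-isCommutativeSemigroup public
    using () renaming (assoc to ⊕-assoc; comm to ⊕-comm)

  ⊗-commutativeMonoid : CommutativeMonoid 0ℓ 0ℓ
  ⊗-commutativeMonoid = record { isCommutativeMonoid = isCommutativeMonoid }

  module CMSolver where
    open import Algebra.Solver.CommutativeMonoid ⊗-commutativeMonoid public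
      renaming (_⊕_ to _⊙_)

  open CMSolver using (solve; _⊙_; _⊜_)

  distribʳ : ∀ x u v → (u ⊕ v) ⊗ x ≡ u ⊗ x ⊕ v ⊗ x
  distribʳ x u v = trans (⊗-comm (u ⊕ v) x) (trans (distribˡ x u v) (cong₂ _⊕_ (⊗-comm x u) (⊗-comm x v)))

  ⊗-cancelʳ : ∀ x {u v} → u ⊗ x ≡ v ⊗ x → u ≡ v
  ⊗-cancelʳ x {u} {v} eq = begin
    u              ≡⟨ restore u ⟨
    u ⊗ x ⊗ x ⁻¹   ≡⟨ cong (_⊗ x ⁻¹) eq ⟩
    v ⊗ x ⊗ x ⁻¹   ≡⟨ restore v ⟩
    v              ∎
    where
    open ≡-Reasoning
    restore : ∀ z → z ⊗ x ⊗ x ⁻¹ ≡ z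
    restore z = trans (⊗-assoc z x (x ⁻¹)) (trans (cong (z ⊗_) (inverseʳ x)) (identityʳ z))

  infixr 8 _^_
  _^_ : Carrier → ℕ → Carrier
  _^_ = pow P

  ∏ : ℕ → (ℕ → Carrier) → Carrier
  ∏ = prodTo P

  medial : ∀ u v x z → u ⊗ v ⊗ (x ⊗ z) ≡ u ⊗ x ⊗ (v ⊗ z)
  medial = solve 4 (λ u v x z → (u ⊙ v) ⊙ (x ⊙ z) ⊜ (u ⊙ x) ⊙ (v ⊙ z)) refl

  ^-+ : ∀ x m n → x ^ (m + n) ≡ x ^ m ⊗ x ^ n
  ^-+ x zero    n = sym (identityˡ _)
  ^-+ x (suc m) n = trans (cong (x ⊗_) (^-+ x m n)) (sym (⊗-assoc x _ _))

  ⊗-^ : ∀ x z n → (x ⊗ z) ^ n ≡ x ^ n ⊗ z ^ n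
  ⊗-^ x z zero    = sym (identityˡ 𝟙)
  ⊗-^ x z (suc n) = trans (cong ((x ⊗ z) ⊗_) (⊗-^ x z n)) (medial x z _ _)

  𝟙-^ : ∀ n → 𝟙 ^ n ≡ 𝟙
  𝟙-^ zero    = refl
  𝟙-^ (suc n) = trans (identityˡ _) (𝟙-^ n)

  ^-* : ∀ x m n → (x ^ m) ^ n ≡ x ^ (n * m)
  ^-* x m zero    = refl
  ^-* x m (suc n) = trans (cong (x ^ m ⊗_) (^-* x m n)) (sym (^-+ x m (n * m)))

  ^-swap : ∀ x m n → (x ^ m) ^ n ≡ (x ^ n) ^ m
  ^-swap x m n = trans (^-* x m n) (trans (cong (x ^_) (*-comm n m)) (sym (^-* x n m)))

  ⁻¹-^ : ∀ x n → (x ⁻¹) ^ n ⊗ x ^ n ≡ 𝟙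
  ⁻¹-^ x n = trans (sym (⊗-^ (x ⁻¹) x n)) (trans (cong (_^ n) (inverseˡ x)) (𝟙-^ n))

  ∏-cong : ∀ n {f g : ℕ → Carrier} → (∀ i → 0 < i → i ≤ n → f i ≡ g i) → ∏ n f ≡ ∏ n g
  ∏-cong zero    h = refl
  ∏-cong (suc n) h = cong₂ _⊗_ (∏-cong n (λ i 0<i i≤n → h i 0<i (m≤n⇒m≤1+n i≤n))) (h (suc n) z<s ≤-refl)

  ∏-𝟙 : ∀ n → ∏ n (λ _ → 𝟙) ≡ 𝟙
  ∏-𝟙 zero    = refl
  ∏-𝟙 (suc n) = trans (identityʳ _) (∏-𝟙 n)

  ∏-⊗ : ∀ n (f g : ℕ → Carrier) → ∏ n (λ i → f i ⊗ g i) ≡ ∏ n f ⊗ ∏ n g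
  ∏-⊗ zero    f g = sym (identityˡ 𝟙)
  ∏-⊗ (suc n) f g = trans (cong (_⊗ (f (suc n) ⊗ g (suc n))) (∏-⊗ n f g)) (medial _ _ _ _)

  ∏-first : ∀ n (f : ℕ → Carrier) → ∏ (suc n) f ≡ f 1 ⊗ ∏ n (λ i → f (suc i))
  ∏-first zero    f = ⊗-comm 𝟙 (f 1)
  ∏-first (suc n) f = trans (cong (_⊗ f (suc (suc n))) (∏-first n f)) (⊗-assoc (f 1) _ _)

  ∏-δ-zero : ∀ n k (f : ℕ → Carrier) → n < k → ∏ n (λ i → f i ^ ind (i ≟ k)) ≡ 𝟙
  ∏-δ-zero zero    k f n<k = refl
  ∏-δ-zero (suc n) k f n<k rewrite ind-no (suc n ≟ k) (<⇒≢ n<k) = trans (identityʳ _) (∏-δ-zero n k f (<⇒≤ n<k))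

  ∏-δ : ∀ n k (f : ℕ → Carrier) → 0 < k → k ≤ n → ∏ n (λ i → f i ^ ind (i ≟ k)) ≡ f k
  ∏-δ zero    k f 0<k k≤n = ⊥-elim (<⇒≢ 0<k (sym (n≤0⇒n≡0 k≤n)))
  ∏-δ (suc n) k f 0<k k≤n with suc n ≟ k
  ... | yes refl = trans (cong₂ _⊗_ (∏-δ-zero n (suc n) f ≤-refl) (trans (cong (f (suc n) ^_) (ind-yes (suc n ≟ suc n) refl)) (identityʳ _))) (identityˡ _)
  ... | no ≢k = trans (cong₂ _⊗_ (∏-δ n k f 0<k (s≤s⁻¹ (≤∧≢⇒< k≤n (λ e → ≢k (sym e))))) (cong (f (suc n) ^_) (ind-no (suc n ≟ k) ≢k))) (identityʳ _)

  ∏-δ₂ : ∀ n k l (f : ℕ → Carrier) → 0 < k → k ≤ n → 0 < l → l ≤ n →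
         ∏ n (λ i → f i ^ (ind (i ≟ k) + ind (i ≟ l))) ≡ f k ⊗ f l
  ∏-δ₂ n k l f 0<k k≤n 0<l l≤n =
    trans (∏-cong n (λ i _ _ → ^-+ (f i) (ind (i ≟ k)) (ind (i ≟ l))))
    (trans (∏-⊗ n _ _) (cong₂ _⊗_ (∏-δ n k f 0<k k≤n) (∏-δ n l f 0<l l≤n)))

-- Exchange matrices and c-vectors along the mutation sequence

-K₊ : ∀ n → [ ℤ.- + n ]₊ ≡ 0
-K₊ zero    = refl
-K₊ (suc n) = refl

module Cluster (a b c d : ℕ) (a>0 : 0 < a) (b>0 : 0 < b) (c>0 : 0 < c) (d>0 : 0 < d)
               (c+d : c + d ≡ a + b) (c≢a : c ≢ a) (c≢b : c ≢ b) where

  open Quiver a b c d a>0 b>0 c>0 d>0 c+d c≢a c≢b public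
  open Points a b c d N a>0 b>0 c>0 d>0 refl c+d public

  N>0 : 0 < N
  N>0 = <-trans a>0 a<N

  -- The rotation of positions caused by one mutation: the mutated vertex goes to the end of the
  -- queue, every other one advances.
  px : ℕ → ℕ
  px zero    = pred N
  px (suc n) = n

  sucN : suc (pred N) ≡ N
  sucN = suc-pred N {{ℕ.>-nonZero N>0}}

  px< : ∀ {ρ} → ρ < N → px ρ < N
  px< {zero}  _ = ≤-reflexive sucN
  px< {suc ρ} p = <-trans (n<1+n ρ) p

  px-inj : ∀ {ρ σ} → ρ < N → σ < N → px ρ ≡ px σ → ρ ≡ σ
  px-inj {zero}  {zero}  _ _ _  = refl
  px-inj {zero}  {suc σ} _ q eq = ⊥-elim (<⇒≢ q (trans (cong suc (sym eq)) sucN))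
  px-inj {suc ρ} {zero}  p _ eq = ⊥-elim (<⇒≢ p (trans (cong suc eq) sucN))
  px-inj {suc ρ} {suc σ} _ _ eq = cong suc eq

  sx : ℕ → ℕ
  sx ρ = if suc ρ ≡ᵇ N then 0 else suc ρ

  px-sx : ∀ {ρ} → ρ < N → px (sx ρ) ≡ ρ
  px-sx {ρ} p with suc ρ ≟ N
  ... | yes eq rewrite dec-true (suc ρ ≟ N) eq = cong pred (sym eq)
  ... | no ≢N rewrite dec-false (suc ρ ≟ N) ≢N = refl

  sx-px : ∀ {ρ} → ρ < N → sx (px ρ) ≡ ρ
  sx-px {zero}  _ rewrite dec-true (suc (pred N) ≟ N) sucN = refl
  sx-px {suc ρ} p rewrite dec-false (suc ρ ≟ N) (<⇒≢ p) = refl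

  -- The row and column of the mutated vertex become those of the vertex N, and `exchB-shift` treats
  -- the other entries. So one fixed matrix, read in the current positions, serves all steps of the
  -- mutation sequence.
  e-px : ∀ {ρ σ} → ρ < N → σ < N → e (px ρ) (px σ) ≡
         (if (ρ ≡ᵇ 0) ∨ (σ ≡ᵇ 0) then ℤ.- e ρ σ
          else e ρ σ ℤ.+ + ([ e ρ 0 ]₊ * [ e 0 σ ]₊) ℤ.- + ([ ℤ.- e ρ 0 ]₊ * [ ℤ.- e 0 σ ]₊))
  e-px {zero}  {zero}  _ _ = trans (exchB-diag (suc (pred N))) (sym (cong ℤ.-_ (exchB-diag 1)))
  e-px {zero}  {suc σ} _ q = trans (cong (λ n → exchB a b c d n (suc σ)) sucN) (exchB-N-row (suc σ) (<⇒≤ q))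
  e-px {suc ρ} {zero}  p _ = trans (cong (exchB a b c d (suc ρ)) sucN) (exchB-N-col (suc ρ) (<⇒≤ p))
  e-px {suc ρ} {suc σ} _ _ = trans (exchB-shift (suc ρ) (suc σ))
    (sym (cong₂ (λ s t → e (suc ρ) (suc σ) ℤ.+ + s ℤ.- + t)
      (cong₂ _*_ (e-col₊ (suc ρ)) (e-row₊ (suc σ))) (cong₂ _*_ (e-col₋ (suc ρ)) (e-row₋ (suc σ)))))

  -- The c-vector entry, at time m, of the vertex in position ρ: the contributions to K
  -- that arrive through the mutations still to come are removed.
  cvec : (m l ρ : ℕ) → ℤ
  cvec m l ρ = + K t l ℤ.- + (ind (c ≤? ρ) * K t (l + c)) ℤ.- + (ind (d ≤? ρ) * K t (l + d))
    where t = suc m + ρ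

  cvec-0 : ∀ m l → cvec m l 0 ≡ + K (suc m) l
  cvec-0 m l rewrite ind-no (c ≤? 0) (<⇒≱ c>0) | ind-no (d ≤? 0) (<⇒≱ d>0) | +-identityʳ m =
    trans (ℤₚ.+-identityʳ _) (ℤₚ.+-identityʳ _)

  private
    K-⊖ : ∀ x y z → x ≡ y + z → + x ℤ.- + y ℤ.- + z ≡ + 0
    K-⊖ x y z refl = solve 2 (λ y z → (y :+ z) :- y :- z := con (+ 0)) refl (+ y) (+ z)
      where open ℤSolver.+-*-Solver

    ⊖-shuffle : ∀ x y z u v → + x ℤ.- + y ℤ.- + z ≡ + x ℤ.- + (y + u) ℤ.- + (z + v) ℤ.+ + (u + v)
    ⊖-shuffle x y z u v = solve 5 (λ x y z u v → x :- y :- z := x :- (y :+ u) :- (z :+ v) :+ (u :+ v)) refl (+ x) (+ y) (+ z) (+ u) (+ v)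
      where open ℤSolver.+-*-Solver

    drop-ind : ∀ {n ρ l} → 0 < l → ind (n ≤? ρ) * K (suc ρ) (l + n) ≡ K (suc ρ) (l + n)
    drop-ind {n} {ρ} {l} l>0 with n ≤? ρ
    ... | yes p rewrite ind-yes (n ≤? ρ) p = +-identityʳ _
    ... | no ¬p rewrite ind-no (n ≤? ρ) ¬p = sym (K-zero _ _ (≤-<-trans (≰⇒> ¬p) (m<n+m n l>0)))

  -- Here t = ρ + 1 ≤ N. The indicators may be dropped, as `K t (l + c)` vanishes for c > ρ, and
  -- likewise for d; the term `K t (l + N)` of the recurrence vanishes too. What remains is 1 for t
  -- = l and 0 otherwise.
  cvec-init : ∀ l ρ → 0 < l → l ≤ N → ρ < N → cvec 0 l ρ ≡ (if l ≡ᵇ suc ρ then + 1 else + 0)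
  cvec-init l ρ l>0 l≤N ρ<N = trans (cong₂ (λ s t → + K (suc ρ) l ℤ.- + s ℤ.- + t) (drop-ind {c} {ρ} l>0) (drop-ind {d} {ρ} l>0)) (case-split l>0)
    where
    case-split : 0 < l → + K (suc ρ) l ℤ.- + K (suc ρ) (l + c) ℤ.- + K (suc ρ) (l + d) ≡ (if l ≡ᵇ suc ρ then + 1 else + 0)
    case-split l>0 with l ≟ suc ρ
    ... | yes refl rewrite dec-true (suc ρ ≟ suc ρ) refl | K-diag (suc ρ) | K-zero (suc ρ) (suc ρ + c) (m<m+n (suc ρ) c>0) | K-zero (suc ρ) (suc ρ + d) (m<m+n (suc ρ) d>0) = refl
    ... | no l≢ rewrite dec-false (l ≟ suc ρ) l≢ = K-⊖ (K (suc ρ) l) (K (suc ρ) (l + c)) (K (suc ρ) (l + d)) (begin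
      K (suc ρ) l                      ≡⟨ +-identityʳ _ ⟨
      K (suc ρ) l + 0                  ≡⟨ cong (λ t → K (suc ρ) l + t) (K-zero (suc ρ) (l + N) (≤-<-trans ρ<N (m<n+m N l>0))) ⟨
      K (suc ρ) l + K (suc ρ) (l + N)  ≡⟨ K-recurrence (suc ρ) l (l≢ ∘ sym) ⟩
      K (suc ρ) (l + c) + K (suc ρ) (l + d) ∎)
      where
      open ≡-Reasoning

  -- In position N - 1 both indicators are 1, and the recurrence leaves - K t (l + N) = - K (m + 1)
  -- l, the negated entry of the mutated vertex. For ρ > 0 the value of t does not change, and an
  -- indicator switches off exactly at ρ = c or ρ = d; this gives back K (m + 1) l, which is what an
  -- arrow counted by `G` transports. The negative parts give nothing, as the entry in position 0 is
  -- a count.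
  cvec-px : ∀ m l ρ → l ≤ N → ρ < N → cvec (suc m) l (px ρ) ≡
            (if ρ ≡ᵇ 0 then ℤ.- cvec m l ρ
             else cvec m l ρ ℤ.+ + ([ cvec m l 0 ]₊ * [ e 0 ρ ]₊) ℤ.- + ([ ℤ.- cvec m l 0 ]₊ * [ ℤ.- e 0 ρ ]₊))
  cvec-px m l zero l≤N _ = begin
    + K t l ℤ.- + (ind (c ≤? pred N) * K t (l + c)) ℤ.- + (ind (d ≤? pred N) * K t (l + d))
      ≡⟨ cong₂ (λ s u → + K t l ℤ.- + (s * K t (l + c)) ℤ.- + (u * K t (l + d))) (ind-yes (c ≤? pred N) (≤pred c<N)) (ind-yes (d ≤? pred N) (≤pred d<N)) ⟩
    + K t l ℤ.- + (1 * K t (l + c)) ℤ.- + (1 * K t (l + d))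
      ≡⟨ cong₂ (λ s u → + K t l ℤ.- + s ℤ.- + u) (*-identityˡ (K t (l + c))) (*-identityˡ (K t (l + d))) ⟩
    + K t l ℤ.- + K t (l + c) ℤ.- + K t (l + d)
      ≡⟨ ℤneg (K t l) (K t (l + c)) (K t (l + d)) (K t (l + N)) (K-recurrence t l (λ e → <⇒≢ l<t (sym e))) ⟩
    ℤ.- + K t (l + N)         ≡⟨ cong (ℤ.-_ ∘ +_) Kt≡ ⟩
    ℤ.- + K (suc m) l         ≡⟨ cong ℤ.-_ (cvec-0 m l) ⟨
    ℤ.- cvec m l 0            ∎
    where
    open ≡-Reasoning
    t = suc (suc m) + pred N
    t≡ : t ≡ N + suc m
    t≡ = trans (sym (+-suc (suc m) (pred N))) (trans (cong (λ n → suc m + n) sucN) (+-comm (suc m) N))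
    l<t : l < t
    l<t = subst (l <_) (sym t≡) (≤-<-trans l≤N (m<m+n N z<s))
    ≤pred : ∀ {n} → n < N → n ≤ pred N
    ≤pred {n} p = s≤s⁻¹ (subst (n <_) (sym sucN) p)
    Kt≡ : K t (l + N) ≡ K (suc m) l
    Kt≡ = trans (cong₂ K t≡ (+-comm l N)) (K-shift* N (suc m) l)
    ℤneg : ∀ x y z w → x + w ≡ y + z → + x ℤ.- + y ℤ.- + z ≡ ℤ.- + w
    ℤneg x y z w eq = begin
      + x ℤ.- + y ℤ.- + z ≡⟨ solve 4 (λ x y z w → x :- y :- z := (x :+ w) :- y :- z :- w) refl (+ x) (+ y) (+ z) (+ w) ⟩
      + (x + w) ℤ.- + y ℤ.- + z ℤ.- + w ≡⟨ cong (λ t → + t ℤ.- + y ℤ.- + z ℤ.- + w) eq ⟩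
      + (y + z) ℤ.- + y ℤ.- + z ℤ.- + w ≡⟨ solve 3 (λ y z w → (y :+ z) :- y :- z :- w := :- w) refl (+ y) (+ z) (+ w) ⟩
      ℤ.- + w ∎
      where open ℤSolver.+-*-Solver
  cvec-px m l (suc σ) l≤N _ = begin
    cvec (suc m) l σ
      ≡⟨ cong (λ n → + K n l ℤ.- + (ind (c ≤? σ) * K n (l + c)) ℤ.- + (ind (d ≤? σ) * K n (l + d))) (sym (+-suc (suc m) σ)) ⟩
    + K t l ℤ.- + (ind (c ≤? σ) * K t (l + c)) ℤ.- + (ind (d ≤? σ) * K t (l + d))
      ≡⟨ ⊖-shuffle (K t l) y z (ind (suc σ ≟ c) * K₁) (ind (suc σ ≟ d) * K₁) ⟩
    + K t l ℤ.- + (y + ind (suc σ ≟ c) * K₁) ℤ.- + (z + ind (suc σ ≟ d) * K₁) ℤ.+ + (ind (suc σ ≟ c) * K₁ + ind (suc σ ≟ d) * K₁)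
      ≡⟨ cong₂ ℤ._+_ (cong₂ (λ u v → + K t l ℤ.- + u ℤ.- + v) (arrive c) (arrive d)) (cong +_ (sym incr)) ⟩
    cvec m l (suc σ) ℤ.+ + ([ cvec m l 0 ]₊ * [ e 0 (suc σ) ]₊)
      ≡⟨ sym (trans (cong (λ u → X ℤ.- + (u * [ ℤ.- e 0 (suc σ) ]₊)) (trans (cong (λ v → [ ℤ.- v ]₊) (cvec-0 m l)) (-K₊ K₁))) (ℤₚ.+-identityʳ X)) ⟩
    X ℤ.- + ([ ℤ.- cvec m l 0 ]₊ * [ ℤ.- e 0 (suc σ) ]₊) ∎
    where
    open ≡-Reasoning
    t = suc m + suc σ
    K₁ = K (suc m) l
    y = ind (c ≤? σ) * K t (l + c)
    z = ind (d ≤? σ) * K t (l + d)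
    X = cvec m l (suc σ) ℤ.+ + ([ cvec m l 0 ]₊ * [ e 0 (suc σ) ]₊)
    incr : [ cvec m l 0 ]₊ * [ e 0 (suc σ) ]₊ ≡ ind (suc σ ≟ c) * K₁ + ind (suc σ ≟ d) * K₁
    incr = trans (cong₂ _*_ (cong [_]₊ (cvec-0 m l)) (e-row₊ (suc σ)))
                 (trans (*-comm K₁ (G (suc σ))) (*-distribʳ-+ K₁ (ind (suc σ ≟ c)) (ind (suc σ ≟ d))))
    arrive : ∀ n → ind (n ≤? σ) * K t (l + n) + ind (suc σ ≟ n) * K₁ ≡ ind (n ≤? suc σ) * K t (l + n)
    arrive n with <-cmp n (suc σ)
    ... | tri< n<σ n≢ _ rewrite ind-yes (n ≤? σ) (s≤s⁻¹ n<σ) | ind-yes (n ≤? suc σ) (<⇒≤ n<σ) | ind-no (suc σ ≟ n) (n≢ ∘ sym) = +-identityʳ _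
    ... | tri> n≮ n≢ n> rewrite ind-no (n ≤? σ) (λ p → n≮ (s≤s p)) | ind-no (n ≤? suc σ) (<⇒≱ n>) | ind-no (suc σ ≟ n) (n≢ ∘ sym) = refl
    ... | tri≈ n≮ refl _ rewrite ind-no (suc σ ≤? σ) (λ p → n≮ (s≤s p)) | ind-yes (suc σ ≤? suc σ) ≤-refl | ind-yes (suc σ ≟ suc σ) refl =
      cong (λ t → t + 0) (trans (sym (K-shift* (suc σ) (suc m) l)) (cong₂ K (+-comm (suc σ) (suc m)) (+-comm (suc σ) l)))

-- F-polynomials along the mutation sequence

module Orbit (a b c d : ℕ) (a>0 : 0 < a) (b>0 : 0 < b) (c>0 : 0 < c) (d>0 : 0 < d)
             (c+d : c + d ≡ a + b) (c≢a : c ≢ a) (c≢b : c ≢ b) (P : Semifield) where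

  open Cluster a b c d a>0 b>0 c>0 d>0 c+d c≢a c≢b public
  open SemifieldProperties P public

  module _ (y : ℕ → Carrier) where

    -- At t = m + 1 this is the coefficient monomial of the mutation number m: by `cvec-0` its
    -- exponents form the c-vector of the mutated vertex.
    Y : ℕ → Carrier
    Y t = ∏ N (λ i → y i ^ K t i)

    exchange : (ℕ → Carrier) → ℕ → Carrier
    exchange V m = (Y (suc m) ⊗ (V a ⊗ V b) ⊕ V c ⊗ V d) ⊗ (V 0 ⁻¹)

    -- The F-polynomials of the cluster after m mutations, by position.
    window : ℕ → ℕ → Carrier
    window zero    ρ = 𝟙
    window (suc m) ρ = if suc ρ ≡ᵇ N then exchange (window m) m else window m (suc ρ)

    fresh : ℕ → Carrier
    fresh m = exchange (window m) m

    window-last : ∀ m → window (suc m) (pred N) ≡ fresh m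
    window-last m rewrite dec-true (suc (pred N) ≟ N) sucN = refl

    window-suc : ∀ m {ρ} → suc ρ < N → window (suc m) ρ ≡ window m (suc ρ)
    window-suc m {ρ} p rewrite dec-false (suc ρ ≟ N) (<⇒≢ p) = refl

    window-px : ∀ m {ρ} → ρ < N → window (suc m) (px ρ) ≡ (if ρ ≡ᵇ 0 then fresh m else window m ρ)
    window-px m {zero}  _ = window-last m
    window-px m {suc ρ} p = window-suc m p

  -- Serves both directions of mutation. Forwards, `ρ₀` is `pred` and the quiver is the given one;
  -- backwards, `ρ₀ i` is N - i, and the reflected quiver has the two pairs of parameters exchanged.
  module Mutations (a₀ b₀ c₀ d₀ : ℕ) (N₀ : a₀ + b₀ ≡ N) (y ŷ : ℕ → Carrier) (ρ₀ k : ℕ → ℕ)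
    (ρ₀< : ∀ {i} → 0 < i → i ≤ N → ρ₀ i < N)
    (ρ₀-inj : ∀ {i j} → 0 < i → i ≤ N → 0 < j → j ≤ N → ρ₀ i ≡ ρ₀ j → i ≡ j)
    (∏-ρ₀ : ∀ (g : ℕ → Carrier) → ∏ N (g ∘ ρ₀) ≡ ∏ N (g ∘ pred))
    (k>0 : ∀ m → 0 < k m) (k≤N : ∀ m → k m ≤ N)
    (y-ŷ : ∀ i → 0 < i → i ≤ N → y i ≡ ŷ (suc (ρ₀ i)))
    (B₀ : ∀ {i j} → 0 < i → i ≤ N → 0 < j → j ≤ N → exchB a₀ b₀ c₀ d₀ i j ≡ e (ρ₀ i) (ρ₀ j))
    where

    -- The vertex in position ρ after m mutations is the one mutated in step m + ρ.
    pos : ℕ → ℕ → ℕ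
    pos zero    i = ρ₀ i
    pos (suc m) i = px (pos m i)

    pos< : ∀ m {i} → 0 < i → i ≤ N → pos m i < N
    pos< zero    p q = ρ₀< p q
    pos< (suc m) p q = px< (pos< m p q)

    module _ (next : ℕ → ℕ) (ρ₀-next : ∀ {i} → 0 < i → i ≤ N → ρ₀ (next i) ≡ sx (ρ₀ i))
             (k-zero : ρ₀ (k 0) ≡ 0) (k-suc : ∀ m → k (suc m) ≡ next (k m))
             (S : ℕ → FSeed Carrier) (S-zero : S 0 ≡ initF P a₀ b₀ c₀ d₀ y)
             (S-suc : ∀ m → S (suc m) ≡ mutF P a₀ b₀ c₀ d₀ y (k m) (S m)) where

      pos-next : ∀ m {i} → 0 < i → i ≤ N → pos m (next i) ≡ sx (pos m i)
      pos-next zero    p q = ρ₀-next p q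
      pos-next (suc m) p q = trans (cong px (pos-next m p q)) (trans (px-sx (pos< m p q)) (sym (sx-px (pos< m p q))))

      pos-k : ∀ m → pos m (k m) ≡ 0
      pos-k zero    = k-zero
      pos-k (suc m) = trans (cong (px ∘ pos m) (k-suc m))
        (trans (cong px (pos-next m (k>0 m) (k≤N m))) (trans (px-sx (pos< m (k>0 m) (k≤N m))) (pos-k m)))

      pos-inj : ∀ m {i j} → 0 < i → i ≤ N → 0 < j → j ≤ N → pos m i ≡ pos m j → i ≡ j
      pos-inj zero    p q p′ q′ eq = ρ₀-inj p q p′ q′ eq
      pos-inj (suc m) p q p′ q′ eq = pos-inj m p q p′ q′ (px-inj (pos< m p q) (pos< m p′ q′) eq)

      pos-≡ᵇ : ∀ m {i} → 0 < i → i ≤ N → (i ≡ᵇ k m) ≡ (pos m i ≡ᵇ 0)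
      pos-≡ᵇ m {i} p q = does-⇔ (mk⇔ (λ { refl → pos-k m }) (λ eq → pos-inj m p q (k>0 m) (k≤N m) (trans eq (sym (pos-k m)))))
                                (i ≟ k m) (pos m i ≟ 0)

      ∏-px : ∀ (g : ℕ → Carrier) → ∏ N (λ i → g (px (pred i))) ≡ ∏ N (g ∘ pred)
      ∏-px g = subst (λ n → ∏ n (λ i → g (px (pred i))) ≡ ∏ n (g ∘ pred)) sucN (begin
        ∏ (suc (pred N)) (λ i → g (px (pred i)))      ≡⟨ ∏-first (pred N) _ ⟩
        g (pred N) ⊗ ∏ (pred N) (λ i → g (px i))      ≡⟨ ⊗-comm _ _ ⟩
        ∏ (pred N) (λ i → g (px i)) ⊗ g (pred N)      ≡⟨ cong (_⊗ g (pred N)) (∏-cong (pred N) (λ { (suc i) _ _ → refl })) ⟩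
        ∏ (pred N) (g ∘ pred) ⊗ g (pred N)            ∎)
        where open ≡-Reasoning

      ∏-pos : ∀ m (g : ℕ → Carrier) → ∏ N (g ∘ pos m) ≡ ∏ N (g ∘ pred)
      ∏-pos zero    g = ∏-ρ₀ g
      ∏-pos (suc m) g = trans (∏-pos m (g ∘ px)) (∏-px g)

      ∏-pair : ∀ m (V : ℕ → Carrier) {u v} → u < N → v < N →
               ∏ N (λ i → V (pos m i) ^ (ind (pos m i ≟ u) + ind (pos m i ≟ v))) ≡ V u ⊗ V v
      ∏-pair m V {u} {v} u<N v<N = begin
        ∏ N (λ i → V (pos m i) ^ (ind (pos m i ≟ u) + ind (pos m i ≟ v)))
          ≡⟨ ∏-pos m (λ ρ → V ρ ^ (ind (ρ ≟ u) + ind (ρ ≟ v))) ⟩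
        ∏ N (λ i → V (pred i) ^ (ind (pred i ≟ u) + ind (pred i ≟ v)))
          ≡⟨ ∏-cong N (λ { (suc i) _ _ → refl }) ⟩
        ∏ N (λ i → V (pred i) ^ (ind (i ≟ suc u) + ind (i ≟ suc v)))
          ≡⟨ ∏-δ₂ N (suc u) (suc v) (V ∘ pred) z<s u<N z<s v<N ⟩
        V u ⊗ V v ∎
        where open ≡-Reasoning

      -- In `C≡` the rows belong to the variables `y` and keep their initial labels, while the
      -- columns move with the vertices.
      record Invariant (m : ℕ) (s : FSeed Carrier) : Set where
        open FSeed s
        field
          B≡ : ∀ {i j} → 0 < i → i ≤ N → 0 < j → j ≤ N → Bm i j ≡ e (pos m i) (pos m j)
          C≡ : ∀ {i j} → 0 < i → i ≤ N → 0 < j → j ≤ N → Cm i j ≡ cvec m (suc (ρ₀ i)) (pos m j)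
          F≡ : ∀ {i} → 0 < i → i ≤ N → Fv i ≡ window ŷ m (pos m i)

      invariant-init : Invariant 0 (initF P a₀ b₀ c₀ d₀ y)
      invariant-init = record
        { B≡ = B₀
        ; C≡ = λ {i} {j} p q p′ q′ → trans
            (cong (if_then + 1 else + 0) (does-⇔ (mk⇔ (cong (suc ∘ ρ₀)) (λ eq → ρ₀-inj p q p′ q′ (suc-injective eq))) (i ≟ j) (suc (ρ₀ i) ≟ suc (ρ₀ j))))
            (sym (cvec-init (suc (ρ₀ i)) (ρ₀ j) z<s (ρ₀< p q) (ρ₀< p′ q′)))
        ; F≡ = λ _ _ → refl }

      invariant-mut : ∀ m s → Invariant m s → Invariant (suc m) (mutF P a₀ b₀ c₀ d₀ y (k m) s)
      invariant-mut m s inv = record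
        { B≡ = λ {i} {j} p q p′ q′ → trans
            (cong₃ (λ t u v → if t then u else v)
              (cong₂ _∨_ (pos-≡ᵇ m p q) (pos-≡ᵇ m p′ q′))
              (cong ℤ.-_ (B≡ p q p′ q′))
              (cong₂ ℤ._-_ (cong₂ ℤ._+_ (B≡ p q p′ q′) (cong +_ (cong₂ _*_ (cong [_]₊ (B-col p q)) (cong [_]₊ (B-row p′ q′)))))
                           (cong +_ (cong₂ _*_ (cong ([_]₊ ∘ ℤ.-_) (B-col p q)) (cong ([_]₊ ∘ ℤ.-_) (B-row p′ q′))))))
            (sym (e-px (pos< m p q) (pos< m p′ q′)))
        ; C≡ = λ {i} {j} p q p′ q′ → trans
            (cong₃ (λ t u v → if t then u else v) (pos-≡ᵇ m p′ q′)
              (cong ℤ.-_ (C≡ p q p′ q′))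
              (cong₂ ℤ._-_ (cong₂ ℤ._+_ (C≡ p q p′ q′) (cong +_ (cong₂ _*_ (cong [_]₊ (C-col p q)) (cong [_]₊ (B-row p′ q′)))))
                           (cong +_ (cong₂ _*_ (cong ([_]₊ ∘ ℤ.-_) (C-col p q)) (cong ([_]₊ ∘ ℤ.-_) (B-row p′ q′))))))
            (sym (cvec-px m (suc (ρ₀ i)) (pos m j) (ρ₀< p q) (pos< m p′ q′)))
        ; F≡ = λ {i} p q → trans
            (cong₃ (λ t u v → if t then u else v) (pos-≡ᵇ m p q) new≡ (F≡ p q))
            (sym (window-px ŷ m (pos< m p q))) }
        where
        open Invariant inv
        open FSeed s
        cong₃ : ∀ {A B C D : Set} (f : A → B → C → D) {x x′ u u′ v v′} → x ≡ x′ → u ≡ u′ → v ≡ v′ → f x u v ≡ f x′ u′ v′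
        cong₃ f refl refl refl = refl
        B-col : ∀ {i} → 0 < i → i ≤ N → Bm i (k m) ≡ e (pos m i) 0
        B-col {i} p q = trans (B≡ p q (k>0 m) (k≤N m)) (cong (e (pos m i)) (pos-k m))
        B-row : ∀ {j} → 0 < j → j ≤ N → Bm (k m) j ≡ e 0 (pos m j)
        B-row {j} p q = trans (B≡ (k>0 m) (k≤N m) p q) (cong (λ t → e t (pos m j)) (pos-k m))
        C-col : ∀ {i} → 0 < i → i ≤ N → Cm i (k m) ≡ cvec m (suc (ρ₀ i)) 0
        C-col {i} p q = trans (C≡ p q (k>0 m) (k≤N m)) (cong (cvec m (suc (ρ₀ i))) (pos-k m))
        C-col′ : ∀ {i} → 0 < i → i ≤ N → Cm i (k m) ≡ + K (suc m) (suc (ρ₀ i))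
        C-col′ {i} p q = trans (C-col p q) (cvec-0 m (suc (ρ₀ i)))
        V = window ŷ m
        ∏-N₀ : ∀ f → ∏ (a₀ + b₀) f ≡ ∏ N f
        ∏-N₀ f = cong (λ n → ∏ n f) N₀
        y₊ : prodTo P (a₀ + b₀) (λ i → y i ^ [ Cm i (k m) ]₊) ≡ Y ŷ (suc m)
        y₊ = begin
          ∏ (a₀ + b₀) (λ i → y i ^ [ Cm i (k m) ]₊)                  ≡⟨ ∏-N₀ _ ⟩
          ∏ N (λ i → y i ^ [ Cm i (k m) ]₊)                          ≡⟨ ∏-cong N (λ i p q → cong₂ _^_ (y-ŷ i p q) (cong [_]₊ (C-col′ p q))) ⟩
          ∏ N (λ i → ŷ (suc (ρ₀ i)) ^ K (suc m) (suc (ρ₀ i)))        ≡⟨ ∏-ρ₀ (λ ρ → ŷ (suc ρ) ^ K (suc m) (suc ρ)) ⟩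
          ∏ N (λ i → ŷ (suc (pred i)) ^ K (suc m) (suc (pred i)))    ≡⟨ ∏-cong N (λ { (suc i) _ _ → refl }) ⟩
          Y ŷ (suc m)                                                ∎
          where open ≡-Reasoning
        -- The c-vector of the mutated vertex has no negative entries, so only one side of the
        -- exchange relation carries coefficients.
        y₋ : prodTo P (a₀ + b₀) (λ i → y i ^ [ ℤ.- Cm i (k m) ]₊) ≡ 𝟙
        y₋ = trans (∏-N₀ _)
             (trans (∏-cong N (λ i p q → cong (y i ^_) (trans (cong ([_]₊ ∘ ℤ.-_) (C-col′ p q)) (-K₊ (K (suc m) (suc (ρ₀ i))))))) (∏-𝟙 N))
        F₊ : prodTo P (a₀ + b₀) (λ i → Fv i ^ [ Bm i (k m) ]₊) ≡ V a ⊗ V b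
        F₊ = trans (∏-N₀ _)
             (trans (∏-cong N (λ i p q → cong₂ _^_ (F≡ p q) (trans (cong [_]₊ (B-col p q)) (e-col₊ (pos m i))))) (∏-pair m V a<N b<N))
        F₋ : prodTo P (a₀ + b₀) (λ i → Fv i ^ [ ℤ.- Bm i (k m) ]₊) ≡ V c ⊗ V d
        F₋ = trans (∏-N₀ _)
             (trans (∏-cong N (λ i p q → cong₂ _^_ (F≡ p q) (trans (cong ([_]₊ ∘ ℤ.-_) (B-col p q)) (e-col₋ (pos m i))))) (∏-pair m V c<N d<N))
        new≡ : (prodTo P (a₀ + b₀) (λ i → y i ^ [ Cm i (k m) ]₊) ⊗ prodTo P (a₀ + b₀) (λ i → Fv i ^ [ Bm i (k m) ]₊)
                ⊕ prodTo P (a₀ + b₀) (λ i → y i ^ [ ℤ.- Cm i (k m) ]₊) ⊗ prodTo P (a₀ + b₀) (λ i → Fv i ^ [ ℤ.- Bm i (k m) ]₊))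
               ⊗ (Fv (k m) ⁻¹) ≡ fresh ŷ m
        new≡ = cong₂ _⊗_ (cong₂ _⊕_ (cong₂ _⊗_ y₊ F₊) (trans (cong₂ _⊗_ y₋ F₋) (identityˡ _)))
                         (cong _⁻¹ (trans (F≡ (k>0 m) (k≤N m)) (cong V (pos-k m))))

      invariant : ∀ m → Invariant m (S m)
      invariant zero    = subst (Invariant 0) (sym S-zero) invariant-init
      invariant (suc m) = subst (Invariant (suc m)) (sym (S-suc m)) (invariant-mut m (S m) (invariant m))

      F-fresh : ∀ m → FSeed.Fv (S (suc m)) (k m) ≡ fresh ŷ m
      F-fresh m = trans (Invariant.F≡ (invariant (suc m)) (k>0 m) (k≤N m))
                  (trans (cong (window ŷ (suc m) ∘ px) (pos-k m)) (window-last ŷ m))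

-- Change of the initial seed

module Rotation (a b c d : ℕ) (a>0 : 0 < a) (b>0 : 0 < b) (c>0 : 0 < c) (d>0 : 0 < d)
                (c+d : c + d ≡ a + b) (c≢a : c ≢ a) (c≢b : c ≢ b) (P : Semifield) where

  open Orbit a b c d a>0 b>0 c>0 d>0 c+d c≢a c≢b P public

  module Reseed (y : ℕ → Carrier) where

    -- With b = G i - D i, the entry of the row of vertex 1, the coefficient mutation multiplies by
    -- y₁^[b]₊ (1 + y₁)^(-b) = y₁^(G i) (1 + y₁)^(D i - G i). In terms of `w` = 1 + y₁ and `q` = y₁
    -- / (1 + y₁) this is q^(G i) w^(D i).
    w q : Carrier
    w = y 1 ⊕ 𝟙
    q = y 1 ⊗ w ⁻¹

    -- The coefficients of the initial seed mutated at the vertex 1, relabelled by i ↦ i - 1.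
    y′ : ℕ → Carrier
    y′ i = if i ≡ᵇ N then y 1 ⁻¹ else y (suc i) ⊗ (q ^ G i ⊗ w ^ D i)

    q⊗w : ∀ n → q ^ n ⊗ w ^ n ≡ y 1 ^ n
    q⊗w n = trans (sym (⊗-^ q w n)) (cong (_^ n)
      (trans (⊗-assoc (y 1) (w ⁻¹) w) (trans (cong (y 1 ⊗_) (inverseˡ w)) (identityʳ (y 1)))))

    y′-N : y′ N ≡ y 1 ⁻¹
    y′-N rewrite dec-true (N ≟ N) refl = refl

    y′-< : ∀ {i} → i < N → y′ i ≡ y (suc i) ⊗ (q ^ G i ⊗ w ^ D i)
    y′-< {i} p rewrite dec-false (i ≟ N) (<⇒≢ p) = refl

    private
      ∏-N : ∀ f → ∏ N f ≡ ∏ (suc (pred N)) f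
      ∏-N f = cong (λ n → ∏ n f) (sym sucN)

      ≤pred : ∀ {n} → n < N → n ≤ pred N
      ≤pred {n} p = s≤s⁻¹ (subst (n <_) (sym sucN) p)

      rest : ℕ → Carrier
      rest t = ∏ (pred N) (λ i → y (suc i) ^ K t i)

      Y-y : ∀ t → Y y (suc t) ≡ y 1 ^ K t 0 ⊗ rest t
      Y-y t = trans (∏-N _) (trans (∏-first (pred N) _)
        (cong₂ _⊗_ (cong (y 1 ^_) (K-shift t 0)) (∏-cong (pred N) (λ i _ _ → cong (y (suc i) ^_) (K-shift t i)))))

      Y-y′ : ∀ t → Y y′ t ≡ rest t ⊗ (q ^ K t c ⊗ q ^ K t d ⊗ (w ^ K t a ⊗ w ^ K t b)) ⊗ (y 1 ⁻¹) ^ K t N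
      Y-y′ t = begin
        Y y′ t ≡⟨ ∏-N _ ⟩
        ∏ (pred N) (λ i → y′ i ^ K t i) ⊗ y′ (suc (pred N)) ^ K t (suc (pred N))
          ≡⟨ cong₂ _⊗_ (∏-cong (pred N) factor) (trans (cong (λ n → y′ n ^ K t n) sucN) (cong (_^ K t N) y′-N)) ⟩
        ∏ (pred N) (λ i → y (suc i) ^ K t i ⊗ ((q ^ K t i) ^ G i ⊗ (w ^ K t i) ^ D i)) ⊗ (y 1 ⁻¹) ^ K t N
          ≡⟨ cong (_⊗ (y 1 ⁻¹) ^ K t N) (trans (∏-⊗ (pred N) _ _) (cong (rest t ⊗_) (trans (∏-⊗ (pred N) _ _) (cong₂ _⊗_
               (∏-δ₂ (pred N) c d (λ i → q ^ K t i) c>0 (≤pred c<N) d>0 (≤pred d<N))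
               (∏-δ₂ (pred N) a b (λ i → w ^ K t i) a>0 (≤pred a<N) b>0 (≤pred b<N)))))) ⟩
        rest t ⊗ (q ^ K t c ⊗ q ^ K t d ⊗ (w ^ K t a ⊗ w ^ K t b)) ⊗ (y 1 ⁻¹) ^ K t N ∎
        where
        open ≡-Reasoning
        factor : ∀ i → 0 < i → i ≤ pred N → y′ i ^ K t i ≡ y (suc i) ^ K t i ⊗ ((q ^ K t i) ^ G i ⊗ (w ^ K t i) ^ D i)
        factor i _ i≤ = trans (cong (_^ K t i) (y′-< (≤-trans (s≤s i≤) (≤-reflexive sucN))))
          (trans (⊗-^ (y (suc i)) _ (K t i)) (cong (y (suc i) ^ K t i ⊗_) (trans (⊗-^ (q ^ G i) (w ^ D i) (K t i))
            (cong₂ _⊗_ (^-swap q (G i) (K t i)) (^-swap w (D i) (K t i))))))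

    -- The exponent of y₁ decides. The powers of `q` contribute K t c + K t d and `y′ N` contributes
    -- - K t N; by `K-rec` the total is K t 0, the exponent of y₁ in `Y y (suc t)`. The denominators
    -- of `q` are moved to the left as a power of `w`.
    Y-reseed : ∀ t → 0 < t → Y y′ t ⊗ w ^ (K t c + K t d) ≡ Y y (suc t) ⊗ w ^ (K t a + K t b)
    Y-reseed t t>0 = begin
      Y y′ t ⊗ w ^ (K t c + K t d)
        ≡⟨ cong (_⊗ w ^ (K t c + K t d)) (Y-y′ t) ⟩
      rest t ⊗ (q ^ K t c ⊗ q ^ K t d ⊗ (w ^ K t a ⊗ w ^ K t b)) ⊗ y⁻ ⊗ w ^ (K t c + K t d)
        ≡⟨ cong₂ (λ u v → rest t ⊗ (u ⊗ v) ⊗ y⁻ ⊗ w ^ (K t c + K t d)) (sym (^-+ q (K t c) (K t d))) (sym (^-+ w (K t a) (K t b))) ⟩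
      rest t ⊗ (q ^ (K t c + K t d) ⊗ w ^ (K t a + K t b)) ⊗ y⁻ ⊗ w ^ (K t c + K t d)
        ≡⟨ solve 5 (λ A u v z x → (((A ⊙ (u ⊙ v)) ⊙ z) ⊙ x) ⊜ ((A ⊙ v) ⊙ z) ⊙ (u ⊙ x)) refl (rest t) _ _ y⁻ _ ⟩
      rest t ⊗ w ^ (K t a + K t b) ⊗ y⁻ ⊗ (q ^ (K t c + K t d) ⊗ w ^ (K t c + K t d))
        ≡⟨ cong (rest t ⊗ w ^ (K t a + K t b) ⊗ y⁻ ⊗_) (trans (q⊗w (K t c + K t d)) (trans (cong (y 1 ^_) (sym (K-rec t t>0))) (^-+ (y 1) (K t 0) (K t N)))) ⟩
      rest t ⊗ w ^ (K t a + K t b) ⊗ y⁻ ⊗ (y 1 ^ K t 0 ⊗ y 1 ^ K t N)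
        ≡⟨ solve 5 (λ A v z x u → ((A ⊙ v) ⊙ z) ⊙ (x ⊙ u) ⊜ ((x ⊙ A) ⊙ v) ⊙ (z ⊙ u)) refl (rest t) _ y⁻ _ _ ⟩
      y 1 ^ K t 0 ⊗ rest t ⊗ w ^ (K t a + K t b) ⊗ (y⁻ ⊗ y 1 ^ K t N)
        ≡⟨ cong₂ _⊗_ (cong (_⊗ w ^ (K t a + K t b)) (sym (Y-y t))) (⁻¹-^ (y 1) (K t N)) ⟩
      Y y (suc t) ⊗ w ^ (K t a + K t b) ⊗ 𝟙
        ≡⟨ identityʳ _ ⟩
      Y y (suc t) ⊗ w ^ (K t a + K t b) ∎
      where
      open ≡-Reasoning
      y⁻ = (y 1 ⁻¹) ^ K t N
      open CMSolver using (solve; _⊙_; _⊜_)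

    exchange-⊗ : ∀ z V m → exchange z V m ⊗ V 0 ≡ Y z (suc m) ⊗ (V a ⊗ V b) ⊕ V c ⊗ V d
    exchange-⊗ z V m = trans (⊗-assoc _ (V 0 ⁻¹) (V 0)) (trans (cong (λ u → (Y z (suc m) ⊗ (V a ⊗ V b) ⊕ V c ⊗ V d) ⊗ u) (inverseˡ (V 0))) (identityʳ _))

    fresh-0 : fresh y 0 ≡ w
    fresh-0 = ⊗-cancelʳ 𝟙 (trans (exchange-⊗ y (λ _ → 𝟙) 0)
      (trans (cong₂ _⊕_ (trans (cong₂ _⊗_ Y₁ (identityˡ 𝟙)) (identityʳ (y 1))) (identityˡ 𝟙)) (sym (identityʳ w))))
      where
      Y₁ : Y y 1 ≡ y 1
      Y₁ = trans (Y-y 0) (trans (cong₂ (λ n z → y 1 ^ n ⊗ z) K-00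
             (trans (∏-cong (pred N) (λ i i>0 _ → cong (y (suc i) ^_) (K-zero 0 i i>0))) (∏-𝟙 (pred N))))
           (trans (identityʳ _) (identityʳ (y 1))))

    private
      -- One exponent fits all positions: it is 0 as long as the variable is an initial one for both
      -- seeds, and in position N - 1 it is K (m + N) N = K m 0, the exponent belonging to the
      -- variable just created.
      Reseeds : ℕ → Set
      Reseeds m = ∀ {ρ} → ρ < N → window y (suc m) ρ ≡ w ^ K (suc m + ρ) N ⊗ window y′ m ρ

      -- Complementary positions u and N - u contribute the exponents K t (N - u) and K t u. So the
      -- two products of the exchange relation carry w^(K t a + K t b) and w^(K t c + K t d), and
      -- `Y-reseed` turns the first power into the second. By `K-rec` the common exponent is K t 0 +
      -- K t N, where K t N is absorbed by the divisor `V 0`.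
      fresh-step : ∀ m → Reseeds m → fresh y (suc m) ≡ w ^ K (suc m) 0 ⊗ fresh y′ m
      fresh-step m h = ⊗-cancelʳ (V 0) (begin
        fresh y (suc m) ⊗ V 0                         ≡⟨ exchange-⊗ y V (suc m) ⟩
        Y y (suc t) ⊗ (V a ⊗ V b) ⊕ V c ⊗ V d         ≡⟨ cong₂ _⊕_ (cong (Y y (suc t) ⊗_) (pair a<N b<N refl (+-comm b a))) (pair c<N d<N c+d (trans (+-comm d c) c+d)) ⟩
        Y y (suc t) ⊗ (w ^ (K t b + K t a) ⊗ (V′ a ⊗ V′ b)) ⊕ w ^ (K t d + K t c) ⊗ (V′ c ⊗ V′ d)
          ≡⟨ cong₂ (λ u v → Y y (suc t) ⊗ (w ^ u ⊗ (V′ a ⊗ V′ b)) ⊕ w ^ v ⊗ (V′ c ⊗ V′ d)) (+-comm (K t b) (K t a)) (+-comm (K t d) (K t c)) ⟩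
        Y y (suc t) ⊗ (w ^ (K t a + K t b) ⊗ (V′ a ⊗ V′ b)) ⊕ w ^ (K t c + K t d) ⊗ (V′ c ⊗ V′ d)
          ≡⟨ cong (_⊕ w ^ (K t c + K t d) ⊗ (V′ c ⊗ V′ d)) (trans (sym (⊗-assoc _ _ _)) (trans (cong (_⊗ (V′ a ⊗ V′ b)) (trans (sym (Y-reseed t z<s)) (⊗-comm _ _))) (⊗-assoc _ _ _))) ⟩
        w ^ (K t c + K t d) ⊗ (Y y′ t ⊗ (V′ a ⊗ V′ b)) ⊕ w ^ (K t c + K t d) ⊗ (V′ c ⊗ V′ d)
          ≡⟨ distribˡ _ _ _ ⟨
        w ^ (K t c + K t d) ⊗ (Y y′ t ⊗ (V′ a ⊗ V′ b) ⊕ V′ c ⊗ V′ d)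
          ≡⟨ cong₂ _⊗_ (trans (cong (w ^_) (sym (K-rec t z<s))) (^-+ w (K t 0) (K t N))) (sym (exchange-⊗ y′ V′ m)) ⟩
        w ^ K t 0 ⊗ w ^ K t N ⊗ (fresh y′ m ⊗ V′ 0)
          ≡⟨ medial _ _ _ _ ⟩
        w ^ K t 0 ⊗ fresh y′ m ⊗ (w ^ K t N ⊗ V′ 0)
          ≡⟨ cong (w ^ K t 0 ⊗ fresh y′ m ⊗_) (trans (h N>0) (cong (λ n → w ^ K n N ⊗ V′ 0) (+-identityʳ t))) ⟨
        w ^ K t 0 ⊗ fresh y′ m ⊗ V 0 ∎)
        where
        open ≡-Reasoning
        t = suc m
        V = window y (suc m)
        V′ = window y′ m
        K-comp : ∀ u v → u + v ≡ N → K (t + u) N ≡ K t v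
        K-comp u v uv = trans (cong₂ K (+-comm t u) (sym uv)) (K-shift* u t v)
        pair : ∀ {u v} → u < N → v < N → u + v ≡ N → v + u ≡ N → V u ⊗ V v ≡ w ^ (K t v + K t u) ⊗ (V′ u ⊗ V′ v)
        pair {u} {v} u<N v<N uv vu = begin
          V u ⊗ V v                                              ≡⟨ cong₂ _⊗_ (h u<N) (h v<N) ⟩
          w ^ K (t + u) N ⊗ V′ u ⊗ (w ^ K (t + v) N ⊗ V′ v)       ≡⟨ medial _ _ _ _ ⟩
          w ^ K (t + u) N ⊗ w ^ K (t + v) N ⊗ (V′ u ⊗ V′ v)       ≡⟨ cong₂ (λ m n → w ^ m ⊗ w ^ n ⊗ (V′ u ⊗ V′ v)) (K-comp u v uv) (K-comp v u vu) ⟩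
          w ^ K t v ⊗ w ^ K t u ⊗ (V′ u ⊗ V′ v)                   ≡⟨ cong (_⊗ (V′ u ⊗ V′ v)) (sym (^-+ w (K t v) (K t u))) ⟩
          w ^ (K t v + K t u) ⊗ (V′ u ⊗ V′ v)                     ∎

      last : ∀ z m {ρ} → suc ρ ≡ N → window z (suc m) ρ ≡ fresh z m
      last z m eq = trans (cong (window z (suc m)) (cong pred eq)) (window-last z m)

      reseeds : ∀ m → Reseeds m
      reseeds zero {ρ} ρ<N with suc ρ ≟ N
      ... | yes eq = trans (last y 0 eq) (trans fresh-0 (sym (trans (identityʳ _) (trans (cong (w ^_) (trans (cong (λ n → K n N) eq) (K-diag N))) (identityʳ w)))))
      ... | no ρ≢ = trans (window-suc y 0 p) (sym (trans (identityʳ _) (cong (w ^_) (K-zero _ _ p))))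
        where p = ≤∧≢⇒< ρ<N ρ≢
      reseeds (suc m) {ρ} ρ<N with suc ρ ≟ N
      ... | yes eq = trans (last y (suc m) eq) (trans (fresh-step m (reseeds m))
                       (cong₂ (λ n z → w ^ n ⊗ z) K≡ (sym (last y′ m eq))))
        where
        K≡ : K (suc m) 0 ≡ K (suc (suc m) + ρ) N
        K≡ = trans (sym (K-shift* N (suc m) 0))
          (cong₂ K (trans (+-comm N (suc m)) (trans (cong (λ n → suc m + n) (sym eq)) (+-suc (suc m) ρ))) (+-identityʳ N))
      ... | no ρ≢ = trans (window-suc y (suc m) p) (trans (reseeds m p)
                     (cong₂ (λ n z → w ^ K n N ⊗ z) (+-suc (suc m) ρ) (sym (window-suc y′ m p))))
        where p = ≤∧≢⇒< ρ<N ρ≢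

    fresh-suc : ∀ m → fresh y (suc m) ≡ w ^ K (suc m) 0 ⊗ fresh y′ m
    fresh-suc m = fresh-step m (reseeds m)

-- Sums over subsets and order ideals

true-ext : ∀ {b b′ : Bool} → (b ≡ true → b′ ≡ true) → (b′ ≡ true → b ≡ true) → b ≡ b′
true-ext {false} {false} f g = refl
true-ext {false} {true}  f g = g refl
true-ext {true}  {b′}    f g = sym (f refl)

does-true : ∀ {p} {X : Set p} (X? : Dec X) → does X? ≡ true → X
does-true (yes x) _ = x

-- A semifield has no zero. With `nothing` in that role a condition becomes a factor `⟦ b ⟧`, and a
-- sum over ideals becomes a sum over all subsets.
module Semiring₀ (P : Semifield) where
  open SemifieldProperties P public

  infixl 6 _⊞_
  infixl 7 _⊠_

  _⊞_ _⊠_ : Maybe Carrier → Maybe Carrier → Maybe Carrier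
  _⊞_ = _⊕?_ P
  just x ⊠ just z  = just (x ⊗ z)
  just x ⊠ nothing = nothing
  nothing ⊠ m      = nothing

  ⊞-identityʳ : ∀ m → m ⊞ nothing ≡ m
  ⊞-identityʳ (just x) = refl
  ⊞-identityʳ nothing  = refl

  ⊞-comm : ∀ m n → m ⊞ n ≡ n ⊞ m
  ⊞-comm (just x) (just z) = cong just (⊕-comm x z)
  ⊞-comm (just x) nothing  = refl
  ⊞-comm nothing  n        = sym (⊞-identityʳ n)

  ⊞-assoc : ∀ m n o → (m ⊞ n) ⊞ o ≡ m ⊞ (n ⊞ o)
  ⊞-assoc (just x) (just z) (just u) = cong just (⊕-assoc x z u)
  ⊞-assoc (just x) (just z) nothing  = refl
  ⊞-assoc (just x) nothing  o        = refl
  ⊞-assoc nothing  n        o        = refl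

  ⊞-medial : ∀ m n o p → (m ⊞ n) ⊞ (o ⊞ p) ≡ (m ⊞ o) ⊞ (n ⊞ p)
  ⊞-medial m n o p = trans (⊞-assoc m n (o ⊞ p)) (trans (cong (m ⊞_)
    (trans (sym (⊞-assoc n o p)) (trans (cong (_⊞ p) (⊞-comm n o)) (⊞-assoc o n p)))) (sym (⊞-assoc m o (n ⊞ p))))

  ⊠-identityˡ : ∀ m → just 𝟙 ⊠ m ≡ m
  ⊠-identityˡ (just x) = cong just (identityˡ x)
  ⊠-identityˡ nothing  = refl

  ⊠-distribˡ : ∀ m n o → m ⊠ (n ⊞ o) ≡ m ⊠ n ⊞ m ⊠ o
  ⊠-distribˡ (just x) (just z) (just u) = cong just (distribˡ x z u)
  ⊠-distribˡ (just x) (just z) nothing  = refl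
  ⊠-distribˡ (just x) nothing  o        = refl
  ⊠-distribˡ nothing  n        o        = refl

  ⊠-distribʳ : ∀ m n o → (n ⊞ o) ⊠ m ≡ n ⊠ m ⊞ o ⊠ m
  ⊠-distribʳ (just x) (just z) (just u) = cong just (distribʳ x z u)
  ⊠-distribʳ nothing  (just z) (just u) = refl
  ⊠-distribʳ m        (just z) nothing  = sym (⊞-identityʳ (just z ⊠ m))
  ⊠-distribʳ m        nothing  o        = refl

  ⟦_⟧ : Bool → Maybe Carrier
  ⟦ b ⟧ = if b then just 𝟙 else nothing

  ∏ₗ : ∀ {A : Set} → List A → (A → Carrier) → Carrier
  ∏ₗ xs f = prodL P (map f xs)

  ∏ₗ-cong : ∀ {A : Set} {f g : A → Carrier} xs → (∀ {x} → x ∈ xs → f x ≡ g x) → ∏ₗ xs f ≡ ∏ₗ xs g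
  ∏ₗ-cong []       h = refl
  ∏ₗ-cong (x ∷ xs) h = cong₂ _⊗_ (h (here refl)) (∏ₗ-cong xs (h ∘ there))

  ∏ₗ-⊗ : ∀ {A : Set} (f g : A → Carrier) xs → ∏ₗ xs (λ x → f x ⊗ g x) ≡ ∏ₗ xs f ⊗ ∏ₗ xs g
  ∏ₗ-⊗ f g []       = sym (identityˡ 𝟙)
  ∏ₗ-⊗ f g (x ∷ xs) = trans (cong (f x ⊗ g x ⊗_) (∏ₗ-⊗ f g xs)) (medial _ _ _ _)

  ∏ₗ-^ : ∀ {A : Set} z (f : A → ℕ) xs → ∏ₗ xs (λ x → z ^ f x) ≡ z ^ ∑ xs f
  ∏ₗ-^ z f []       = refl
  ∏ₗ-^ z f (x ∷ xs) = trans (cong (z ^ f x ⊗_) (∏ₗ-^ z f xs)) (sym (^-+ z (f x) (∑ xs f)))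

  ∏ₗ-𝟙 : ∀ {A : Set} {f : A → Carrier} xs → (∀ {x} → x ∈ xs → f x ≡ 𝟙) → ∏ₗ xs f ≡ 𝟙
  ∏ₗ-𝟙 []       h = refl
  ∏ₗ-𝟙 (x ∷ xs) h = trans (cong₂ _⊗_ (h (here refl)) (∏ₗ-𝟙 xs (h ∘ there))) (identityˡ 𝟙)

  ∏ₗ-++ : ∀ {A : Set} (f : A → Carrier) xs ys → ∏ₗ (xs ++ ys) f ≡ ∏ₗ xs f ⊗ ∏ₗ ys f
  ∏ₗ-++ f []       ys = sym (identityˡ _)
  ∏ₗ-++ f (x ∷ xs) ys = trans (cong (f x ⊗_) (∏ₗ-++ f xs ys)) (sym (⊗-assoc (f x) _ _))

  ∏ₗ-↭ : ∀ {A : Set} (f : A → Carrier) {xs ys} → xs ↭ ys → ∏ₗ xs f ≡ ∏ₗ ys f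
  ∏ₗ-↭ f p = ↭ₛₚ.foldr-commMonoid (setoid Carrier) isCommutativeMonoid (↭⇒↭ₛ (↭ₚ.map⁺ f p))

  ∏? : ∀ {A : Set} → List A → (A → Maybe Carrier) → Maybe Carrier
  ∏? []       f = just 𝟙
  ∏? (x ∷ xs) f = f x ⊠ ∏? xs f

  ∏?-just : ∀ {A : Set} {f : A → Maybe Carrier} {g : A → Carrier} xs → (∀ {x} → x ∈ xs → f x ≡ just (g x)) → ∏? xs f ≡ just (∏ₗ xs g)
  ∏?-just []       h = refl
  ∏?-just (x ∷ xs) h = cong₂ _⊠_ (h (here refl)) (∏?-just xs (h ∘ there))

  ∏?-guard : ∀ {A : Set} (ok : A → Bool) (g : A → Carrier) xs →
             ∏? xs (λ x → ⟦ ok x ⟧ ⊠ just (g x)) ≡ ⟦ all ok xs ⟧ ⊠ just (∏ₗ xs g)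
  ∏?-guard ok g []       = cong just (sym (identityˡ 𝟙))
  ∏?-guard ok g (x ∷ xs) with ok x
  ... | false = refl
  ... | true  = trans (cong (just (𝟙 ⊗ g x) ⊠_) (∏?-guard ok g xs)) (absorb (all ok xs))
    where
    absorb : ∀ b → just (𝟙 ⊗ g x) ⊠ (⟦ b ⟧ ⊠ just (∏ₗ xs g)) ≡ ⟦ b ⟧ ⊠ just (g x ⊗ ∏ₗ xs g)
    absorb true  = cong just (trans (cong₂ _⊗_ (identityˡ (g x)) (identityˡ _)) (sym (identityˡ _)))
    absorb false = refl

  module Subsets {A : Set} (_≟_ : DecidableEquality A) where

    insert : A → (A → Bool) → A → Bool
    insert x χ z = does (z ≟ x) ∨ χ z

    insert-≡ : ∀ x χ → insert x χ x ≡ true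
    insert-≡ x χ rewrite dec-true (x ≟ x) refl = refl

    insert-≢ : ∀ {x χ z} → z ≢ x → insert x χ z ≡ χ z
    insert-≢ {x} {χ} {z} z≢x rewrite dec-false (z ≟ x) z≢x = refl

    -- ∑⊆ xs χ φ sums φ over the unions of χ with the subsets of xs, sets being given by their indicator functions.
    ∑⊆ : List A → (A → Bool) → ((A → Bool) → Maybe Carrier) → Maybe Carrier
    ∑⊆ []       χ φ = φ χ
    ∑⊆ (x ∷ xs) χ φ = ∑⊆ xs χ φ ⊞ ∑⊆ xs (insert x χ) φ

    ∅ : A → Bool
    ∅ _ = false

    -- Inserting the same elements in another order gives a function that is only pointwise equal,
    -- so summands have to respect pointwise equality before a list may be permuted.
    Extensional : ((A → Bool) → Maybe Carrier) → Set
    Extensional φ = ∀ {χ χ′} → (∀ z → χ z ≡ χ′ z) → φ χ ≡ φ χ′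

    -- Only sets that agree with `χ` outside of `xs` occur in the sum. This keeps the part of an
    -- ideal in `E` fixed while a layer is summed out.
    ∑⊆-cong : ∀ {φ ψ} xs χ → (∀ χ′ → (∀ z → z ∉ xs → χ′ z ≡ χ z) → φ χ′ ≡ ψ χ′) → ∑⊆ xs χ φ ≡ ∑⊆ xs χ ψ
    ∑⊆-cong []       χ h = h χ (λ _ _ → refl)
    ∑⊆-cong (x ∷ xs) χ h = cong₂ _⊞_
      (∑⊆-cong xs χ (λ χ′ e → h χ′ (λ z z∉ → e z (z∉ ∘ there))))
      (∑⊆-cong xs (insert x χ) (λ χ′ e → h χ′ (λ z z∉ → trans (e z (z∉ ∘ there)) (insert-≢ {x} {χ} (z∉ ∘ here)))))

    ∑⊆-ext : ∀ {φ} → Extensional φ → ∀ xs {χ χ′} → (∀ z → χ z ≡ χ′ z) → ∑⊆ xs χ φ ≡ ∑⊆ xs χ′ φ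
    ∑⊆-ext ext []       h = ext h
    ∑⊆-ext ext (x ∷ xs) h = cong₂ _⊞_ (∑⊆-ext ext xs h) (∑⊆-ext ext xs (λ z → cong (does (z ≟ x) ∨_) (h z)))

    ∑⊆-↭ : ∀ {φ} → Extensional φ → ∀ {xs ys} → xs ↭ ys → ∀ χ → ∑⊆ xs χ φ ≡ ∑⊆ ys χ φ
    ∑⊆-↭ ext ↭.refl          χ = refl
    ∑⊆-↭ ext (↭.prep x p)    χ = cong₂ _⊞_ (∑⊆-↭ ext p χ) (∑⊆-↭ ext p (insert x χ))
    ∑⊆-↭ {φ} ext (↭.swap {xs} {ys} x z p) χ = trans
      (cong₂ _⊞_ (cong₂ _⊞_ (∑⊆-↭ ext p χ) (∑⊆-↭ ext p (insert z χ)))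
                 (cong₂ _⊞_ (∑⊆-↭ ext p (insert x χ)) (trans (∑⊆-↭ ext p (insert z (insert x χ))) (∑⊆-ext ext ys exchange-insert))))
      (⊞-medial (∑⊆ ys χ φ) (∑⊆ ys (insert z χ) φ) (∑⊆ ys (insert x χ) φ) (∑⊆ ys (insert x (insert z χ)) φ))
      where
      exchange-insert : ∀ u → insert z (insert x χ) u ≡ insert x (insert z χ) u
      exchange-insert u = trans (sym (∨-assoc (does (u ≟ z)) _ _))
        (trans (cong (_∨ χ u) (∨-comm (does (u ≟ z)) (does (u ≟ x)))) (∨-assoc (does (u ≟ x)) _ _))
    ∑⊆-↭ ext (↭.trans p p′)  χ = trans (∑⊆-↭ ext p χ) (∑⊆-↭ ext p′ χ)

    ∑⊆-++ : ∀ φ xs ys χ → ∑⊆ (xs ++ ys) χ φ ≡ ∑⊆ xs χ (λ χ′ → ∑⊆ ys χ′ φ)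
    ∑⊆-++ φ []       ys χ = refl
    ∑⊆-++ φ (x ∷ xs) ys χ = cong₂ _⊞_ (∑⊆-++ φ xs ys χ) (∑⊆-++ φ xs ys (insert x χ))

    ∑⊆-⊠ : ∀ m φ xs χ → ∑⊆ xs χ (λ χ′ → m ⊠ φ χ′) ≡ m ⊠ ∑⊆ xs χ φ
    ∑⊆-⊠ m φ []       χ = refl
    ∑⊆-⊠ m φ (x ∷ xs) χ = trans (cong₂ _⊞_ (∑⊆-⊠ m φ xs χ) (∑⊆-⊠ m φ xs (insert x χ))) (sym (⊠-distribˡ m _ _))

    -- This is the distributive law: expanding the product on the right means deciding for each
    -- element whether it belongs to the subset.
    ∑⊆-∏? : ∀ (ψ : A → Bool → Maybe Carrier) {xs} χ → Unique xs → (∀ {z} → z ∈ xs → χ z ≡ false) →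
            ∑⊆ xs χ (λ χ′ → ∏? xs (λ x → ψ x (χ′ x))) ≡ ∏? xs (λ x → ψ x false ⊞ ψ x true)
    ∑⊆-∏? ψ {[]}     χ _        _ = refl
    ∑⊆-∏? ψ {x ∷ xs} χ (x∉ ∷ u) h = trans
      (cong₂ _⊞_ (split χ (h (here refl)) (h ∘ there))
                 (split (insert x χ) (insert-≡ x χ) (λ z∈ → trans (insert-≢ {x} {χ} (λ z≡x → All.lookup x∉ z∈ (sym z≡x))) (h (there z∈)))))
      (sym (⊠-distribʳ _ (ψ x false) (ψ x true)))
      where
      split : ∀ χ {b} → χ x ≡ b → (∀ {z} → z ∈ xs → χ z ≡ false) →
              ∑⊆ xs χ (λ χ′ → ψ x (χ′ x) ⊠ ∏? xs (λ x → ψ x (χ′ x))) ≡ ψ x b ⊠ ∏? xs (λ x → ψ x false ⊞ ψ x true)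
      split χ {b} refl h = trans
        (∑⊆-cong xs χ (λ χ′ e → cong (λ t → ψ x t ⊠ ∏? xs (λ x → ψ x (χ′ x))) (e x (λ x∈ → All.lookup x∉ x∈ refl))))
        (trans (∑⊆-⊠ (ψ x b) _ xs χ) (cong (ψ x b ⊠_) (∑⊆-∏? ψ χ u h)))

    ∑⊆-zero : ∀ xs χ → ∑⊆ xs χ (λ _ → nothing) ≡ nothing
    ∑⊆-zero []       χ = refl
    ∑⊆-zero (x ∷ xs) χ = cong₂ _⊞_ (∑⊆-zero xs χ) (∑⊆-zero xs (insert x χ))

    adjoin : (A → Bool) → List A → A → Bool
    adjoin χ []      = χ
    adjoin χ (x ∷ R) = adjoin (insert x χ) R

    ∈⇒adjoin : ∀ R {χ z} → z ∈ R ⊎ χ z ≡ true → adjoin χ R z ≡ true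
    ∈⇒adjoin []      (inj₂ e) = e
    ∈⇒adjoin (x ∷ R) {χ} (inj₁ (here refl)) = ∈⇒adjoin R (inj₂ (insert-≡ x χ))
    ∈⇒adjoin (x ∷ R) (inj₁ (there z∈)) = ∈⇒adjoin R (inj₁ z∈)
    ∈⇒adjoin (x ∷ R) {χ} {z} (inj₂ e) = ∈⇒adjoin R (inj₂ (trans (cong (does (z ≟ x) ∨_) e) (∨-zeroʳ (does (z ≟ x)))))

    adjoin⇒∈ : ∀ R {χ z} → adjoin χ R z ≡ true → z ∈ R ⊎ χ z ≡ true
    adjoin⇒∈ []      e = inj₂ e
    adjoin⇒∈ (x ∷ R) {χ} {z} e with adjoin⇒∈ R e
    ... | inj₁ z∈ = inj₁ (there z∈)
    ... | inj₂ i with z ≟ x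
    ...   | yes z≡x = inj₁ (here z≡x)
    ...   | no _ = inj₂ i

    sum? : List (Maybe Carrier) → Maybe Carrier
    sum? = foldr _⊞_ nothing

    sum?-++ : ∀ ms ns → sum? (ms ++ ns) ≡ sum? ms ⊞ sum? ns
    sum?-++ []       ns = refl
    sum?-++ (m ∷ ms) ns = trans (cong (m ⊞_) (sum?-++ ms ns)) (sym (⊞-assoc m _ _))

    ∑⊆-sublists : ∀ φ xs χ → sum? (map (φ ∘ adjoin χ) (sublists xs)) ≡ ∑⊆ xs χ φ
    ∑⊆-sublists φ []       χ = ⊞-identityʳ (φ χ)
    ∑⊆-sublists φ (x ∷ xs) χ = begin
      sum? (map (φ ∘ adjoin χ) (r ++ map (x ∷_) r))
        ≡⟨ cong sum? (map-++ (φ ∘ adjoin χ) r (map (x ∷_) r)) ⟩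
      sum? (map (φ ∘ adjoin χ) r ++ map (φ ∘ adjoin χ) (map (x ∷_) r))
        ≡⟨ sum?-++ (map (φ ∘ adjoin χ) r) _ ⟩
      sum? (map (φ ∘ adjoin χ) r) ⊞ sum? (map (φ ∘ adjoin χ) (map (x ∷_) r))
        ≡⟨ cong₂ _⊞_ (∑⊆-sublists φ xs χ) (trans (cong sum? (sym (map-∘ r))) (∑⊆-sublists φ xs (insert x χ))) ⟩
      ∑⊆ xs χ φ ⊞ ∑⊆ xs (insert x χ) φ ∎
      where
      open ≡-Reasoning
      r = sublists xs

  module _ {A B : Set} (_≟ᴬ_ : DecidableEquality A) (_≟ᴮ_ : DecidableEquality B) where
    private
      module SA = Subsets _≟ᴬ_
      module SB = Subsets _≟ᴮ_

    ∑⊆-map : ∀ (f : A → B) → (∀ {x z} → f x ≡ f z → x ≡ z) → ∀ {φ ψ} → SA.Extensional ψ → (∀ χ → φ χ ≡ ψ (χ ∘ f)) →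
             ∀ xs χ → SB.∑⊆ (map f xs) χ φ ≡ SA.∑⊆ xs (χ ∘ f) ψ
    ∑⊆-map f inj ext h []       χ = h χ
    ∑⊆-map f inj ext h (x ∷ xs) χ = cong₂ _⊞_ (∑⊆-map f inj ext h xs χ)
      (trans (∑⊆-map f inj ext h xs (SB.insert (f x) χ))
             (SA.∑⊆-ext ext xs (λ z → cong (_∨ χ (f z)) (does-⇔ (mk⇔ inj (cong f)) (f z ≟ᴮ f x) (z ≟ᴬ x)))))

all⁻ : ∀ {A : Set} (f : A → Bool) xs → all f xs ≡ true → ∀ {x} → x ∈ xs → f x ≡ true
all⁻ f (x ∷ xs) h (here refl) with f x | h
... | true | _ = refl
all⁻ f (x ∷ xs) h (there x∈) with f x | h
... | true | h′ = all⁻ f xs h′ x∈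

all⁺ : ∀ {A : Set} (f : A → Bool) xs → (∀ {x} → x ∈ xs → f x ≡ true) → all f xs ≡ true
all⁺ f []       h = refl
all⁺ f (x ∷ xs) h rewrite h (here refl) = all⁺ f xs (h ∘ there)

any⁺ : ∀ {A : Set} (f : A → Bool) {xs x} → x ∈ xs → f x ≡ true → any f xs ≡ true
any⁺ f (here refl) e rewrite e = refl
any⁺ f {x ∷ xs} (there x∈) e = trans (cong (f x ∨_) (any⁺ f x∈ e)) (∨-zeroʳ (f x))

any⁻ : ∀ {A : Set} (f : A → Bool) xs → any f xs ≡ true → ∃ λ x → x ∈ xs × f x ≡ true
any⁻ f (x ∷ xs) h with f x in eq
... | true  = x , here refl , eq
... | false = let z , z∈ , e = any⁻ f xs h in z , there z∈ , e

false≢true : ∀ {b} → b ≡ false → b ≡ true → ∀ {X : Set} → X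
false≢true refl ()

module Ideals (P : Semifield) {A : Set} (_≟_ : DecidableEquality A) (_⊑_ : A → A → Set) (_⊑?_ : ∀ x z → Dec (x ⊑ z)) where
  open Semiring₀ P public
  open Subsets _≟_ public

  record Down (L : List A) (χ : A → Bool) : Set where
    constructor down
    field closed : All (λ x → All (λ z → z ⊑ x → χ x ≡ true → χ z ≡ true) L) L

  down? : ∀ L χ → Dec (Down L χ)
  down? L χ = map′ down Down.closed (all? (λ x → all? (λ z → (z ⊑? x) →-dec ((χ x ≟ᵇ true) →-dec (χ z ≟ᵇ true))) L) L)

  down⁺ : ∀ {L χ} → (∀ {x z} → x ∈ L → z ∈ L → z ⊑ x → χ x ≡ true → χ z ≡ true) → Down L χ
  down⁺ h = down (All.tabulate (λ x∈ → All.tabulate (λ z∈ → h x∈ z∈)))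

  down⁻ : ∀ {L χ} → Down L χ → ∀ {x z} → x ∈ L → z ∈ L → z ⊑ x → χ x ≡ true → χ z ≡ true
  down⁻ (down D) x∈ z∈ = All.lookup (All.lookup D x∈) z∈

  weigh : (A → Carrier) → (A → Bool) → A → Carrier
  weigh w χ x = if χ x then w x else 𝟙

  term : List A → (A → Carrier) → (A → Bool) → Maybe Carrier
  term L w χ = ⟦ does (down? L χ) ⟧ ⊠ just (∏ₗ L (weigh w χ))

  ∑ideals : List A → (A → Carrier) → Maybe Carrier
  ∑ideals L w = ∑⊆ L ∅ (term L w)

  term-cong : ∀ {L w χ χ′} → (∀ {x} → x ∈ L → χ x ≡ χ′ x) → term L w χ ≡ term L w χ′
  term-cong {L} {w} {χ} {χ′} h = cong₂ (λ b z → ⟦ b ⟧ ⊠ just z)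
    (does-⇔ (mk⇔ (transport χ χ′ h) (transport χ′ χ (sym ∘ h))) (down? L χ) (down? L χ′))
    (∏ₗ-cong L (λ {x} x∈ → cong (λ b → if b then w x else 𝟙) (h x∈)))
    where
    transport : ∀ χ χ′ → (∀ {x} → x ∈ L → χ x ≡ χ′ x) → Down L χ → Down L χ′
    transport χ χ′ h D = down⁺ (λ x∈ z∈ z⊑x χ′x → trans (sym (h z∈)) (down⁻ D x∈ z∈ z⊑x (trans (h x∈) χ′x)))

  term-ext : ∀ L w → Extensional (term L w)
  term-ext L w {χ} {χ′} h = term-cong {L} {w} {χ} {χ′} (λ {x} _ → h x)

  ∑ideals-↭ : ∀ {L L′} w → L ↭ L′ → ∑ideals L w ≡ ∑ideals L′ w
  ∑ideals-↭ {L} {L′} w p = trans (∑⊆-↭ (term-ext L w) p ∅) (∑⊆-cong L′ ∅ (λ χ _ → cong₂ (λ b z → ⟦ b ⟧ ⊠ just z)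
    (does-⇔ (mk⇔ (transport χ p) (transport χ (↭-sym p))) (down? L χ) (down? L′ χ)) (∏ₗ-↭ (weigh w χ) p)))
    where
    transport : ∀ χ {L L′} → L ↭ L′ → Down L χ → Down L′ χ
    transport χ p D = down⁺ (λ x∈ z∈ → down⁻ D (↭ₚ.∈-resp-↭ (↭-sym p) x∈) (↭ₚ.∈-resp-↭ (↭-sym p) z∈))

  ∑ideals-cong : ∀ L {w w′} → (∀ {x} → x ∈ L → w x ≡ w′ x) → ∑ideals L w ≡ ∑ideals L w′
  ∑ideals-cong L h = ∑⊆-cong L ∅ (λ χ _ → cong (λ z → ⟦ does (down? L χ) ⟧ ⊠ just z)
    (∏ₗ-cong L (λ {x} x∈ → cong (λ u → if χ x then u else 𝟙) (h x∈))))

  private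
    ∈-sublists : ∀ (xs : List A) {R z} → R ∈ sublists xs → z ∈ R → z ∈ xs
    ∈-sublists []       (here refl) z∈ = z∈
    ∈-sublists (x ∷ xs) R∈ z∈ with ∈-++⁻ (sublists xs) R∈
    ... | inj₁ R∈′ = there (∈-sublists xs R∈′ z∈)
    ... | inj₂ xR∈ with ∈-map⁻ (x ∷_) xR∈
    ...   | R′ , R′∈ , refl with z∈
    ...     | here refl = here refl
    ...     | there z∈′ = there (∈-sublists xs R′∈ z∈′)

    mem : List A → A → Bool
    mem R = adjoin ∅ R

    mem⁻ : ∀ R {z} → mem R z ≡ true → z ∈ R
    mem⁻ R e with adjoin⇒∈ R e
    ... | inj₁ z∈ = z∈

    mem⁺ : ∀ R {z} → z ∈ R → mem R z ≡ true
    mem⁺ R z∈ = ∈⇒adjoin R (inj₁ z∈)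

    ∉-mem : ∀ R {z} → z ∉ R → mem R z ≡ false
    ∉-mem R {z} z∉ with mem R z in eq
    ... | true  = ⊥-elim (z∉ (mem⁻ R eq))
    ... | false = refl

    ∏-sublist : ∀ w {xs} → Unique xs → ∀ {R} → R ∈ sublists xs → ∏ₗ R w ≡ ∏ₗ xs (weigh w (mem R))
    ∏-sublist w {[]}     _        (here refl) = refl
    ∏-sublist w {x ∷ xs} (x∉ ∷ u) {R} R∈ with ∈-++⁻ (sublists xs) R∈
    ... | inj₁ R∈′ rewrite ∉-mem R {x} (λ x∈ → All.lookup x∉ (∈-sublists xs R∈′ x∈) refl) = trans (∏-sublist w u R∈′) (sym (identityˡ _))
    ... | inj₂ xR∈ with ∈-map⁻ (x ∷_) xR∈
    ...   | R′ , R′∈ , refl rewrite mem⁺ (x ∷ R′) (here refl) = cong (w x ⊗_) (trans (∏-sublist w u R′∈)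
             (∏ₗ-cong xs (λ {z} z∈ → cong (λ b → if b then w z else 𝟙) (true-ext
               (λ e → mem⁺ (x ∷ R′) (there (mem⁻ R′ e)))
               (λ e → mem⁺ R′ (drop z∈ (mem⁻ (x ∷ R′) e)))))))
      where
      drop : ∀ {z} → z ∈ xs → z ∈ x ∷ R′ → z ∈ R′
      drop z∈ (here refl)  = ⊥-elim (All.lookup x∉ z∈ refl)
      drop z∈ (there z∈R′) = z∈R′

  -- The predicate unfolds to `IsIdeal` for the order itself and to `IsFilter` for the opposite
  -- order, so both sums of the theorem are covered.
  ∑ideals-sublists : ∀ {L} w → Unique L → (D? : Decidable (λ R → All (λ x → All (λ z → z ⊑ x → z ∈ R) L) R)) →
    sumL P (map (λ R → prodL P (map w R)) (filter D? (sublists L))) ≡ ∑ideals L w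
  ∑ideals-sublists {L} w u D? = trans (guard (sublists L) (λ R∈ → R∈)) (∑⊆-sublists (term L w) L ∅)
    where
    to : ∀ {R} → R ∈ sublists L → All (λ x → All (λ z → z ⊑ x → z ∈ R) L) R → Down L (mem R)
    to {R} R∈ D = down⁺ (λ x∈ z∈ z⊑x e → mem⁺ R (All.lookup (All.lookup D (mem⁻ R e)) z∈ z⊑x))
    from : ∀ {R} → R ∈ sublists L → Down L (mem R) → All (λ x → All (λ z → z ⊑ x → z ∈ R) L) R
    from {R} R∈ D = All.tabulate (λ x∈ → All.tabulate (λ z∈ z⊑x → mem⁻ R (down⁻ D (∈-sublists L R∈ x∈) z∈ z⊑x (mem⁺ R x∈))))
    guard : ∀ Rs → (∀ {R} → R ∈ Rs → R ∈ sublists L) →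
            sumL P (map (λ R → prodL P (map w R)) (filter D? Rs)) ≡ sum? (map (term L w ∘ mem) Rs)
    guard []       h = refl
    guard (R ∷ Rs) h with D? R
    ... | yes D rewrite dec-true (down? L (mem R)) (to (h (here refl)) D) =
      cong₂ _⊞_ (cong just (trans (∏-sublist w u (h (here refl))) (sym (identityˡ _)))) (guard Rs (h ∘ there))
    ... | no ¬D rewrite dec-false (down? L (mem R)) (¬D ∘ from (h (here refl))) = guard Rs (h ∘ there)

  -- Resummation of a layer: an element λ of the layer whose lower neighbours all lie in the ideal and
  -- whose upper neighbours all lie outside of it may be added or not, independently of the other ones.
  module Layer (trans-⊑ : ∀ {x z u} → x ⊑ z → z ⊑ u → x ⊑ u) {E Λ : List A} (unique : Unique Λ) (E∩Λ : ∀ {x} → x ∈ E → x ∉ Λ)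
    (lo up : A → List A)
    (lo-sound : ∀ {x l} → x ∈ Λ → l ∈ lo x → l ∈ E × l ⊑ x)
    (up-sound : ∀ {x u} → x ∈ Λ → u ∈ up x → u ∈ E × x ⊑ u)
    (below : ∀ {x z} → x ∈ Λ → z ∈ E → z ⊑ x → ∃ λ l → l ∈ lo x × z ⊑ l)
    (above : ∀ {x z} → x ∈ Λ → z ∈ E → x ⊑ z → ∃ λ u → u ∈ up x × u ⊑ z)
    (within : ∀ {x z} → x ∈ Λ → z ∈ Λ → z ⊑ x → z ≡ x ⊎ ∃₂ λ u l → u ∈ up z × l ∈ lo x × u ⊑ l)
    where

    -- The three cases are: forced into the ideal, free, and forced out of it. By `up⇒lo` a point is
    -- never forced in and out at once.
    local : (A → Carrier) → (A → Bool) → A → Carrier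
    local w χ x = if any χ (up x) then w x else if all χ (lo x) then 𝟙 ⊕ w x else 𝟙

    up⇒lo : ∀ {χ} → Down E χ → ∀ {x} → x ∈ Λ → any χ (up x) ≡ true → all χ (lo x) ≡ true
    up⇒lo {χ} D {x} x∈ e with any⁻ χ (up x) e
    ... | u , u∈ , χu = all⁺ χ (lo x) (λ l∈ → let u∈E , x⊑u = up-sound x∈ u∈ ; l∈E , l⊑x = lo-sound x∈ l∈ in
      down⁻ D u∈E l∈E (trans-⊑ l⊑x x⊑u) χu)

    private
      ok : (A → Bool) → A → Bool → Bool
      ok χ x b = if b then all χ (lo x) else not (any χ (up x))

      module _ {w : A → Carrier} {χ : A → Bool} (zero : ∀ {x} → x ∈ Λ → χ x ≡ false) where

        ψ : A → Bool → Maybe Carrier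
        ψ x b = ⟦ ok χ x b ⟧ ⊠ just (if b then w x else 𝟙)

        agree : ∀ (χ′ : A → Bool) → (∀ z → z ∉ Λ → χ′ z ≡ χ z) → ∀ {z} → z ∈ E → χ′ z ≡ χ z
        agree χ′ h {z} z∈ = h z (E∩Λ z∈)

        not-down : ¬ Down E χ → ∀ (χ′ : A → Bool) → (∀ z → z ∉ Λ → χ′ z ≡ χ z) → ¬ Down (E ++ Λ) χ′
        not-down ¬D χ′ h D = ¬D (down⁺ (λ x∈ z∈ z⊑x e → trans (sym (agree χ′ h z∈))
          (down⁻ D (∈-++⁺ˡ x∈) (∈-++⁺ˡ z∈) z⊑x (trans (agree χ′ h x∈) e))))

        down-++⁻ : ∀ (χ′ : A → Bool) → (∀ z → z ∉ Λ → χ′ z ≡ χ z) → Down (E ++ Λ) χ′ → ∀ {x} → x ∈ Λ → ok χ x (χ′ x) ≡ true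
        down-++⁻ χ′ h D {x} x∈ with χ′ x in eq
        ... | true  = all⁺ χ (lo x) (λ l∈ → let l∈E , l⊑x = lo-sound x∈ l∈ in
                trans (sym (agree χ′ h l∈E)) (down⁻ D (∈-++⁺ʳ E x∈) (∈-++⁺ˡ l∈E) l⊑x eq))
        ... | false with any χ (up x) in eq′
        ...   | false = refl
        ...   | true  = let u , u∈ , χu = any⁻ χ (up x) eq′ ; u∈E , x⊑u = up-sound x∈ u∈ in
                false≢true eq (down⁻ D (∈-++⁺ˡ u∈E) (∈-++⁺ʳ E x∈) x⊑u (trans (agree χ′ h u∈E) χu))

        down-++⁺ : Down E χ → ∀ (χ′ : A → Bool) → (∀ z → z ∉ Λ → χ′ z ≡ χ z) → (∀ {x} → x ∈ Λ → ok χ x (χ′ x) ≡ true) → Down (E ++ Λ) χ′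
        down-++⁺ D χ′ h oks = down⁺ λ x∈ z∈ → cases (∈-++⁻ E x∈) (∈-++⁻ E z∈)
          where
          lower : ∀ {x} → x ∈ Λ → χ′ x ≡ true → ∀ {l} → l ∈ lo x → χ l ≡ true
          lower {x} x∈ e = all⁻ χ (lo x) (trans (cong (ok χ x) (sym e)) (oks x∈))
          upper : ∀ {x} → x ∈ Λ → ∀ {u} → u ∈ up x → χ u ≡ true → χ′ x ≡ true
          upper {x} x∈ u∈ e with χ′ x in eq
          ... | true  = refl
          ... | false = false≢true (cong not (any⁺ χ u∈ e)) (trans (cong (ok χ x) (sym eq)) (oks x∈))
          cases : ∀ {x z} → x ∈ E ⊎ x ∈ Λ → z ∈ E ⊎ z ∈ Λ → z ⊑ x → χ′ x ≡ true → χ′ z ≡ true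
          cases (inj₁ x∈) (inj₁ z∈) z⊑x e = trans (agree χ′ h z∈) (down⁻ D x∈ z∈ z⊑x (trans (sym (agree χ′ h x∈)) e))
          cases (inj₂ x∈) (inj₁ z∈) z⊑x e = let l , l∈ , z⊑l = below x∈ z∈ z⊑x in
            trans (agree χ′ h z∈) (down⁻ D (proj₁ (lo-sound x∈ l∈)) z∈ z⊑l (lower x∈ e l∈))
          cases (inj₁ x∈) (inj₂ z∈) z⊑x e = let u , u∈ , u⊑x = above z∈ x∈ z⊑x in
            upper z∈ u∈ (down⁻ D x∈ (proj₁ (up-sound z∈ u∈)) u⊑x (trans (sym (agree χ′ h x∈)) e))
          cases (inj₂ x∈) (inj₂ z∈) z⊑x e with within x∈ z∈ z⊑x
          ... | inj₁ refl = e
          -- Two comparable points of the layer are linked through `E`: the larger one forces `l`,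
          -- then `u` lies in the ideal, and `u` forces the smaller one. So the layer imposes no
          -- condition of its own.
          ... | inj₂ (u , l , u∈ , l∈ , u⊑l) =
            upper z∈ u∈ (down⁻ D (proj₁ (lo-sound x∈ l∈)) (proj₁ (up-sound z∈ u∈)) u⊑l (lower x∈ e l∈))

        -- When `χ` is an ideal of `E`, being an ideal of the union is one condition for each point
        -- of the layer, which involves the other points only through `χ`. Hence the term factors
        -- over the layer.
        term-++ : Down E χ → ∀ (χ′ : A → Bool) → (∀ z → z ∉ Λ → χ′ z ≡ χ z) →
                  term (E ++ Λ) w χ′ ≡ just (∏ₗ E (weigh w χ)) ⊠ ∏? Λ (λ x → ψ x (χ′ x))
        term-++ D χ′ h = begin
          ⟦ does (down? (E ++ Λ) χ′) ⟧ ⊠ just (∏ₗ (E ++ Λ) (weigh w χ′))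
            ≡⟨ cong₂ (λ b z → ⟦ b ⟧ ⊠ just z) does≡ (trans (∏ₗ-++ (weigh w χ′) E Λ)
                 (cong (_⊗ ∏ₗ Λ (weigh w χ′)) (∏ₗ-cong E (λ {x} x∈ → cong (λ b → if b then w x else 𝟙) (agree χ′ h x∈))))) ⟩
          ⟦ all (λ x → ok χ x (χ′ x)) Λ ⟧ ⊠ just (∏ₗ E (weigh w χ) ⊗ ∏ₗ Λ (weigh w χ′))
            ≡⟨ swap (all (λ x → ok χ x (χ′ x)) Λ) ⟩
          just (∏ₗ E (weigh w χ)) ⊠ (⟦ all (λ x → ok χ x (χ′ x)) Λ ⟧ ⊠ just (∏ₗ Λ (weigh w χ′)))
            ≡⟨ cong (just (∏ₗ E (weigh w χ)) ⊠_) (sym (∏?-guard (λ x → ok χ x (χ′ x)) (weigh w χ′) Λ)) ⟩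
          just (∏ₗ E (weigh w χ)) ⊠ ∏? Λ (λ x → ψ x (χ′ x)) ∎
          where
          open ≡-Reasoning
          does≡ : does (down? (E ++ Λ) χ′) ≡ all (λ x → ok χ x (χ′ x)) Λ
          does≡ = true-ext (λ e → all⁺ (λ x → ok χ x (χ′ x)) Λ (down-++⁻ χ′ h (does-true (down? (E ++ Λ) χ′) e)))
                           (λ e → dec-true (down? (E ++ Λ) χ′) (down-++⁺ D χ′ h (all⁻ (λ x → ok χ x (χ′ x)) Λ e)))
          swap : ∀ b {u v} → ⟦ b ⟧ ⊠ just (u ⊗ v) ≡ just u ⊠ (⟦ b ⟧ ⊠ just v)
          swap true  = cong just (trans (identityˡ _) (cong (_ ⊗_) (sym (identityˡ _))))
          swap false = refl

        ψ-sum : Down E χ → ∀ {x} → x ∈ Λ → ψ x false ⊞ ψ x true ≡ just (local w χ x)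
        ψ-sum D {x} x∈ with any χ (up x) in eqᵤ | all χ (lo x) in eqₗ
        ... | true  | true  = cong just (identityˡ _)
        ... | true  | false = false≢true eqₗ (up⇒lo D x∈ eqᵤ)
        ... | false | true  = cong just (cong₂ _⊕_ (identityˡ _) (identityˡ _))
        ... | false | false = cong just (identityˡ _)

        ∑-layer : ∑⊆ Λ χ (term (E ++ Λ) w) ≡ ⟦ does (down? E χ) ⟧ ⊠ just (∏ₗ E (weigh w χ) ⊗ ∏ₗ Λ (local w χ))
        ∑-layer with down? E χ
        ... | no ¬D = trans (∑⊆-cong Λ χ (λ χ′ h → cong (λ b → ⟦ b ⟧ ⊠ just (∏ₗ (E ++ Λ) (weigh w χ′))) (dec-false (down? (E ++ Λ) χ′) (not-down ¬D χ′ h))))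
                            (trans (∑⊆-zero Λ χ) (cong (λ b → ⟦ b ⟧ ⊠ just (∏ₗ E (weigh w χ) ⊗ ∏ₗ Λ (local w χ))) (sym (dec-false (down? E χ) ¬D))))
        ... | yes D = begin
          ∑⊆ Λ χ (term (E ++ Λ) w)
            ≡⟨ ∑⊆-cong Λ χ (term-++ D) ⟩
          ∑⊆ Λ χ (λ χ′ → just (∏ₗ E (weigh w χ)) ⊠ ∏? Λ (λ x → ψ x (χ′ x)))
            ≡⟨ ∑⊆-⊠ (just (∏ₗ E (weigh w χ))) _ Λ χ ⟩
          just (∏ₗ E (weigh w χ)) ⊠ ∑⊆ Λ χ (λ χ′ → ∏? Λ (λ x → ψ x (χ′ x)))
            ≡⟨ cong (just (∏ₗ E (weigh w χ)) ⊠_) (trans (∑⊆-∏? ψ χ unique zero) (∏?-just Λ (ψ-sum D))) ⟩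
          just (∏ₗ E (weigh w χ) ⊗ ∏ₗ Λ (local w χ))
            ≡⟨ trans (cong (λ b → ⟦ b ⟧ ⊠ just (∏ₗ E (weigh w χ) ⊗ ∏ₗ Λ (local w χ))) (dec-true (down? E χ) D)) (⊠-identityˡ _) ⟨
          ⟦ does (down? E χ) ⟧ ⊠ just (∏ₗ E (weigh w χ) ⊗ ∏ₗ Λ (local w χ)) ∎
          where open ≡-Reasoning

    ∑ideals-layer : ∀ w → ∑ideals (E ++ Λ) w ≡
      ∑⊆ E ∅ (λ χ → ⟦ does (down? E χ) ⟧ ⊠ just (∏ₗ E (weigh w χ) ⊗ ∏ₗ Λ (local w χ)))
    ∑ideals-layer w = trans (∑⊆-++ (term (E ++ Λ) w) E Λ ∅)
      (∑⊆-cong E ∅ (λ χ h → ∑-layer {w} {χ} (λ {x} x∈ → h x (λ x∈E → E∩Λ x∈E x∈))))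

module _ (P : Semifield) {A B : Set} (_≟ᴬ_ : DecidableEquality A) (_≟ᴮ_ : DecidableEquality B)
         (_⊑ᴬ_ : A → A → Set) (_⊑ᴬ?_ : ∀ x z → Dec (x ⊑ᴬ z)) (_⊑ᴮ_ : B → B → Set) (_⊑ᴮ?_ : ∀ x z → Dec (x ⊑ᴮ z)) where
  private
    module IA = Ideals P _≟ᴬ_ _⊑ᴬ_ _⊑ᴬ?_
    module IB = Ideals P _≟ᴮ_ _⊑ᴮ_ _⊑ᴮ?_

  ∑ideals-map : (f : A → B) → (∀ {x z} → f x ≡ f z → x ≡ z) → (∀ {x z} → x ⊑ᴬ z → f x ⊑ᴮ f z) → (∀ {x z} → f x ⊑ᴮ f z → x ⊑ᴬ z) →
                ∀ L w → IB.∑ideals (map f L) w ≡ IA.∑ideals L (w ∘ f)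
  ∑ideals-map f inj mono reflect L w = IA.∑⊆-map _≟ᴬ_ _≟ᴮ_ f inj (IA.term-ext L (w ∘ f)) term-map L IB.∅
    where
    term-map : ∀ χ → IB.term (map f L) w χ ≡ IA.term L (w ∘ f) (χ ∘ f)
    term-map χ = cong₂ (λ b z → IA.⟦ b ⟧ IA.⊠ just z)
      (does-⇔ (mk⇔ (λ D → IA.down⁺ (λ x∈ z∈ z⊑x → IB.down⁻ D (∈-map⁺ f x∈) (∈-map⁺ f z∈) (mono z⊑x)))
                   (λ D → IB.down⁺ (λ x∈ z∈ → lift D (∈-map⁻ f x∈) (∈-map⁻ f z∈))))
              (IB.down? (map f L) χ) (IA.down? L (χ ∘ f)))
      (cong (prodL P) (sym (map-∘ L)))
      where
      lift : IA.Down L (χ ∘ f) → ∀ {x z} → (∃ λ u → u ∈ L × x ≡ f u) → (∃ λ v → v ∈ L × z ≡ f v) → z ⊑ᴮ x → χ x ≡ true → χ z ≡ true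
      lift D (u , u∈ , refl) (v , v∈ , refl) z⊑x = IA.down⁻ D u∈ v∈ (reflect z⊑x)

-- The recursion for the posets S⁽ʲ⁾

infix 4 _⊴_ _⊴?_

-- The componentwise order of λ = (p , q , -r , -s).
_⊴_ : Pt → Pt → Set
(p , q , r , s) ⊴ (p′ , q′ , r′ , s′) = p ≤ p′ × q ≤ q′ × r′ ≤ r × s′ ≤ s

_⊴?_ : ∀ x z → Dec (x ⊴ z)
(p , q , r , s) ⊴? (p′ , q′ , r′ , s′) = (p ≤? p′) ×-dec (q ≤? q′) ×-dec (r′ ≤? r) ×-dec (s′ ≤? s)

⊴-trans : ∀ {x z u} → x ⊴ z → z ⊴ u → x ⊴ u
⊴-trans (p , q , r , s) (p′ , q′ , r′ , s′) = ≤-trans p p′ , ≤-trans q q′ , ≤-trans r′ r , ≤-trans s′ s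

_≟ₚ_ : DecidableEquality Pt
_≟ₚ_ = ≡-dec _≟_ (≡-dec _≟_ (≡-dec _≟_ _≟_))

-- For a point below another one, a strict step in p or q lowers the weight, and a strict step in r
-- or s raises it.
_◁ˡ_ _◁ʳ_ : Pt → Pt → Set
(p , q , r , s) ◁ˡ (p′ , q′ , r′ , s′) = p < p′ ⊎ q < q′
(p , q , r , s) ◁ʳ (p′ , q′ , r′ , s′) = r′ < r ⊎ s′ < s

preds : ℕ → (ℕ → Pt) → List Pt
preds zero    f = []
preds (suc n) f = f n ∷ []

-- Neighbours that stay in the common part of the two posets: a point of the top layer can only lose
-- weight, a point of the bottom layer can only gain it.
lo-max up-max lo-min up-min : Pt → List Pt
lo-max (p , q , r , s) = preds p (λ p → p , q , r , s) ++ preds q (λ q → p , q , r , s)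
up-max (p , q , r , s) = preds r (λ r → p , q , r , s) ++ preds s (λ s → p , q , r , s)
lo-min (p , q , r , s) = (p , q , suc r , s) ∷ (p , q , r , suc s) ∷ []
up-min (p , q , r , s) = (suc p , q , r , s) ∷ (p , suc q , r , s) ∷ []

-- The last component keeps the strictness on the other side, so that a second step can be made from
-- `l`; comparable points of one layer need both.
lower-max : ∀ {x z} → z ⊴ x → z ◁ˡ x → ∃ λ l → l ∈ lo-max x × z ⊴ l × (z ◁ʳ x → z ◁ʳ l)
lower-max {suc p , q , r , s} (_ , q≤ , r≤ , s≤) (inj₁ p<) = _ , here refl , (s≤s⁻¹ p< , q≤ , r≤ , s≤) , λ h → h
lower-max {p , suc q , r , s} (p≤ , _ , r≤ , s≤) (inj₂ q<) =
  _ , ∈-++⁺ʳ (preds p _) (here refl) , (p≤ , s≤s⁻¹ q< , r≤ , s≤) , λ h → h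

upper-max : ∀ {x z} → z ⊴ x → z ◁ʳ x → ∃ λ u → u ∈ up-max z × u ⊴ x
upper-max {z = p , q , suc r , s} (p≤ , q≤ , _ , s≤) (inj₁ r<) = _ , here refl , (p≤ , q≤ , s≤s⁻¹ r< , s≤)
upper-max {z = p , q , r , suc s} (p≤ , q≤ , r≤ , _) (inj₂ s<) =
  _ , ∈-++⁺ʳ (preds r _) (here refl) , (p≤ , q≤ , r≤ , s≤s⁻¹ s<)

lower-min : ∀ {x z} → z ⊴ x → z ◁ʳ x → ∃ λ l → l ∈ lo-min x × z ⊴ l × (z ◁ˡ x → z ◁ˡ l)
lower-min (p≤ , q≤ , _ , s≤) (inj₁ r<) = _ , here refl , (p≤ , q≤ , r< , s≤) , λ h → h
lower-min (p≤ , q≤ , r≤ , _) (inj₂ s<) = _ , there (here refl) , (p≤ , q≤ , r≤ , s<) , λ h → h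

upper-min : ∀ {x z} → z ⊴ x → z ◁ˡ x → ∃ λ u → u ∈ up-min z × u ⊴ x
upper-min (_ , q≤ , r≤ , s≤) (inj₁ p<) = _ , here refl , (p< , q≤ , r≤ , s≤)
upper-min (p≤ , _ , r≤ , s≤) (inj₂ q<) = _ , there (here refl) , (p≤ , q< , r≤ , s≤)

bit : Bool → ℕ
bit b = if b then 1 else 0

module PosetRecursion (a b c d : ℕ) (a>0 : 0 < a) (b>0 : 0 < b) (c>0 : 0 < c) (d>0 : 0 < d)
                      (c+d : c + d ≡ a + b) (c≢a : c ≢ a) (c≢b : c ≢ b) (P : Semifield) where

  open Rotation a b c d a>0 b>0 c>0 d>0 c+d c≢a c≢b P public
  open Ideals P _≟ₚ_ _⊴_ _⊴?_ public
    using (Down; down?; weigh; ∑ideals; ∑ideals-↭; ∅; ∑⊆; ∑⊆-cong; ∑⊆-⊠; module Layer;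
           ∏ₗ; ∏ₗ-cong; ∏ₗ-⊗; ∏ₗ-^; ∏ₗ-𝟙; ⟦_⟧; _⊠_)

  wt-mono : ∀ {p q r s p′ q′ r′ s′} → p ≤ p′ → q ≤ q′ → r ≤ r′ → s ≤ s′ → wt (p , q , r , s) ≤ wt (p′ , q′ , r′ , s′)
  wt-mono p≤ q≤ r≤ s≤ = +-mono-≤ (+-mono-≤ (+-mono-≤ (*-monoʳ-≤ a p≤) (*-monoʳ-≤ b q≤)) (*-monoʳ-≤ c r≤)) (*-monoʳ-≤ d s≤)

  wt<⇒◁ˡ : ∀ {x z} → z ⊴ x → wt z < wt x → z ◁ˡ x
  wt<⇒◁ˡ {p′ , q′ , _} {p , q , _} (p≤ , q≤ , r≤ , s≤) w< with p <? p′ | q <? q′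
  ... | yes p< | _      = inj₁ p<
  ... | no _   | yes q< = inj₂ q<
  ... | no p≮  | no q≮  = ⊥-elim (<⇒≱ w< (wt-mono (≮⇒≥ p≮) (≮⇒≥ q≮) r≤ s≤))

  wt>⇒◁ʳ : ∀ {x z} → z ⊴ x → wt x < wt z → z ◁ʳ x
  wt>⇒◁ʳ {_ , _ , r′ , s′} {_ , _ , r , s} (p≤ , q≤ , r≤ , s≤) w< with r′ <? r | s′ <? s
  ... | yes r< | _      = inj₁ r<
  ... | no _   | yes s< = inj₂ s<
  ... | no r≮  | no s≮  = ⊥-elim (<⇒≱ w< (wt-mono p≤ q≤ (≮⇒≥ r≮) (≮⇒≥ s≮)))

  ◁ʳ-wt : ∀ {x z} → z ⊴ x → z ◁ʳ x → wt z ≡ wt x → z ◁ˡ x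
  ◁ʳ-wt {p′ , q′ , r′ , s′} {p , q , r , s} z⊴x ◁ eq with p <? p′ | q <? q′
  ... | yes p< | _      = inj₁ p<
  ... | no _   | yes q< = inj₂ q<
  ... | no p≮  | no q≮  = ⊥-elim ([ (λ r< → <⇒≱ (m<m+n _ c>0) (bound (wt-r p′ q′ r′ s′) (wt-mono (≮⇒≥ p≮) (≮⇒≥ q≮) r< (proj₂ (proj₂ (proj₂ z⊴x))))))
                                  , (λ s< → <⇒≱ (m<m+n _ d>0) (bound (wt-s p′ q′ r′ s′) (wt-mono (≮⇒≥ p≮) (≮⇒≥ q≮) (proj₁ (proj₂ (proj₂ z⊴x))) s<))) ]′ ◁)
    where
    bound : ∀ {x u} → wt x ≡ wt (p′ , q′ , r′ , s′) + u → wt x ≤ wt (p , q , r , s) → wt (p′ , q′ , r′ , s′) + u ≤ wt (p′ , q′ , r′ , s′)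
    bound e h = ≤-trans (≤-reflexive (sym e)) (≤-trans h (≤-reflexive eq))

  -- What is lost in p and q has to be regained in r and s, so with equal weights neither strict
  -- step occurs alone.
  wt≡⇒◁ : ∀ {x z} → z ⊴ x → wt z ≡ wt x → z ≡ x ⊎ (z ◁ˡ x × z ◁ʳ x)
  wt≡⇒◁ {p′ , q′ , r′ , s′} {p , q , r , s} z⊴x@(p≤ , q≤ , r≤ , s≤) eq with r′ <? r | s′ <? s
  ... | yes r< | _      = inj₂ (◁ʳ-wt z⊴x (inj₁ r<) eq , inj₁ r<)
  ... | no _   | yes s< = inj₂ (◁ʳ-wt z⊴x (inj₂ s<) eq , inj₂ s<)
  ... | no r≮  | no s≮ with ≤-antisym (≮⇒≥ r≮) r≤ | ≤-antisym (≮⇒≥ s≮) s≤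
  ...   | refl | refl with p <? p′ | q <? q′
  ...     | no p≮  | no q≮ = inj₁ (cong₂ (λ p q → p , q , r , s) (≤-antisym p≤ (≮⇒≥ p≮)) (≤-antisym q≤ (≮⇒≥ q≮)))
  ...     | yes p< | _     = ⊥-elim (<⇒≱ (m<m+n _ a>0) (≤-trans (≤-reflexive (sym (wt-p p q r s))) (≤-trans (wt-mono p< q≤ ≤-refl ≤-refl) (≤-reflexive (sym eq)))))
  ...     | no _   | yes q< = ⊥-elim (<⇒≱ (m<m+n _ b>0) (≤-trans (≤-reflexive (sym (wt-q p q r s))) (≤-trans (wt-mono p≤ q< ≤-refl ≤-refl) (≤-reflexive (sym eq)))))

  strip? : (k : ℕ) → Decidable (λ x → wt x < k × k ≤ wt x + N)
  strip? k x = (wt x <? k) ×-dec (k ≤? wt x + N)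

  strip : ℕ → List Pt
  strip k = filter (strip? k) (grid (suc k))

  strip-unique : ∀ k → Unique (strip k)
  strip-unique k = Uniqueₚ.filter⁺ (strip? k) (grid-unique (suc k))

  strip⁻ : ∀ {k x} → x ∈ strip k → wt x < k × k ≤ wt x + N
  strip⁻ {k} {x} x∈ = proj₂ (∈-filter⁻ (strip? k) {xs = grid (suc k)} x∈)

  strip⁺ : ∀ {k x} → wt x < k → k ≤ wt x + N → x ∈ strip k
  strip⁺ {k} {x} p q = ∈-filter⁺ (strip? k) (∈-grid x (≤-trans p (n≤1+n k))) (p , q)

  -- The sum over J(S⁽ᵏ⁾), where (p , q , r , s) stands for λ = (p , q , -r , -s).
  Z : (ℕ → Carrier) → ℕ → Maybe Carrier
  Z z k = ∑ideals (strip k) (λ x → z (k ∸ wt x))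

  module Step (k : ℕ) where

    E? : Decidable (λ x → wt x < k × suc k ≤ wt x + N)
    E? x = (wt x <? k) ×-dec (suc k ≤? wt x + N)
    max? : Decidable (λ x → wt x ≡ k)
    max? x = wt x ≟ k
    min? : Decidable (λ x → wt x + N ≡ k)
    min? x = wt x + N ≟ k

    -- S⁽ᵏ⁺¹⁾ is the union of `E` and `Λ`, and S⁽ᵏ⁾ that of `E` and `Λ′`. The points of `Λ` have the
    -- label 1, those of `Λ′` the label N.
    E Λ Λ′ : List Pt
    E  = filter E? (grid (suc k))
    Λ  = filter max? (grid (suc k))
    Λ′ = filter min? (grid (suc k))

    E-unique : Unique E
    E-unique = Uniqueₚ.filter⁺ E? (grid-unique (suc k))
    Λ-unique : Unique Λ
    Λ-unique = Uniqueₚ.filter⁺ max? (grid-unique (suc k))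
    Λ′-unique : Unique Λ′
    Λ′-unique = Uniqueₚ.filter⁺ min? (grid-unique (suc k))

    E⁻ : ∀ {x} → x ∈ E → wt x < k × suc k ≤ wt x + N
    E⁻ x∈ = proj₂ (∈-filter⁻ E? {xs = grid (suc k)} x∈)
    Λ⁻ : ∀ {x} → x ∈ Λ → wt x ≡ k
    Λ⁻ x∈ = proj₂ (∈-filter⁻ max? {xs = grid (suc k)} x∈)
    Λ′⁻ : ∀ {x} → x ∈ Λ′ → wt x + N ≡ k
    Λ′⁻ x∈ = proj₂ (∈-filter⁻ min? {xs = grid (suc k)} x∈)

    E⁺ : ∀ {x} → wt x < k → suc k ≤ wt x + N → x ∈ E
    E⁺ {x} p q = ∈-filter⁺ E? (∈-grid x (≤-trans p (n≤1+n k))) (p , q)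
    Λ⁺ : ∀ {x} → wt x ≡ k → x ∈ Λ
    Λ⁺ {x} e = ∈-filter⁺ max? (∈-grid x (s≤s (≤-reflexive e))) e
    Λ′⁺ : ∀ {x} → wt x + N ≡ k → x ∈ Λ′
    Λ′⁺ {x} e = ∈-filter⁺ min? (∈-grid x (s≤s (wt≤ {x} e))) e

    E-shift : ∀ {x u} → 0 < u → u < N → wt x + u ≡ k → x ∈ E
    E-shift {x} {u} u>0 u<N refl = E⁺ (m<m+n (wt x) u>0) (+-monoʳ-< (wt x) u<N)

    E∩Λ : ∀ {x} → x ∈ E → x ∉ Λ
    E∩Λ x∈E x∈Λ = <⇒≢ (proj₁ (E⁻ x∈E)) (Λ⁻ x∈Λ)
    E∩Λ′ : ∀ {x} → x ∈ E → x ∉ Λ′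
    E∩Λ′ x∈E x∈Λ = <⇒≢ (proj₂ (E⁻ x∈E)) (sym (Λ′⁻ x∈Λ))

    strip-suc : strip (suc k) ↭ E ++ Λ
    strip-suc = unique-↭ (strip-unique (suc k))
                         (Uniqueₚ.++⁺ E-unique Λ-unique (λ (p , q) → E∩Λ p q)) to from
      where
      to : ∀ {x} → x ∈ strip (suc k) → x ∈ E ++ Λ
      to {x} x∈ with wt< , k≤ ← strip⁻ {suc k} {x} x∈ with wt x ≟ k
      ... | yes e = ∈-++⁺ʳ E (Λ⁺ e)
      ... | no ≢k = ∈-++⁺ˡ (E⁺ (≤∧≢⇒< (s≤s⁻¹ wt<) ≢k) k≤)
      from : ∀ {x} → x ∈ E ++ Λ → x ∈ strip (suc k)
      from {x} x∈ with ∈-++⁻ E x∈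
      ... | inj₁ x∈E = let p , q = E⁻ x∈E ; p′ = ≤-trans p (n≤1+n k) in strip⁺ {suc k} {x} p′ q
      ... | inj₂ x∈Λ = strip⁺ {suc k} {x} (s≤s (≤-reflexive (Λ⁻ x∈Λ))) (subst (λ n → suc n ≤ wt x + N) (Λ⁻ x∈Λ) (m<m+n (wt x) N>0))

    strip-same : strip k ↭ E ++ Λ′
    strip-same = unique-↭ (strip-unique k)
                          (Uniqueₚ.++⁺ E-unique Λ′-unique (λ (p , q) → E∩Λ′ p q)) to from
      where
      to : ∀ {x} → x ∈ strip k → x ∈ E ++ Λ′
      to {x} x∈ with wt< , k≤ ← strip⁻ {k} {x} x∈ with wt x + N ≟ k
      ... | yes e = ∈-++⁺ʳ E (Λ′⁺ e)
      ... | no ≢k = ∈-++⁺ˡ (E⁺ wt< (≤∧≢⇒< k≤ (≢k ∘ sym)))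
      from : ∀ {x} → x ∈ E ++ Λ′ → x ∈ strip k
      from {x} x∈ with ∈-++⁻ E x∈
      ... | inj₁ x∈E = let p , q = E⁻ x∈E in strip⁺ {k} {x} p (≤-trans (n≤1+n k) q)
      ... | inj₂ x∈Λ = let e = Λ′⁻ x∈Λ in strip⁺ {k} {x} (subst (wt x <_) e (m<m+n (wt x) N>0)) (≤-reflexive (sym e))

    private
      drop-eq : ∀ {x z u} → wt x ≡ wt z + u → wt x ≡ k → wt z + u ≡ k
      drop-eq p q = trans (sym p) q

      lift-eq : ∀ {x z u v} → wt z ≡ wt x + u → u + v ≡ N → wt x + N ≡ k → wt z + v ≡ k
      lift-eq {x} {z} {u} {v} p uv e = trans (cong (λ t → t + v) p) (trans (+-assoc (wt x) u v) (trans (cong (λ t → wt x + t) uv) e))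

      d+c : d + c ≡ N
      d+c = trans (+-comm d c) c+d

    lo-max-sound : ∀ {x l} → x ∈ Λ → l ∈ lo-max x → l ∈ E × l ⊴ x
    lo-max-sound {p , q , r , s} x∈ l∈ with ∈-++⁻ (preds p _) l∈
    lo-max-sound {suc p , q , r , s} x∈ l∈ | inj₁ (here refl) =
      E-shift a>0 a<N (drop-eq {suc p , q , r , s} (wt-p p q r s) (Λ⁻ x∈)) , (n≤1+n p , ≤-refl , ≤-refl , ≤-refl)
    lo-max-sound {p , suc q , r , s} x∈ l∈ | inj₂ (here refl) =
      E-shift b>0 b<N (drop-eq {p , suc q , r , s} (wt-q p q r s) (Λ⁻ x∈)) , (≤-refl , n≤1+n q , ≤-refl , ≤-refl)

    up-max-sound : ∀ {x u} → x ∈ Λ → u ∈ up-max x → u ∈ E × x ⊴ u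
    up-max-sound {p , q , r , s} x∈ l∈ with ∈-++⁻ (preds r _) l∈
    up-max-sound {p , q , suc r , s} x∈ l∈ | inj₁ (here refl) =
      E-shift c>0 c<N (drop-eq {p , q , suc r , s} (wt-r p q r s) (Λ⁻ x∈)) , (≤-refl , ≤-refl , n≤1+n r , ≤-refl)
    up-max-sound {p , q , r , suc s} x∈ l∈ | inj₂ (here refl) =
      E-shift d>0 d<N (drop-eq {p , q , r , suc s} (wt-s p q r s) (Λ⁻ x∈)) , (≤-refl , ≤-refl , ≤-refl , n≤1+n s)

    lo-min-sound : ∀ {x l} → x ∈ Λ′ → l ∈ lo-min x → l ∈ E × l ⊴ x
    lo-min-sound {x@(p , q , r , s)} x∈ (here refl) =
      E-shift d>0 d<N (lift-eq {x} {p , q , suc r , s} (wt-r p q r s) c+d (Λ′⁻ x∈)) , (≤-refl , ≤-refl , n≤1+n r , ≤-refl)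
    lo-min-sound {x@(p , q , r , s)} x∈ (there (here refl)) =
      E-shift c>0 c<N (lift-eq {x} {p , q , r , suc s} (wt-s p q r s) d+c (Λ′⁻ x∈)) , (≤-refl , ≤-refl , ≤-refl , n≤1+n s)

    up-min-sound : ∀ {x u} → x ∈ Λ′ → u ∈ up-min x → u ∈ E × x ⊴ u
    up-min-sound {x@(p , q , r , s)} x∈ (here refl) =
      E-shift b>0 b<N (lift-eq {x} {suc p , q , r , s} (wt-p p q r s) refl (Λ′⁻ x∈)) , (n≤1+n p , ≤-refl , ≤-refl , ≤-refl)
    up-min-sound {x@(p , q , r , s)} x∈ (there (here refl)) =
      E-shift a>0 a<N (lift-eq {x} {p , suc q , r , s} (wt-q p q r s) (+-comm b a) (Λ′⁻ x∈)) , (≤-refl , n≤1+n q , ≤-refl , ≤-refl)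

    private
      Λ-top : ∀ {x z} → x ∈ Λ → z ∈ E → wt z < wt x
      Λ-top x∈ z∈ = ≤-trans (proj₁ (E⁻ z∈)) (≤-reflexive (sym (Λ⁻ x∈)))

      Λ′-bot : ∀ {x z} → x ∈ Λ′ → z ∈ E → wt x < wt z
      Λ′-bot {x} {z} x∈ z∈ = +-cancelʳ-< N (wt x) (wt z) (≤-trans (s≤s (≤-reflexive (Λ′⁻ x∈))) (proj₂ (E⁻ z∈)))

      below-max : ∀ {x z} → x ∈ Λ → z ∈ E → z ⊴ x → ∃ λ l → l ∈ lo-max x × z ⊴ l
      below-max {x} {z} x∈ z∈ z⊴x = let l , l∈ , z⊴l , _ = lower-max {x} {z} z⊴x (wt<⇒◁ˡ {x} {z} z⊴x (Λ-top x∈ z∈)) in l , l∈ , z⊴l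

      above-max : ∀ {x z} → x ∈ Λ → z ∈ E → x ⊴ z → ∃ λ u → u ∈ up-max x × u ⊴ z
      above-max {x} {z} x∈ z∈ x⊴z = upper-max {z} {x} x⊴z (wt>⇒◁ʳ {z} {x} x⊴z (Λ-top x∈ z∈))

      within-max : ∀ {x z} → x ∈ Λ → z ∈ Λ → z ⊴ x → z ≡ x ⊎ ∃₂ λ u l → u ∈ up-max z × l ∈ lo-max x × u ⊴ l
      within-max {x} {z} x∈ z∈ z⊴x with wt≡⇒◁ {x} {z} z⊴x (trans (Λ⁻ z∈) (sym (Λ⁻ x∈)))
      ... | inj₁ z≡x        = inj₁ z≡x
      ... | inj₂ (◁ˡ , ◁ʳ) =
        let l , l∈ , z⊴l , keep = lower-max {x} {z} z⊴x ◁ˡ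
            u , u∈ , u⊴l = upper-max {l} {z} z⊴l (keep ◁ʳ)
        in inj₂ (u , l , u∈ , l∈ , u⊴l)

      below-min : ∀ {x z} → x ∈ Λ′ → z ∈ E → z ⊴ x → ∃ λ l → l ∈ lo-min x × z ⊴ l
      below-min {x} {z} x∈ z∈ z⊴x = let l , l∈ , z⊴l , _ = lower-min {x} {z} z⊴x (wt>⇒◁ʳ {x} {z} z⊴x (Λ′-bot x∈ z∈)) in l , l∈ , z⊴l

      above-min : ∀ {x z} → x ∈ Λ′ → z ∈ E → x ⊴ z → ∃ λ u → u ∈ up-min x × u ⊴ z
      above-min {x} {z} x∈ z∈ x⊴z = upper-min {z} {x} x⊴z (wt<⇒◁ˡ {z} {x} x⊴z (Λ′-bot x∈ z∈))

      within-min : ∀ {x z} → x ∈ Λ′ → z ∈ Λ′ → z ⊴ x → z ≡ x ⊎ ∃₂ λ u l → u ∈ up-min z × l ∈ lo-min x × u ⊴ l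
      within-min {x} {z} x∈ z∈ z⊴x with wt≡⇒◁ {x} {z} z⊴x (+-cancelʳ-≡ N (wt z) (wt x) (trans (Λ′⁻ z∈) (sym (Λ′⁻ x∈))))
      ... | inj₁ z≡x        = inj₁ z≡x
      ... | inj₂ (◁ˡ , ◁ʳ) =
        let l , l∈ , z⊴l , keep = lower-min {x} {z} z⊴x ◁ʳ
            u , u∈ , u⊴l = upper-min {l} {z} z⊴l (keep ◁ˡ)
        in inj₂ (u , l , u∈ , l∈ , u⊴l)

    module Max = Layer (λ {x} {z} {u} → ⊴-trans {x} {z} {u}) Λ-unique E∩Λ lo-max up-max lo-max-sound up-max-sound below-max above-max within-max
    module Min = Layer (λ {x} {z} {u} → ⊴-trans {x} {z} {u}) Λ′-unique E∩Λ′ lo-min up-min lo-min-sound up-min-sound below-min above-min within-min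

    private
      -- Translation by a vector of weight u carries the points of weight k - u onto part of the top
      -- layer. With all sums indexed by `Λ`, the counts below can be compared point by point.
      module Shift (u : ℕ) (shift unshift : Pt → Pt) (wt-shift : ∀ x → wt (shift x) ≡ wt x + u) (unshift-shift : ∀ x → unshift (shift x) ≡ x)
                   {Q : Pt → Set} (Q? : Decidable Q) (Q-shift : ∀ x → Q (shift x)) (shift-unshift : ∀ x → Q x → shift (unshift x) ≡ x)
                   {M : List Pt} (M-unique : Unique M) (M⁺ : ∀ {x} → wt x + u ≡ k → x ∈ M) where

        ∑-shift : ∀ F → ∑ M (λ x → ind (wt x + u ≟ k) * F x) ≡ ∑ Λ (λ x → ind (Q? x) * F (unshift x))
        ∑-shift F = ∑-reindex (λ x → wt x + u ≟ k) Q? F (F ∘ unshift) shift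
          (λ {x} {z} e → trans (sym (unshift-shift x)) (trans (cong unshift e) (unshift-shift z))) M-unique Λ-unique
          (λ {x} _ e → Λ⁺ (trans (wt-shift x) e) , Q-shift x)
          (λ {x} x∈ Qx → let e = trans (sym (wt-shift (unshift x))) (trans (cong wt (shift-unshift x Qx)) (Λ⁻ x∈)) in
             unshift x , M⁺ e , e , shift-unshift x Qx)
          (λ x → cong F (sym (unshift-shift x)))

      p>0? : Decidable (λ ((p , _) : Pt) → 0 < p)
      p>0? (p , _) = 0 <? p
      q>0? : Decidable (λ ((_ , q , _) : Pt) → 0 < q)
      q>0? (_ , q , _) = 0 <? q
      r>0? : Decidable (λ ((_ , _ , r , _) : Pt) → 0 < r)
      r>0? (_ , _ , r , _) = 0 <? r
      s>0? : Decidable (λ ((_ , _ , _ , s) : Pt) → 0 < s)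
      s>0? (_ , _ , _ , s) = 0 <? s

      p⁻ q⁻ r⁻ s⁻ : Pt → Pt
      p⁻ (p , q , r , s) = pred p , q , r , s
      q⁻ (p , q , r , s) = p , pred q , r , s
      r⁻ (p , q , r , s) = p , q , pred r , s
      s⁻ (p , q , r , s) = p , q , r , pred s

      ∑-p : ∀ F → ∑ E (λ x → ind (wt x + a ≟ k) * F x) ≡ ∑ Λ (λ x → ind (p>0? x) * F (p⁻ x))
      ∑-p = Shift.∑-shift a (λ (p , q , r , s) → suc p , q , r , s) p⁻ (λ (p , q , r , s) → wt-p p q r s) (λ _ → refl)
              p>0? (λ _ → z<s) (λ { (suc p , q , r , s) _ → refl }) E-unique (E-shift a>0 a<N)
      ∑-q : ∀ F → ∑ E (λ x → ind (wt x + b ≟ k) * F x) ≡ ∑ Λ (λ x → ind (q>0? x) * F (q⁻ x))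
      ∑-q = Shift.∑-shift b (λ (p , q , r , s) → p , suc q , r , s) q⁻ (λ (p , q , r , s) → wt-q p q r s) (λ _ → refl)
              q>0? (λ _ → z<s) (λ { (p , suc q , r , s) _ → refl }) E-unique (E-shift b>0 b<N)
      ∑-r : ∀ F → ∑ E (λ x → ind (wt x + c ≟ k) * F x) ≡ ∑ Λ (λ x → ind (r>0? x) * F (r⁻ x))
      ∑-r = Shift.∑-shift c (λ (p , q , r , s) → p , q , suc r , s) r⁻ (λ (p , q , r , s) → wt-r p q r s) (λ _ → refl)
              r>0? (λ _ → z<s) (λ { (p , q , suc r , s) _ → refl }) E-unique (E-shift c>0 c<N)
      ∑-s : ∀ F → ∑ E (λ x → ind (wt x + d ≟ k) * F x) ≡ ∑ Λ (λ x → ind (s>0? x) * F (s⁻ x))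
      ∑-s = Shift.∑-shift d (λ (p , q , r , s) → p , q , r , suc s) s⁻ (λ (p , q , r , s) → wt-s p q r s) (λ _ → refl)
              s>0? (λ _ → z<s) (λ { (p , q , r , suc s) _ → refl }) E-unique (E-shift d>0 d<N)

      ∑-Λ′ : ∀ F → ∑ Λ′ F ≡ ∑ Λ′ (λ x → ind (wt x + N ≟ k) * F x)
      ∑-Λ′ F = ∑-cong Λ′ (λ {x} x∈ → sym (trans (cong (λ t → t * F x) (ind-yes (wt x + N ≟ k) (Λ′⁻ x∈))) (+-identityʳ (F x))))

      ∑-pq : ∀ F → ∑ Λ′ F ≡ ∑ Λ (λ x → ind (p>0? x ×-dec q>0? x) * F (p⁻ (q⁻ x)))
      ∑-pq F = trans (∑-Λ′ F) (Shift.∑-shift N (λ (p , q , r , s) → suc p , suc q , r , s) (p⁻ ∘ q⁻) (λ (p , q , r , s) → wt-pq p q r s) (λ _ → refl)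
              (λ x → p>0? x ×-dec q>0? x) (λ _ → z<s , z<s) (λ { (suc p , suc q , r , s) _ → refl }) Λ′-unique Λ′⁺ F)
      ∑-rs : ∀ F → ∑ Λ′ F ≡ ∑ Λ (λ x → ind (r>0? x ×-dec s>0? x) * F (r⁻ (s⁻ x)))
      ∑-rs F = trans (∑-Λ′ F) (Shift.∑-shift N (λ (p , q , r , s) → p , q , suc r , suc s) (r⁻ ∘ s⁻) (λ (p , q , r , s) → wt-rs p q r s) (λ _ → refl)
              (λ x → r>0? x ×-dec s>0? x) (λ _ → z<s , z<s) (λ { (p , q , suc r , suc s) _ → refl }) Λ′-unique Λ′⁺ F)

      base? : Decidable (λ (x : Pt) → proj₁ x ≡ 0 × proj₁ (proj₂ x) ≡ 0)
      base? x = (proj₁ x ≟ 0) ×-dec (proj₁ (proj₂ x) ≟ 0)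

      K-base : K k 0 ≡ ∑ Λ (λ x → ind (base? x) * 1)
      K-base = ∑-reindex (bottom? 0 k) base? (λ _ → 1) (λ _ → 1) (λ x → x) (λ e → e) (grid-unique (suc k)) Λ-unique
        (λ {x} _ (e , z) → Λ⁺ (trans (sym (+-identityʳ (wt x))) e) , z)
        (λ {x} x∈ z → x , ∈-grid x (s≤s (≤-reflexive (Λ⁻ x∈))) , (trans (+-identityʳ (wt x)) (Λ⁻ x∈) , z) , refl)
        (λ _ → refl)

      ∑-+₃ : ∀ (f g h : Pt → ℕ) xs → ∑ xs (λ x → f x + (g x + h x)) ≡ ∑ xs f + (∑ xs g + ∑ xs h)
      ∑-+₃ f g h xs = trans (∑-+ f (λ x → g x + h x) xs) (cong (λ t → ∑ xs f + t) (∑-+ g h xs))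

    module _ (χ : Pt → Bool) where

      -- With u, v saying whether the two lower neighbours of a point of Λ belong to χ, this is (u ∧ v) + (u ∨ v) = u + v.
      lower-count : ∑ Λ (λ x → bit (all χ (lo-max x))) + ∑ Λ′ (λ x → bit (any χ (up-min x))) ≡
                    K k 0 + (∑ E (λ x → ind (wt x + a ≟ k) * bit (χ x)) + ∑ E (λ x → ind (wt x + b ≟ k) * bit (χ x)))
      lower-count = begin
        ∑ Λ L + ∑ Λ′ U             ≡⟨ cong (λ t → ∑ Λ L + t) (∑-pq U) ⟩
        ∑ Λ L + ∑ Λ U′             ≡⟨ ∑-+ L U′ Λ ⟨
        ∑ Λ (λ x → L x + U′ x)     ≡⟨ ∑-cong Λ (λ {x} _ → pointwise x) ⟩
        ∑ Λ (λ x → ind (base? x) * 1 + (ind (p>0? x) * bit (χ (p⁻ x)) + ind (q>0? x) * bit (χ (q⁻ x))))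
          ≡⟨ ∑-+₃ (λ x → ind (base? x) * 1) (λ x → ind (p>0? x) * bit (χ (p⁻ x))) (λ x → ind (q>0? x) * bit (χ (q⁻ x))) Λ ⟩
        _ ≡⟨ cong₂ _+_ K-base (cong₂ _+_ (∑-p (bit ∘ χ)) (∑-q (bit ∘ χ))) ⟨
        K k 0 + (∑ E (λ x → ind (wt x + a ≟ k) * bit (χ x)) + ∑ E (λ x → ind (wt x + b ≟ k) * bit (χ x))) ∎
        where
        open ≡-Reasoning
        L U U′ : Pt → ℕ
        L x = bit (all χ (lo-max x))
        U x = bit (any χ (up-min x))
        U′ x = ind (p>0? x ×-dec q>0? x) * U (p⁻ (q⁻ x))
        pointwise : ∀ x → L x + U′ x ≡ ind (base? x) * 1 + (ind (p>0? x) * bit (χ (p⁻ x)) + ind (q>0? x) * bit (χ (q⁻ x)))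
        -- `all` holds on the empty list; these points produce the term K k 0.
        pointwise (zero  , zero  , r , s) = refl
        pointwise (zero  , suc q , r , s) with χ (zero , q , r , s)
        ... | true  = refl
        ... | false = refl
        pointwise (suc p , zero  , r , s) with χ (p , zero , r , s)
        ... | true  = refl
        ... | false = refl
        -- The two lower neighbours of the top point are the two upper neighbours of its translate
        -- by -(1,1,0,0).
        pointwise (suc p , suc q , r , s) with χ (p , suc q , r , s) | χ (suc p , q , r , s)
        ... | true  | true  = refl
        ... | true  | false = refl
        ... | false | true  = refl
        ... | false | false = refl

      -- The mirror image of `lower-count`, with translation by (0,0,1,1). There is no term K,
      -- because `any` fails on the empty list: top points with r = s = 0 contribute nothing.
      upper-count : ∑ Λ (λ x → bit (any χ (up-max x))) + ∑ Λ′ (λ x → bit (all χ (lo-min x))) ≡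
                    ∑ E (λ x → ind (wt x + c ≟ k) * bit (χ x)) + ∑ E (λ x → ind (wt x + d ≟ k) * bit (χ x))
      upper-count = begin
        ∑ Λ U + ∑ Λ′ L             ≡⟨ cong (λ t → ∑ Λ U + t) (∑-rs L) ⟩
        ∑ Λ U + ∑ Λ L′             ≡⟨ ∑-+ U L′ Λ ⟨
        ∑ Λ (λ x → U x + L′ x)     ≡⟨ ∑-cong Λ (λ {x} _ → pointwise x) ⟩
        ∑ Λ (λ x → ind (r>0? x) * bit (χ (r⁻ x)) + ind (s>0? x) * bit (χ (s⁻ x)))
          ≡⟨ ∑-+ (λ x → ind (r>0? x) * bit (χ (r⁻ x))) (λ x → ind (s>0? x) * bit (χ (s⁻ x))) Λ ⟩
        _ ≡⟨ cong₂ _+_ (∑-r (bit ∘ χ)) (∑-s (bit ∘ χ)) ⟨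
        ∑ E (λ x → ind (wt x + c ≟ k) * bit (χ x)) + ∑ E (λ x → ind (wt x + d ≟ k) * bit (χ x)) ∎
        where
        open ≡-Reasoning
        U L L′ : Pt → ℕ
        U x = bit (any χ (up-max x))
        L x = bit (all χ (lo-min x))
        L′ x = ind (r>0? x ×-dec s>0? x) * L (r⁻ (s⁻ x))
        pointwise : ∀ x → U x + L′ x ≡ ind (r>0? x) * bit (χ (r⁻ x)) + ind (s>0? x) * bit (χ (s⁻ x))
        pointwise (p , q , zero  , zero)  = refl
        pointwise (p , q , zero  , suc s) with χ (p , q , zero , s)
        ... | true  = refl
        ... | false = refl
        pointwise (p , q , suc r , zero)  with χ (p , q , r , zero)
        ... | true  = refl
        ... | false = refl
        pointwise (p , q , suc r , suc s) with χ (p , q , r , suc s) | χ (p , q , suc r , s)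
        ... | true  | true  = refl
        ... | true  | false = refl
        ... | false | true  = refl
        ... | false | false = refl

    module _ (y : ℕ → Carrier) (χ : Pt → Bool) where
      open Reseed y
      private
        y₊ y₊′ : Pt → Carrier
        y₊ x = y (suc k ∸ wt x)
        y₊′ x = y′ (k ∸ wt x)

        nlo nup nlo′ nup′ nG nD : Pt → ℕ
        nlo x = bit (all χ (lo-max x))
        nup x = bit (any χ (up-max x))
        nlo′ x = bit (all χ (lo-min x))
        nup′ x = bit (any χ (up-min x))
        nG x = ind (wt x + c ≟ k) * bit (χ x) + ind (wt x + d ≟ k) * bit (χ x)
        nD x = ind (wt x + a ≟ k) * bit (χ x) + ind (wt x + b ≟ k) * bit (χ x)

        y₊′-Λ′ : ∀ {x} → x ∈ Λ′ → y₊′ x ≡ y 1 ⁻¹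
        y₊′-Λ′ {x} x∈ = trans (cong y′ (trans (cong (_∸ wt x) (sym (Λ′⁻ x∈))) (m+n∸m≡n (wt x) N))) y′-N

        ind-label : ∀ {x u} → x ∈ E → ind (k ∸ wt x ≟ u) ≡ ind (wt x + u ≟ k)
        ind-label {x} {u} x∈ = ind-cong (k ∸ wt x ≟ u) (wt x + u ≟ k)
          (λ { refl → m+[n∸m]≡n (<⇒≤ (proj₁ (E⁻ x∈))) })
          (λ { refl → m+n∸m≡n (wt x) u })

        -- Passing from S⁽ᵏ⁺¹⁾ to S⁽ᵏ⁾ lowers the label of a point by one, as the relabelling in
        -- `y′` does. A factor `q` or `w` appears at the labels c, d or a, b, that is, at the
        -- neighbours of the top layer.
        weigh-E : ∀ {x} → x ∈ E → weigh y₊′ χ x ≡ weigh y₊ χ x ⊗ (q ^ nG x ⊗ w ^ nD x)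
        weigh-E {x} x∈ with χ x
        ... | false rewrite *-zeroʳ (ind (wt x + a ≟ k)) | *-zeroʳ (ind (wt x + b ≟ k)) | *-zeroʳ (ind (wt x + c ≟ k)) | *-zeroʳ (ind (wt x + d ≟ k)) =
          sym (trans (identityˡ _) (identityˡ _))
        ... | true = trans (y′-< k∸<N) (cong₂ _⊗_ (cong y (sym (+-∸-assoc 1 (<⇒≤ (proj₁ (E⁻ x∈))))))
            (cong₂ (λ m n → q ^ m ⊗ w ^ n) (cong₂ _+_ (lab c) (lab d)) (cong₂ _+_ (lab a) (lab b))))
          where
          k∸<N : k ∸ wt x < N
          k∸<N = +-cancelˡ-< (wt x) _ _ (≤-trans (≤-reflexive (cong suc (m+[n∸m]≡n (<⇒≤ (proj₁ (E⁻ x∈)))))) (proj₂ (E⁻ x∈)))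
          lab : ∀ u → ind (k ∸ wt x ≟ u) ≡ ind (wt x + u ≟ k) * 1
          lab u = trans (ind-label x∈) (sym (*-identityʳ _))

        -- The possible values 1, 1 + y₁ and y₁ are 1, w and w q: the lower neighbours contribute
        -- `w`, the upper ones `q`.
        local-max : Down E χ → ∀ {x} → x ∈ Λ → Max.local y₊ χ x ≡ w ^ nlo x ⊗ q ^ nup x
        local-max D {x} x∈ with any χ (up-max x) in eqᵤ | all χ (lo-max x) in eqₗ
        ... | true  | true  = trans (cong y (trans (cong (suc k ∸_) (Λ⁻ x∈)) (m+n∸n≡m 1 k)))
                                    (sym (trans (⊗-comm (w ^ 1) (q ^ 1)) (trans (q⊗w 1) (identityʳ _))))
        ... | true  | false = false≢true eqₗ (Max.up⇒lo D x∈ eqᵤ)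
        ... | false | true  = trans (⊕-comm 𝟙 _) (trans (cong (λ u → y u ⊕ 𝟙) (trans (cong (suc k ∸_) (Λ⁻ x∈)) (m+n∸n≡m 1 k)))
                                    (sym (trans (identityʳ _) (identityʳ w))))
        ... | false | false = sym (identityˡ 𝟙)

        -- As `y′ N` is 1 / y₁, the possible values are 1, 1 + 1 / y₁ = 1 / q and 1 / y₁ = 1 / (w
        -- q). Compared with the top layer, the powers are inverted and the two kinds of neighbours
        -- exchange their roles.
        local-min : Down E χ → ∀ {x} → x ∈ Λ′ → Min.local y₊′ χ x ⊗ (w ^ nup′ x ⊗ q ^ nlo′ x) ≡ 𝟙
        local-min D {x} x∈ with any χ (up-min x) in eqᵤ | all χ (lo-min x) in eqₗ
        ... | true  | true  = trans (cong₂ _⊗_ (y₊′-Λ′ x∈) (trans (⊗-comm _ _) (trans (q⊗w 1) (identityʳ _)))) (inverseˡ _)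
        ... | true  | false = false≢true eqₗ (Min.up⇒lo D x∈ eqᵤ)
        ... | false | true  = begin
          (𝟙 ⊕ y₊′ x) ⊗ (𝟙 ⊗ q ^ 1)          ≡⟨ cong₂ (λ u v → (𝟙 ⊕ u) ⊗ v) (y₊′-Λ′ x∈) (trans (identityˡ _) (identityʳ q)) ⟩
          (𝟙 ⊕ y 1 ⁻¹) ⊗ (y 1 ⊗ w ⁻¹)        ≡⟨ ⊗-assoc _ _ _ ⟨
          (𝟙 ⊕ y 1 ⁻¹) ⊗ y 1 ⊗ w ⁻¹          ≡⟨ cong (_⊗ w ⁻¹) (trans (distribʳ (y 1) 𝟙 (y 1 ⁻¹)) (cong₂ _⊕_ (identityˡ (y 1)) (inverseˡ (y 1)))) ⟩
          w ⊗ w ⁻¹                            ≡⟨ inverseʳ w ⟩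
          𝟙                                   ∎
          where open ≡-Reasoning
        ... | false | false = trans (identityˡ _) (identityˡ 𝟙)

      -- Multiplication by the inverse of the product over `Λ′` turns both sides into the weight on
      -- `E` times a monomial in `w` and `q`. The exponents agree by `lower-count` and
      -- `upper-count`.
      layer-balance : Down E χ → ∏ₗ E (weigh y₊ χ) ⊗ ∏ₗ Λ (Max.local y₊ χ) ≡
                      w ^ K k 0 ⊗ (∏ₗ E (weigh y₊′ χ) ⊗ ∏ₗ Λ′ (Min.local y₊′ χ))
      layer-balance D = ⊗-cancelʳ (w ^ ∑ Λ′ nup′ ⊗ q ^ ∑ Λ′ nlo′) (begin
        ∏ₗ E (weigh y₊ χ) ⊗ ∏ₗ Λ (Max.local y₊ χ) ⊗ (w ^ ∑ Λ′ nup′ ⊗ q ^ ∑ Λ′ nlo′)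
          ≡⟨ cong (λ u → X ⊗ u ⊗ (w ^ ∑ Λ′ nup′ ⊗ q ^ ∑ Λ′ nlo′)) (trans (∏ₗ-cong Λ (local-max D)) (∏ₗ-powers w q nlo nup Λ)) ⟩
        X ⊗ (w ^ ∑ Λ nlo ⊗ q ^ ∑ Λ nup) ⊗ (w ^ ∑ Λ′ nup′ ⊗ q ^ ∑ Λ′ nlo′)
          ≡⟨ trans (⊗-assoc X _ _) (cong (X ⊗_) (medial _ _ _ _)) ⟩
        X ⊗ (w ^ ∑ Λ nlo ⊗ w ^ ∑ Λ′ nup′ ⊗ (q ^ ∑ Λ nup ⊗ q ^ ∑ Λ′ nlo′))
          ≡⟨ cong (X ⊗_) (cong₂ _⊗_ (sym (^-+ w (∑ Λ nlo) (∑ Λ′ nup′))) (sym (^-+ q (∑ Λ nup) (∑ Λ′ nlo′)))) ⟩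
        X ⊗ (w ^ (∑ Λ nlo + ∑ Λ′ nup′) ⊗ q ^ (∑ Λ nup + ∑ Λ′ nlo′))
          ≡⟨ cong₂ (λ m n → X ⊗ (w ^ m ⊗ q ^ n)) (trans (lower-count χ) (cong (λ t → K k 0 + t) (sym (∑-+ _ _ E)))) (trans (upper-count χ) (sym (∑-+ _ _ E))) ⟩
        X ⊗ (w ^ (K k 0 + ∑ E nD) ⊗ q ^ ∑ E nG)
          ≡⟨ cong (λ u → X ⊗ (u ⊗ q ^ ∑ E nG)) (^-+ w (K k 0) (∑ E nD)) ⟩
        X ⊗ (w ^ K k 0 ⊗ w ^ ∑ E nD ⊗ q ^ ∑ E nG)
          ≡⟨ solve 4 (λ X u v z → X ⊙ ((u ⊙ v) ⊙ z) ⊜ u ⊙ (X ⊙ (z ⊙ v))) refl X (w ^ K k 0) (w ^ ∑ E nD) (q ^ ∑ E nG) ⟩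
        w ^ K k 0 ⊗ (X ⊗ (q ^ ∑ E nG ⊗ w ^ ∑ E nD))
          ≡⟨ cong (λ u → w ^ K k 0 ⊗ (X ⊗ u)) (∏ₗ-powers q w nG nD E) ⟨
        w ^ K k 0 ⊗ (X ⊗ ∏ₗ E (λ x → q ^ nG x ⊗ w ^ nD x))
          ≡⟨ cong (w ^ K k 0 ⊗_) (trans (∏ₗ-cong E weigh-E) (∏ₗ-⊗ (weigh y₊ χ) _ E)) ⟨
        w ^ K k 0 ⊗ ∏ₗ E (weigh y₊′ χ)
          ≡⟨ cong (w ^ K k 0 ⊗_) (identityʳ _) ⟨
        w ^ K k 0 ⊗ (∏ₗ E (weigh y₊′ χ) ⊗ 𝟙)
          ≡⟨ cong (λ u → w ^ K k 0 ⊗ (∏ₗ E (weigh y₊′ χ) ⊗ u)) min≡𝟙 ⟨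
        w ^ K k 0 ⊗ (∏ₗ E (weigh y₊′ χ) ⊗ (∏ₗ Λ′ (Min.local y₊′ χ) ⊗ (w ^ ∑ Λ′ nup′ ⊗ q ^ ∑ Λ′ nlo′)))
          ≡⟨ solve 4 (λ u v x z → u ⊙ (v ⊙ (x ⊙ z)) ⊜ (u ⊙ (v ⊙ x)) ⊙ z) refl (w ^ K k 0) (∏ₗ E (weigh y₊′ χ)) (∏ₗ Λ′ (Min.local y₊′ χ)) _ ⟩
        w ^ K k 0 ⊗ (∏ₗ E (weigh y₊′ χ) ⊗ ∏ₗ Λ′ (Min.local y₊′ χ)) ⊗ (w ^ ∑ Λ′ nup′ ⊗ q ^ ∑ Λ′ nlo′) ∎)
        where
        open ≡-Reasoning
        open CMSolver using (solve; _⊙_; _⊜_)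
        X = ∏ₗ E (weigh y₊ χ)
        ∏ₗ-powers : ∀ u v (f g : Pt → ℕ) xs → ∏ₗ xs (λ x → u ^ f x ⊗ v ^ g x) ≡ u ^ ∑ xs f ⊗ v ^ ∑ xs g
        ∏ₗ-powers u v f g xs = trans (∏ₗ-⊗ _ _ xs) (cong₂ _⊗_ (∏ₗ-^ u f xs) (∏ₗ-^ v g xs))
        min≡𝟙 : ∏ₗ Λ′ (Min.local y₊′ χ) ⊗ (w ^ ∑ Λ′ nup′ ⊗ q ^ ∑ Λ′ nlo′) ≡ 𝟙
        min≡𝟙 = trans (cong (∏ₗ Λ′ (Min.local y₊′ χ) ⊗_) (sym (∏ₗ-powers w q nup′ nlo′ Λ′)))
                (trans (sym (∏ₗ-⊗ _ _ Λ′)) (∏ₗ-𝟙 Λ′ (local-min D)))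

  -- The factor w^(K k 0) does not depend on the ideal of `E` over which both layers are resummed,
  -- so it leaves the sum.
  Z-suc : ∀ y k → Z y (suc k) ≡ just (Reseed.w y ^ K k 0) ⊠ Z (Reseed.y′ y) k
  Z-suc y k = begin
    Z y (suc k)                                ≡⟨ ∑ideals-↭ _ strip-suc ⟩
    ∑ideals (E ++ Λ) (λ x → y (suc k ∸ wt x))  ≡⟨ Max.∑ideals-layer _ ⟩
    ∑⊆ E ∅ (λ χ → ⟦ does (down? E χ) ⟧ ⊠ just (∏ₗ E (weigh (λ x → y (suc k ∸ wt x)) χ) ⊗ ∏ₗ Λ (Max.local (λ x → y (suc k ∸ wt x)) χ)))
      ≡⟨ ∑⊆-cong E ∅ (λ χ _ → scale (does (down? E χ)) (layer-balance y χ ∘ does-true (down? E χ))) ⟩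
    ∑⊆ E ∅ (λ χ → just (w ^ K k 0) ⊠ (⟦ does (down? E χ) ⟧ ⊠ just (∏ₗ E (weigh (λ x → y′ (k ∸ wt x)) χ) ⊗ ∏ₗ Λ′ (Min.local (λ x → y′ (k ∸ wt x)) χ))))
      ≡⟨ ∑⊆-⊠ (just (w ^ K k 0)) _ E ∅ ⟩
    just (w ^ K k 0) ⊠ ∑⊆ E ∅ (λ χ → ⟦ does (down? E χ) ⟧ ⊠ just (∏ₗ E (weigh (λ x → y′ (k ∸ wt x)) χ) ⊗ ∏ₗ Λ′ (Min.local (λ x → y′ (k ∸ wt x)) χ)))
      ≡⟨ cong (just (w ^ K k 0) ⊠_) (trans (∑ideals-↭ _ strip-same) (Min.∑ideals-layer _)) ⟨
    just (w ^ K k 0) ⊠ Z y′ k ∎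
    where
    open ≡-Reasoning
    open Step k
    open Reseed y
    scale : ∀ b {u v z} → (b ≡ true → u ≡ v ⊗ z) → ⟦ b ⟧ ⊠ just u ≡ just v ⊠ (⟦ b ⟧ ⊠ just z)
    scale false h = refl
    scale true  h = cong just (trans (identityˡ _) (trans (h refl) (cong (_ ⊗_) (sym (identityˡ _)))))

  Z-zero : ∀ z → Z z 0 ≡ just 𝟙
  Z-zero z = trans (∑ideals-↭ _ empty) (cong just (identityˡ 𝟙))
    where
    empty : strip 0 ↭ []
    empty = unique-↭ (strip-unique 0) [] (λ {x} x∈ → ⊥-elim (n≮0 (proj₁ (strip⁻ {0} {x} x∈)))) λ ()

  -- `fresh-suc` and `Z-suc` are the same recursion. The induction is on m with `y` arbitrary, since
  -- the hypothesis is needed at `y′`.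
  fresh-Z : ∀ m y → just (fresh y m) ≡ Z y (suc m)
  fresh-Z zero    y = sym (trans (Z-suc y 0) (trans (cong₂ (λ n z → just (w ^ n) ⊠ z) K-00 (Z-zero y′))
    (cong just (trans (identityʳ _) (trans (identityʳ w) (sym fresh-0))))))
    where open Reseed y
  fresh-Z (suc m) y = trans (cong just fresh≡) (sym (trans (Z-suc y (suc m)) (cong (just (w ^ K (suc m) 0) ⊠_) (sym (fresh-Z m y′)))))
    where
    open Reseed y
    fresh≡ : fresh y (suc m) ≡ w ^ K (suc m) 0 ⊗ fresh y′ m
    fresh≡ = fresh-suc m

-- Comparison with the definitions

ι : Pt → ℤ⁴
ι (p , q , r , s) = + p , + q , ℤ.- + r , ℤ.- + s

ι-inj : ∀ {x z} → ι x ≡ ι z → x ≡ z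
ι-inj {p , q , r , s} {p′ , q′ , r′ , s′} e
  with refl ← ℤₚ.+-injective (cong proj₁ e)
     | refl ← ℤₚ.+-injective (cong (proj₁ ∘ proj₂) e)
     | refl ← ℤₚ.+-injective (ℤₚ.neg-injective (cong (proj₁ ∘ proj₂ ∘ proj₂) e))
     | refl ← ℤₚ.+-injective (ℤₚ.neg-injective (cong (proj₂ ∘ proj₂ ∘ proj₂) e)) = refl

map-cartesianProduct : ∀ {A B C : Set} (f : A × B → C) xs ys →
                       map f (cartesianProduct xs ys) ≡ concatMap (λ x → map (λ z → f (x , z)) ys) xs
map-cartesianProduct f []       ys = refl
map-cartesianProduct f (x ∷ xs) ys = trans (map-++ f (map (x ,_) ys) (cartesianProduct xs ys))
  (cong₂ _++_ (sym (map-∘ ys)) (map-cartesianProduct f xs ys))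

box-ι : ∀ j → box j ≡ map ι (grid (suc j))
box-ι j = sym (trans (cong (map ι) (grid-def (suc j)))
  (trans (map-cartesianProduct ι u _) (concatMap-cong (λ p →
   trans (map-cartesianProduct (λ z → ι (p , z)) u _) (concatMap-cong (λ q →
   map-cartesianProduct (λ z → ι (p , q , z)) u u) u)) u)))
  where u = upTo (suc j)

Sj-unique : ∀ a b c d j → Unique (Sj a b c d j)
Sj-unique a b c d j = Uniqueₚ.filter⁺ (inS? a b c d j) (subst Unique (sym (box-ι j)) (Uniqueₚ.map⁺ ι-inj (grid-unique (suc j))))

module Bridge (a b c d : ℕ) (a>0 : 0 < a) (b>0 : 0 < b) (c>0 : 0 < c) (d>0 : 0 < d) (c+d : c + d ≡ a + b) where
  open Points a b c d (a + b) a>0 b>0 c>0 d>0 refl c+d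

  lin-ι : ∀ x → lin a b c d (ι x) ≡ + wt x
  lin-ι (p , q , r , s) = begin
    + a ℤ.* + p ℤ.+ + b ℤ.* + q ℤ.- + c ℤ.* (ℤ.- + r) ℤ.- + d ℤ.* (ℤ.- + s)
      ≡⟨ solve 8 (λ a b c d p q r s → a :* p :+ b :* q :- c :* (:- r) :- d :* (:- s) := a :* p :+ b :* q :+ c :* r :+ d :* s)
           refl (+ a) (+ b) (+ c) (+ d) (+ p) (+ q) (+ r) (+ s) ⟩
    + a ℤ.* + p ℤ.+ + b ℤ.* + q ℤ.+ + c ℤ.* + r ℤ.+ + d ℤ.* + s
      ≡⟨ cong₂ ℤ._+_ (cong₂ ℤ._+_ (cong₂ ℤ._+_ (sym (ℤₚ.pos-* a p)) (sym (ℤₚ.pos-* b q))) (sym (ℤₚ.pos-* c r))) (sym (ℤₚ.pos-* d s)) ⟩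
    + wt (p , q , r , s) ∎
    where
    open ≡-Reasoning
    open ℤSolver.+-*-Solver

  private
    shift-≤ : ∀ {i k} j → i ℤ.≤ k → i ℤ.+ j ℤ.≤ k ℤ.+ j
    shift-≤ j = ℤₚ.+-monoˡ-≤ j

    sub-add : ∀ i k → i ℤ.- k ℤ.+ k ≡ i
    sub-add i k = solve 2 (λ i k → i :- k :+ k := i) refl i k
      where open ℤSolver.+-*-Solver

    add-sub : ∀ i k → i ℤ.+ k ℤ.- k ≡ i
    add-sub i k = solve 2 (λ i k → i :+ k :- k := i) refl i k
      where open ℤSolver.+-*-Solver

    -≤⁻ : ∀ {i k m} → + i ℤ.- + k ℤ.≤ + m → i ≤ m + k
    -≤⁻ {i} {k} h = ℤₚ.drop‿+≤+ (subst (ℤ._≤ _) (sub-add (+ i) (+ k)) (shift-≤ (+ k) h))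

    -≤⁺ : ∀ {i k m} → i ≤ m + k → + i ℤ.- + k ℤ.≤ + m
    -≤⁺ {i} {k} {m} h = subst (_ ℤ.≤_) (add-sub (+ m) (+ k)) (shift-≤ (ℤ.- + k) (+≤+ h))

    ≤-⁻ : ∀ {i k m} → + m ℤ.≤ + i ℤ.- + k → m + k ≤ i
    ≤-⁻ {i} {k} h = ℤₚ.drop‿+≤+ (subst (_ ℤ.≤_) (sub-add (+ i) (+ k)) (shift-≤ (+ k) h))

    ≤-⁺ : ∀ {i k m} → m + k ≤ i → + m ℤ.≤ + i ℤ.- + k
    ≤-⁺ {i} {k} {m} h = subst (ℤ._≤ _) (add-sub (+ m) (+ k)) (shift-≤ (ℤ.- + k) (+≤+ h))

  -- The involution `g` is the identity for ideals; for filters it is `swap`, and `L` then lists the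
  -- points for the exchanged parameters.
  Sj-↭ : ∀ j (g : Pt → Pt) → (∀ x → g (g x) ≡ x) → ∀ {L} → Unique L →
         (∀ {x} → x ∈ L → wt (g x) < j × j ≤ wt (g x) + (a + b)) →
         (∀ {x} → wt (g x) < j → j ≤ wt (g x) + (a + b) → x ∈ L) →
         Sj a b c d j ↭ map (ι ∘ g) L
  Sj-↭ j g gg {L} u L⁻ L⁺ = unique-↭
    (Sj-unique a b c d j)
    (Uniqueₚ.map⁺ (λ {x} {z} e → trans (sym (gg x)) (trans (cong g (ι-inj e)) (gg z))) u)
    to from
    where
    to : ∀ {v} → v ∈ Sj a b c d j → v ∈ map (ι ∘ g) L
    to {v} v∈ with v∈box , lo , hi , _ ← ∈-filter⁻ (inS? a b c d j) {xs = box j} v∈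
          with x , x∈ , refl ← ∈-map⁻ ι (subst (v ∈_) (box-ι j) v∈box) =
      subst (_∈ map (ι ∘ g) L) (cong ι (gg x)) (∈-map⁺ (ι ∘ g) (L⁺
        (subst (λ z → wt z < j) (sym (gg x)) (subst (_≤ j) (+-comm (wt x) 1) (≤-⁻ (subst (ℤ._≤ _) (lin-ι x) hi))))
        (subst (λ z → j ≤ wt z + (a + b)) (sym (gg x)) (-≤⁻ (subst (_ ℤ.≤_) (lin-ι x) lo)))))
    from : ∀ {v} → v ∈ map (ι ∘ g) L → v ∈ Sj a b c d j
    from v∈ with x , x∈ , refl ← ∈-map⁻ (ι ∘ g) v∈ with wt< , j≤ ← L⁻ x∈ =
      ∈-filter⁺ (inS? a b c d j) (subst (ι (g x) ∈_) (sym (box-ι j)) (∈-map⁺ ι (∈-grid (g x) (≤-trans wt< (n≤1+n j)))))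
        ( subst (_ ℤ.≤_) (sym (lin-ι (g x))) (-≤⁺ j≤)
        , subst (ℤ._≤ _) (sym (lin-ι (g x))) (≤-⁺ (subst (_≤ j) (sym (+-comm (wt (g x)) 1)) wt<))
        , +≤+ z≤n , +≤+ z≤n , ℤₚ.neg-mono-≤ (+≤+ z≤n) , ℤₚ.neg-mono-≤ (+≤+ z≤n) )

neg-≤⁻ : ∀ {m n} → ℤ.- + m ℤ.≤ ℤ.- + n → n ≤ m
neg-≤⁻ h = ℤₚ.drop‿+≤+ (ℤₚ.neg-cancel-≤ h)

neg-≤⁺ : ∀ {m n} → n ≤ m → ℤ.- + m ℤ.≤ ℤ.- + n
neg-≤⁺ h = ℤₚ.neg-mono-≤ (+≤+ h)

swap : Pt → Pt
swap (p , q , r , s) = r , s , p , q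

module _ (a b c d : ℕ) (a>0 : 0 < a) (b>0 : 0 < b) (c>0 : 0 < c) (d>0 : 0 < d)
         (c+d : c + d ≡ a + b) (c≢a : c ≢ a) (c≢b : c ≢ b) (P : Semifield) (y : ℕ → Semifield.Carrier P) where

  open PosetRecursion a b c d a>0 b>0 c>0 d>0 c+d c≢a c≢b P
  open Bridge a b c d a>0 b>0 c>0 d>0 c+d

  idealSum-Z : ∀ j → idealSum P a b c d y j ≡ Z y j
  idealSum-Z j = begin
    idealSum P a b c d y j
      ≡⟨ Iℤ.∑ideals-sublists (λ l → y ∣ ℤ.- lin a b c d l ℤ.+ + j ∣) (Sj-unique a b c d j) (isIdeal? (Sj a b c d j)) ⟩
    Iℤ.∑ideals (Sj a b c d j) (λ l → y ∣ ℤ.- lin a b c d l ℤ.+ + j ∣)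
      ≡⟨ Iℤ.∑ideals-↭ _ (Sj-↭ j (λ x → x) (λ _ → refl) (strip-unique j) (strip⁻ {j}) (strip⁺ {j})) ⟩
    Iℤ.∑ideals (map ι (strip j)) (λ l → y ∣ ℤ.- lin a b c d l ℤ.+ + j ∣)
      ≡⟨ ∑ideals-map P _≟ₚ_ _≟⁴_ _⊴_ _⊴?_ _≼_ _≼?_ ι ι-inj
           (λ (p , q , r , s) → +≤+ p , +≤+ q , neg-≤⁺ r , neg-≤⁺ s)
           (λ (p , q , r , s) → ℤₚ.drop‿+≤+ p , ℤₚ.drop‿+≤+ q , neg-≤⁻ r , neg-≤⁻ s) (strip j) _ ⟩
    ∑ideals (strip j) (λ x → y ∣ ℤ.- lin a b c d (ι x) ℤ.+ + j ∣)
      ≡⟨ I.∑ideals-cong (strip j) (λ {x} x∈ → cong y (label {x} (strip⁻ {j} x∈))) ⟩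
    Z y j ∎
    where
    open ≡-Reasoning
    module I = Ideals P _≟ₚ_ _⊴_ _⊴?_
    module Iℤ = Ideals P _≟⁴_ _≼_ _≼?_
    label : ∀ {x} → wt x < j × j ≤ wt x + N → ∣ ℤ.- lin a b c d (ι x) ℤ.+ + j ∣ ≡ j ∸ wt x
    label {x} (wt< , _) = cong ∣_∣ (trans (cong (λ t → ℤ.- t ℤ.+ + j) (lin-ι x)) (trans (ℤₚ.+-comm (ℤ.- + wt x) (+ j))
      (trans (ℤₚ.m-n≡m⊖n j (wt x)) (ℤₚ.⊖-≥ (<⇒≤ wt<)))))

  next : ℕ → ℕ
  next i = if i ≡ᵇ N then 1 else suc i

  next-range : ∀ {i} → 0 < i → i ≤ N → 0 < next i × next i ≤ N
  next-range {i} i>0 i≤N with i ≟ N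
  ... | yes e rewrite dec-true (i ≟ N) e = z<s , N>0
  ... | no ≢N rewrite dec-false (i ≟ N) ≢N = z<s , ≤∧≢⇒< i≤N ≢N

  fwdV-range : ∀ m → 0 < fwdV N m × fwdV N m ≤ N
  fwdV-range zero    = z<s , N>0
  fwdV-range (suc m) = let p , q = fwdV-range m in next-range p q

  private
    pred-next : ∀ {i} → 0 < i → i ≤ N → pred (next i) ≡ sx (pred i)
    pred-next {suc i} _ _ with suc i ≡ᵇ N
    ... | true  = refl
    ... | false = refl

    pred< : ∀ {i} → 0 < i → i ≤ N → pred i < N
    pred< {suc i} _ i≤N = i≤N

    pred-inj : ∀ {i j} → 0 < i → i ≤ N → 0 < j → j ≤ N → pred i ≡ pred j → i ≡ j
    pred-inj {suc i} {suc j} _ _ _ _ e = cong suc e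

    y-pred : ∀ i → 0 < i → i ≤ N → y i ≡ y (suc (pred i))
    y-pred (suc i) _ _ = refl

    B-pred : ∀ {i j} → 0 < i → i ≤ N → 0 < j → j ≤ N → exchB a b c d i j ≡ e (pred i) (pred j)
    B-pred {suc i} {suc j} _ _ _ _ = refl

    open Mutations a b c d refl y y pred (fwdV N) pred< pred-inj (λ _ → refl)
      (λ m → proj₁ (fwdV-range m)) (λ m → proj₂ (fwdV-range m)) y-pred B-pred

  Fplus-idealSum : ∀ j → 0 < j → just (Fplus P a b c d y j) ≡ idealSum P a b c d y j
  Fplus-idealSum (suc m) _ = trans (cong just (F-fresh next pred-next refl (λ _ → refl) (seedFwd P a b c d y) refl (λ _ → refl) m))
    (trans (fresh-Z m y) (sym (idealSum-Z (suc m))))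

-- Reflection of the quiver and backward mutation

-- Under reflection j = i + u becomes i′ = j′ + u, and the two bounds N < i + u and i ≤ v of a
-- wrap-around arrow become i′ ≤ u and N < i′ + v.
arrows-reverse : ∀ a b c d → c + d ≡ a + b → ∀ {i i′ j j′} → i + i′ ≡ suc (a + b) → j + j′ ≡ suc (a + b) →
                 arrows a b c d i j ≡ arrows c d a b i′ j′
arrows-reverse a b c d c+d {i} {i′} {j} {j′} ii jj = trans
  (+-cong₈ (step a) (step b) (step′ c) (step′ d) (wrap a c) (wrap a d) (wrap b c) (wrap b d))
  (solve 8 (λ s t u v w x y z → s :+ t :+ u :+ v :+ w :+ x :+ y :+ z := u :+ v :+ s :+ t :+ w :+ y :+ x :+ z) refl
     (ind (i′ ≟ j′ + a)) (ind (i′ ≟ j′ + b)) (ind (j′ ≟ i′ + c)) (ind (j′ ≟ i′ + d)) (wrap′ c a) (wrap′ d a) (wrap′ c b) (wrap′ d b))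
  where
  open +-*-Solver
  flip : ∀ {i i′ j j′} u v → i + i′ ≡ j + j′ → j + v ≡ i + u → j′ + u ≡ i′ + v
  flip {i} {i′} {j} {j′} u v e f = +-cancelˡ-≡ (i + j) _ _ (begin
    i + j + (j′ + u)    ≡⟨ solve 4 (λ i j k u → i :+ j :+ (k :+ u) := (j :+ k) :+ (i :+ u)) refl i j j′ u ⟩
    (j + j′) + (i + u)  ≡⟨ cong₂ _+_ e f ⟨
    (i + i′) + (j + v)  ≡⟨ solve 4 (λ i k j v → (i :+ k) :+ (j :+ v) := i :+ j :+ (k :+ v)) refl i i′ j v ⟩
    i + j + (i′ + v)    ∎)
    where open ≡-Reasoning
  ij : i + i′ ≡ j + j′
  ij = trans ii (sym jj)
  i′i : i′ + i ≡ j′ + j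
  i′i = trans (+-comm i′ i) (trans ij (+-comm j j′))
  step : ∀ u → ind (j ≟ i + u) ≡ ind (i′ ≟ j′ + u)
  step u = ind-cong (j ≟ i + u) (i′ ≟ j′ + u)
    (λ e → sym (trans (flip u 0 ij (trans (+-identityʳ j) e)) (+-identityʳ i′)))
    (λ e → trans (sym (+-identityʳ j)) (flip {i′} {i} {j′} {j} 0 u i′i (trans (sym e) (sym (+-identityʳ i′)))))
  step′ : ∀ u → ind (i ≟ j + u) ≡ ind (j′ ≟ i′ + u)
  step′ u = ind-cong (i ≟ j + u) (j′ ≟ i′ + u)
    (λ e → sym (trans (flip u 0 (sym ij) (trans (+-identityʳ i) e)) (+-identityʳ j′)))
    (λ e → trans (sym (+-identityʳ i)) (flip {j′} {j} {i′} {i} 0 u (sym i′i) (trans (sym e) (sym (+-identityʳ j′)))))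
  wrap′ : ℕ → ℕ → ℕ
  wrap′ v u = ind ((j′ + u ≟ i′ + v) ×-dec (c + d <? i′ + v) ×-dec (i′ ≤? u))
  bound : ∀ {x z} u → x + z ≡ suc (a + b) → a + b < x + u → z ≤ u
  bound {x} {z} u e h = +-cancelˡ-≤ x z u (≤-trans (≤-reflexive e) h)
  bound′ : ∀ {x z} u → x + z ≡ suc (a + b) → z ≤ u → a + b < x + u
  bound′ {x} u e h = ≤-trans (≤-reflexive (sym e)) (+-monoʳ-≤ x h)
  i′i≡ : i′ + i ≡ suc (a + b)
  i′i≡ = trans (+-comm i′ i) ii
  wrap : ∀ u v → ind ((j + v ≟ i + u) ×-dec (a + b <? i + u) ×-dec (i ≤? v)) ≡ wrap′ v u
  wrap u v = ind-cong ((j + v ≟ i + u) ×-dec (a + b <? i + u) ×-dec (i ≤? v)) ((j′ + u ≟ i′ + v) ×-dec (c + d <? i′ + v) ×-dec (i′ ≤? u))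
    (λ (e , p , q) → flip u v ij e , subst (_< i′ + v) (sym c+d) (bound′ v i′i≡ q) , bound u ii p)
    (λ (e , p , q) → flip {i′} {i} {j′} {j} v u i′i e , bound′ u ii q , bound v i′i≡ (subst (_< i′ + v) c+d p))

module _ (a b c d : ℕ) (a>0 : 0 < a) (b>0 : 0 < b) (c>0 : 0 < c) (d>0 : 0 < d)
         (c+d : c + d ≡ a + b) (c≢a : c ≢ a) (c≢b : c ≢ b) (P : Semifield) (y : ℕ → Semifield.Carrier P) where

  private
    a≢d : a ≢ d
    a≢d refl = c≢b (+-cancelʳ-≡ a c b (trans c+d (+-comm a b)))

  open PosetRecursion c d a b c>0 d>0 a>0 b>0 (sym c+d) (c≢a ∘ sym) a≢d P
  open Bridge a b c d a>0 b>0 c>0 d>0 c+d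
  private
    module W = Points a b c d (a + b) a>0 b>0 c>0 d>0 refl c+d

  ŷ : ℕ → Carrier
  ŷ l = y (suc N ∸ l)

  wt-swap : ∀ x → W.wt (swap x) ≡ wt x
  wt-swap (p , q , r , s) = solve 8 (λ a b c d p q r s → a :* r :+ b :* s :+ c :* p :+ d :* q := c :* p :+ d :* q :+ a :* r :+ b :* s) refl a b c d p q r s
    where open +-*-Solver

  -- Filters are ideals of the opposite order. In terms of λ, `swap` is the map to -(λ₃ , λ₄ , λ₁ ,
  -- λ₂), which reverses the order and exchanges the two pairs of parameters. A label l of the
  -- exchanged problem is N + 1 - l here, whence `ŷ`.
  filterSum-Z : ∀ j → filterSum P a b c d y j ≡ Z ŷ j
  filterSum-Z j = begin
    filterSum P a b c d y j
      ≡⟨ Iℤ.∑ideals-sublists val (Sj-unique a b c d j) (isFilter? (Sj a b c d j)) ⟩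
    Iℤ.∑ideals (Sj a b c d j) val
      ≡⟨ Iℤ.∑ideals-↭ val (Sj-↭ j swap (λ _ → refl) (strip-unique j) mem⁻ mem⁺) ⟩
    Iℤ.∑ideals (map (ι ∘ swap) (strip j)) val
      ≡⟨ ∑ideals-map P _≟ₚ_ _≟⁴_ _⊴_ _⊴?_ (λ x z → z ≼ x) (λ x z → z ≼? x) (ι ∘ swap) (λ {x} {z} e → cong swap (ι-inj {swap x} {swap z} e))
           (λ (p , q , r , s) → +≤+ r , +≤+ s , neg-≤⁺ p , neg-≤⁺ q)
           (λ (r , s , p , q) → neg-≤⁻ p , neg-≤⁻ q , ℤₚ.drop‿+≤+ r , ℤₚ.drop‿+≤+ s) (strip j) val ⟩
    ∑ideals (strip j) (val ∘ ι ∘ swap)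
      ≡⟨ I.∑ideals-cong (strip j) (λ {x} x∈ → cong y (label {x} (mem⁻ x∈))) ⟩
    Z ŷ j ∎
    where
    open ≡-Reasoning
    module I = Ideals P _≟ₚ_ _⊴_ _⊴?_
    module Iℤ = Ideals P _≟⁴_ (λ x z → z ≼ x) (λ x z → z ≼? x)
    val : ℤ⁴ → Carrier
    val l = y ∣ lin a b c d l ℤ.+ (+ (a + b + 1) ℤ.- + j) ∣
    mem⁻ : ∀ {x} → x ∈ strip j → W.wt (swap x) < j × j ≤ W.wt (swap x) + (a + b)
    mem⁻ {x} x∈ with p , q ← strip⁻ {j} {x} x∈ =
      subst (_< j) (sym (wt-swap x)) p , subst (j ≤_) (cong₂ _+_ (sym (wt-swap x)) c+d) q
    mem⁺ : ∀ {x} → W.wt (swap x) < j → j ≤ W.wt (swap x) + (a + b) → x ∈ strip j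
    mem⁺ {x} p q = strip⁺ {j} {x} (subst (_< j) (wt-swap x) p) (subst (j ≤_) (cong₂ _+_ (wt-swap x) (sym c+d)) q)
    label : ∀ {x} → W.wt (swap x) < j × j ≤ W.wt (swap x) + (a + b) →
            ∣ lin a b c d (ι (swap x)) ℤ.+ (+ (a + b + 1) ℤ.- + j) ∣ ≡ suc N ∸ (j ∸ wt x)
    label {x} (w< , j≤) = begin
      ∣ lin a b c d (ι (swap x)) ℤ.+ (+ (a + b + 1) ℤ.- + j) ∣
        ≡⟨ cong (λ t → ∣ t ℤ.+ (+ (a + b + 1) ℤ.- + j) ∣) (trans (lin-ι (swap x)) (cong +_ (wt-swap x))) ⟩
      ∣ + wt x ℤ.+ (+ (a + b + 1) ℤ.- + j) ∣
        ≡⟨ cong ∣_∣ (sym (ℤₚ.+-assoc (+ wt x) (+ (a + b + 1)) (ℤ.- + j))) ⟩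
      ∣ + (wt x + (a + b + 1)) ℤ.- + j ∣
        ≡⟨ cong ∣_∣ (trans (ℤₚ.m-n≡m⊖n (wt x + (a + b + 1)) j) (ℤₚ.⊖-≥ j≤′)) ⟩
      (wt x + (a + b + 1)) ∸ j
        ≡⟨ cong₂ _∸_ (cong (λ t → wt x + t) (trans (+-comm (a + b) 1) (cong suc (sym c+d)))) (sym (m+[n∸m]≡n (<⇒≤ w<′))) ⟩
      (wt x + suc N) ∸ (wt x + (j ∸ wt x))
        ≡⟨ [m+n]∸[m+o]≡n∸o (wt x) (suc N) (j ∸ wt x) ⟩
      suc N ∸ (j ∸ wt x) ∎
      where
      w<′ : wt x < j
      w<′ = subst (_< j) (wt-swap x) w<
      j≤′ : j ≤ wt x + (a + b + 1)
      j≤′ = ≤-trans (subst (λ t → j ≤ t + (a + b)) (wt-swap x) j≤) (+-monoʳ-≤ (wt x) (m≤m+n (a + b) 1))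

  prev : ℕ → ℕ
  prev i = if i ≡ᵇ 1 then a + b else pred i

  prev-range : ∀ {i} → 0 < i → i ≤ N → 0 < prev i × prev i ≤ N
  prev-range {suc zero}    _ _   = subst (0 <_) c+d N>0 , ≤-reflexive (sym c+d)
  prev-range {suc (suc i)} _ i≤N = z<s , <⇒≤ i≤N

  bwdV-range : ∀ m → 0 < bwdV (a + b) m × bwdV (a + b) m ≤ N
  bwdV-range zero    = subst (0 <_) c+d N>0 , ≤-reflexive (sym c+d)
  bwdV-range (suc m) = let p , q = bwdV-range m in prev-range p q

  private
    mirror< : ∀ {i} → 0 < i → i ≤ N → N ∸ i < N
    mirror< {suc i} _ i≤N = subst (λ t → t ∸ suc i < t) sucN (s≤s (m∸n≤m (pred N) i))

    mirror : ∀ {i} → i ≤ N → i + suc (N ∸ i) ≡ suc (a + b)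
    mirror {i} i≤N = trans (+-suc i (N ∸ i)) (cong suc (trans (m+[n∸m]≡n i≤N) c+d))

    reverse : ∀ {i j} → i ≤ N → j ≤ N → arrows a b c d i j ≡ arrows c d a b (suc (N ∸ i)) (suc (N ∸ j))
    reverse {i} {j} i≤N j≤N = arrows-reverse a b c d c+d {i} {suc (N ∸ i)} {j} {suc (N ∸ j)} (mirror i≤N) (mirror j≤N)

    ∏-reverse : ∀ n (g : ℕ → Carrier) → ∏ n (λ i → g (n ∸ i)) ≡ ∏ n (g ∘ pred)
    ∏-reverse zero    g = refl
    ∏-reverse (suc n) g = trans (∏-first n (λ i → g (suc n ∸ i))) (trans (⊗-comm (g n) _) (cong (_⊗ g n) (∏-reverse n g)))

    prev-sx : ∀ {i} → 0 < i → i ≤ N → N ∸ prev i ≡ sx (N ∸ i)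
    prev-sx {suc zero} _ _ rewrite dec-true (suc (N ∸ 1) ≟ N) sucN = trans (cong (N ∸_) (sym c+d)) (n∸n≡0 N)
    prev-sx {suc (suc i)} _ i≤N = trans N∸≡ (sym sx≡)
      where
      N∸≡ : N ∸ suc i ≡ suc (N ∸ suc (suc i))
      N∸≡ = +-∸-assoc 1 i≤N
      sx≡ : sx (N ∸ suc (suc i)) ≡ suc (N ∸ suc (suc i))
      sx≡ rewrite dec-false (suc (N ∸ suc (suc i)) ≟ N) (λ e → <⇒≢ (mirror< {suc i} z<s (<⇒≤ i≤N)) (trans N∸≡ e)) = refl

    B-mirror : ∀ {i j} → 0 < i → i ≤ N → 0 < j → j ≤ N → exchB a b c d i j ≡ e (N ∸ i) (N ∸ j)
    B-mirror _ i≤N _ j≤N = cong₂ (λ s t → + s ℤ.- + t) (reverse j≤N i≤N) (reverse i≤N j≤N)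

    open Mutations a b c d (sym c+d) y ŷ (λ i → N ∸ i) (bwdV (a + b)) mirror< (λ _ i≤N _ j≤N → ∸-cancelˡ-≡ i≤N j≤N)
      (∏-reverse N) (λ m → proj₁ (bwdV-range m)) (λ m → proj₂ (bwdV-range m))
      (λ i _ i≤N → cong y (sym (m∸[m∸n]≡n i≤N))) B-mirror

  Fminus-filterSum : ∀ j → 0 < j → just (Fminus P a b c d y j) ≡ filterSum P a b c d y j
  Fminus-filterSum (suc m) _ = trans
    (cong just (F-fresh prev prev-sx (trans (cong (N ∸_) (sym c+d)) (n∸n≡0 N)) (λ _ → refl) (seedBwd P a b c d y) refl (λ _ → refl) m))
    (trans (fresh-Z m ŷ) (sym (filterSum-Z (suc m))))

-- Specialization of the initial cluster variables to 1

module _ (P : Semifield) (a b c d : ℕ) where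
  open SemifieldProperties P

  private
    y₁ : ℕ → Carrier
    y₁ _ = 𝟙

  B-xseed : ∀ m → XSeed.Bm (xseedFwd P a b c d y₁ m) ≡ FSeed.Bm (seedFwd P a b c d y₁ m)
  B-xseed zero    = refl
  B-xseed (suc m) = cong (mutB (fwdV (a + b) m)) (B-xseed m)

  -- At y = 1 all coefficient monomials are 1, so the recursion for the F-polynomials coincides step
  -- by step with the one for the cluster variables at x = 1.
  X-xseed : ∀ m i → XSeed.Xv (xseedFwd P a b c d y₁ m) i ≡ FSeed.Fv (seedFwd P a b c d y₁ m) i
  X-xseed zero    i = refl
  X-xseed (suc m) i = cong₂ (λ u v → if i ≡ᵇ k then u else v) new≡ (X-xseed m i)
    where
    open FSeed (seedFwd P a b c d y₁ m) renaming (Bm to B; Cm to C; Fv to F)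
    open XSeed (xseedFwd P a b c d y₁ m) renaming (Bm to B′; Xv to X)
    k = fwdV (a + b) m
    side : ∀ (C : ℕ → ℕ) (f : ℤ → ℕ) → ∏ (a + b) (λ i → X i ^ f (B′ i k)) ≡ ∏ (a + b) (λ i → 𝟙 ^ C i) ⊗ ∏ (a + b) (λ i → F i ^ f (B i k))
    side C f = trans (∏-cong (a + b) (λ i _ _ → cong₂ (λ z M → z ^ f (M i k)) (X-xseed m i) (B-xseed m)))
      (sym (trans (cong (_⊗ _) (trans (∏-cong (a + b) (λ i _ _ → 𝟙-^ (C i))) (∏-𝟙 (a + b)))) (identityˡ _)))
    new≡ : (∏ (a + b) (λ i → X i ^ [ B′ i k ]₊) ⊕ ∏ (a + b) (λ i → X i ^ [ ℤ.- B′ i k ]₊)) ⊗ (X k ⁻¹) ≡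
           (∏ (a + b) (λ i → 𝟙 ^ [ C i k ]₊) ⊗ ∏ (a + b) (λ i → F i ^ [ B i k ]₊)
             ⊕ ∏ (a + b) (λ i → 𝟙 ^ [ ℤ.- C i k ]₊) ⊗ ∏ (a + b) (λ i → F i ^ [ ℤ.- B i k ]₊)) ⊗ (F k ⁻¹)
    new≡ = cong₂ _⊗_ (cong₂ _⊕_ (side (λ i → [ C i k ]₊) [_]₊) (side (λ i → [ ℤ.- C i k ]₊) ([_]₊ ∘ ℤ.-_))) (cong _⁻¹ (X-xseed m k))

  xPlus-Fplus : ∀ j → xPlus P a b c d y₁ j ≡ Fplus P a b c d y₁ j
  xPlus-Fplus zero    = refl
  xPlus-Fplus (suc m) = X-xseed (suc m) (fwdV (a + b) m)

  prodL-𝟙 : ∀ {A : Set} (xs : List A) → prodL P (map (λ _ → 𝟙) xs) ≡ 𝟙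
  prodL-𝟙 []       = refl
  prodL-𝟙 (x ∷ xs) = trans (identityˡ _) (prodL-𝟙 xs)

  sumL-𝟙 : ∀ {A : Set} (xss : List (List A)) → sumL P (map (λ xs → prodL P (map (λ _ → 𝟙) xs)) xss) ≡ natP P (length xss)
  sumL-𝟙 []         = refl
  sumL-𝟙 (xs ∷ xss) = cong₂ (_⊕?_ P) (cong just (prodL-𝟙 xs)) (sumL-𝟙 xss)

theorem5p6 : (a b c d : ℕ) → 0 < a → 0 < b → 0 < c → 0 < d →
    c + d ≡ a + b → gcd (gcd a c) (a + b) ≡ 1 → c ≢ a → c ≢ b →
    ((P : Semifield) (y : ℕ → Semifield.Carrier P) (j : ℕ) → 0 < j →
    (just (Fminus P a b c d y j) ≡ filterSum P a b c d y j)
    × (just (Fplus P a b c d y j) ≡ idealSum P a b c d y j))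
    × ((P : Semifield) (j : ℕ) → 0 < j →
    just (xPlus P a b c d (λ _ → Semifield.𝟙 P) j) ≡ natP P (length (idealsS a b c d j)))
theorem5p6 a b c d a>0 b>0 c>0 d>0 c+d _ c≢a c≢b =
  (λ P y j j>0 → Fminus-filterSum a b c d a>0 b>0 c>0 d>0 c+d c≢a c≢b P y j j>0
               , Fplus-idealSum a b c d a>0 b>0 c>0 d>0 c+d c≢a c≢b P y j j>0) ,
  (λ P j j>0 → trans (cong just (xPlus-Fplus P a b c d j))
    (trans (Fplus-idealSum a b c d a>0 b>0 c>0 d>0 c+d c≢a c≢b P (λ _ → Semifield.𝟙 P) j j>0)
           (sumL-𝟙 P a b c d (idealsS a b c d j))))
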